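{- Let $q\in\mathbb{N}$ be prime and let $\varepsilon,\delta\in(0,1)$. There exist constants $c_1,c_2>0$ and $r_0$, depending only on $q,\delta,\varepsilon$, such that the following holds. Let $n,d,r,\Delta,e\in\mathbb{N}$ be such that $r\ge r_0$, $r=(q-1)n-d$, $q^{\varepsilon r}\le\Delta\le q^{\frac{r}{4(q-1)}-2}$, and $\delta r\le e\le \frac{r}{8}$. Then there is a $\Delta'\ge q^{c_1 r}$ such that, given any $f:\mathbb{F}_q^n\to\mathbb{F}_q$ that is $\Delta$-far from $\mathcal{P}_q(n,d)$, and for $P$ chosen uniformly at random from $\mathcal{P}_q(n,e)$, we have \[ \Pr_{P}\left[\Delta(f\cdot P,\mathcal{P}_q(n,d+e))<\Delta'\right]\le\frac{1}{q^{q^{c_2 r}}}. \]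
   Context: $\mathbb{N}=\{1,2,3,\ldots\}$. $\mathbb{F}_q$ is the finite field with $q$ elements. $\mathcal{P}_q(n,d)$ (the Reed-Muller code) is the set of functions $\mathbb{F}_q^n\to\mathbb{F}_q$ that are evaluations of polynomials in $n$ variables over $\mathbb{F}_q$ of total degree at most $d$. Products of functions are pointwise. For $f,g:\mathbb{F}_q^n\to\mathbb{F}_q$ the (absolute) Hamming distance is $\Delta(f,g)=\#\{x\in\mathbb{F}_q^n: f(x)\ne g(x)\}$, and for a set $\mathcal{G}$ of functions $\Delta(f,\mathcal{G})=\min_{g\in\mathcal{G}}\Delta(f,g)$. For a number $\Delta$, $f$ is $\Delta$-far from $\mathcal{G}$ if $\Delta(f,\mathcal{G})>\Delta$. -}

module Defs where

open import Algebra.Bundles using (CommutativeRing)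
open import Data.Empty using (⊥-elim)
open import Data.Fin.Base using (Fin; toℕ; finToFun; funToFin)
import Data.Fin.Properties as Fin
open import Data.Integer.Base as ℤ using (ℤ; +_; -[1+_]; ∣_∣)
import Data.Integer.Properties as ℤ
open import Data.List.Base using (List; map; filter; length; allFin)
open import Data.List.Extrema.Nat using (min)
open import Data.List.Membership.Propositional using (_∈_)
open import Data.List.Membership.Propositional.Properties using (∈-filter⁺; ∈-map⁺; ∈-allFin)
open import Data.List.Relation.Unary.Any using (here; there)
open import Data.Nat.Base as ℕ using (ℕ; zero; suc; NonZero; _∸_; s≤s; z≤n)
open import Data.Nat.DivMod using (_mod_)
open import Data.Nat.Primality using (Prime)
import Data.Nat.Properties as ℕ
open import Data.Product.Base using (∃; ∃-syntax; _×_; _,_)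
open import Data.Rational.Base as ℚ using (ℚ; 0ℚ; 1ℚ; ↥_; ↧_; ↧ₙ_)
open import Data.Rational.Literals using (fromℤ)
import Data.Rational.Properties as ℚ
open import Data.Vec.Base as Vec using (Vec; []; _∷_)
import Data.Vec.Properties as Vec
open import Function.Base using (_∘_)
open import Relation.Binary.PropositionalEquality using (_≡_; refl; sym; trans; cong; subst)
open import Relation.Nullary using (¬_; Dec; yes; no)
open import Relation.Nullary.Decidable using (map′; ¬?)
open import Relation.Unary using (Decidable)

4*[q∸1]-nonZero : ∀ {q} → Prime q → NonZero (4 ℕ.* (q ∸ 1))
4*[q∸1]-nonZero {suc (suc _)} _ = _

------------------------------------------------------------------------
-- Real numbers

-- Dedekind's lower cuts of ℚ: nonempty, proper, downward closed, without
-- a greatest element.  Classically these are exactly the real numbers.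

record ℝ : Set₁ where
  field
    _∋_       : ℚ → Set
    inhabited : ∃ _∋_
    proper    : ∃[ s ] ¬ _∋_ s
    lower     : ∀ {s t} → s ℚ.< t → _∋_ t → _∋_ s
    open′     : ∀ {s} → _∋_ s → ∃[ t ] s ℚ.< t × _∋_ t

open ℝ using (_∋_)

infix 4 _≤ᴿ_ _<ᴿ_

_≤ᴿ_ : ℝ → ℝ → Set
x ≤ᴿ y = ∀ s → x ∋ s → y ∋ s

_<ᴿ_ : ℝ → ℝ → Set
x <ᴿ y = ∃[ s ] (y ∋ s × ¬ x ∋ s)

private
  below : ∀ s → s ℚ.- 1ℚ ℚ.< s
  below s = subst (s ℚ.- 1ℚ ℚ.<_) (ℚ.+-identityʳ s)
    (ℚ.+-monoʳ-< s (ℚ.negative⁻¹ (ℚ.- 1ℚ)))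

-- The supremum of a nonempty set of rationals with a rational upper bound.
sup : (S : ℚ → Set) → ∃ S → ∃[ b ] (∀ s → S s → s ℚ.≤ b) → ℝ
sup S (a , a∈S) (b , ≤b) = record
  { _∋_       = λ s → ∃[ t ] (S t × s ℚ.< t)
  ; inhabited = a ℚ.- 1ℚ , a , a∈S , below a
  ; proper    = b , λ (t , t∈S , b<t) → ℚ.<-irrefl refl (ℚ.<-≤-trans b<t (≤b t t∈S))
  ; lower     = λ s<s′ (t , t∈S , s′<t) → t , t∈S , ℚ.<-trans s<s′ s′<t
  ; open′     = λ (t , t∈S , s<t) → let (m , s<m , m<t) = ℚ.<-dense s<t
                                    in m , s<m , t , t∈S , m<t
  }

ℚ→ℝ : ℚ → ℝ
ℚ→ℝ a = sup (_≡ a) (a , refl) (a , λ _ → ℚ.≤-reflexive)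

ℕ→ℚ : ℕ → ℚ
ℕ→ℚ n = fromℤ (+ n)

ℕ→ℝ : ℕ → ℝ
ℕ→ℝ n = ℚ→ℝ (ℕ→ℚ n)

private
  ∈⇒≤ : ∀ x {b t} → ¬ x ∋ b → x ∋ t → t ℚ.≤ b
  ∈⇒≤ x {b} {t} b∉x t∈x with t ℚ.≤? b
  ... | yes t≤b = t≤b
  ... | no  t≰b = ⊥-elim (b∉x (ℝ.lower x (ℚ.≰⇒> t≰b) t∈x))

infixl 7 _·ᴿ_
infix  8 -ᴿ_

_·ᴿ_ : ℝ → ℕ → ℝ
x ·ᴿ n = sup (λ s → ∃[ t ] (x ∋ t × s ≡ t ℚ.* ℕ→ℚ n))
  (let (t , t∈x) = ℝ.inhabited x in _ , t , t∈x , refl)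
  (let (b , b∉x) = ℝ.proper x in b ℚ.* ℕ→ℚ n , λ where
     _ (t , t∈x , refl) → ℚ.*-monoʳ-≤-nonNeg (ℕ→ℚ n) (∈⇒≤ x b∉x t∈x))

private
  neg-neg : ∀ s → ℚ.- (ℚ.- s) ≡ s
  neg-neg = ⁻¹-involutive
    where open import Algebra.Properties.Group ℚ.+-0-group using (⁻¹-involutive)

-ᴿ_ : ℝ → ℝ
-ᴿ x = sup (λ s → ¬ x ∋ (ℚ.- s))
  (let (b , b∉x) = ℝ.proper x in ℚ.- b , subst (λ s → ¬ x ∋ s) (sym (neg-neg b)) b∉x)
  (let (a , a∈x) = ℝ.inhabited x in ℚ.- a , λ s -s∉x →
     subst (ℚ._≤ ℚ.- a) (neg-neg s) (ℚ.neg-antimono-≤ (∈⇒≤ x -s∉x a∈x)))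

open import Algebra.Properties.Semiring.Exp
  (CommutativeRing.semiring ℚ.+-*-commutativeRing) public
  using () renaming (_^_ to _^ℚ_)

infixr 8 _^ℤ_ _^ᴿ_

_^ℤ_ : (b : ℕ) .{{_ : NonZero b}} → ℤ → ℚ
b ^ℤ (+ n)      = ℕ→ℚ b ^ℚ n
b ^ℤ (-[1+ n ]) = (ℚ.1/ ℕ→ℚ b) ^ℚ suc n

-- s ≤ b^(p/m), for s ≥ 0, is the inequality s^m ≤ b^p.
BelowPower : (b : ℕ) .{{_ : NonZero b}} → ℚ → ℚ → Set
BelowPower b t s = 0ℚ ℚ.≤ s × s ^ℚ (↧ₙ t) ℚ.≤ b ^ℤ (↥ t)

private
  open import Algebra.Properties.Semiring.Exp
    (CommutativeRing.semiring ℚ.+-*-commutativeRing) using (^-assocʳ)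

  0≤* : ∀ {x y} → 0ℚ ℚ.≤ x → 0ℚ ℚ.≤ y → 0ℚ ℚ.≤ x ℚ.* y
  0≤* {x} {y} 0≤x 0≤y = subst (ℚ._≤ x ℚ.* y) (ℚ.*-zeroˡ y)
    (ℚ.*-monoʳ-≤-nonNeg y {{ℚ.nonNegative 0≤y}} 0≤x)

  *-mono : ∀ {x y u v} → 0ℚ ℚ.≤ u → 0ℚ ℚ.≤ y → x ℚ.≤ y → u ℚ.≤ v → x ℚ.* u ℚ.≤ y ℚ.* v
  *-mono {x} {y} {u} {v} 0≤u 0≤y x≤y u≤v = ℚ.≤-trans
    (ℚ.*-monoʳ-≤-nonNeg u {{ℚ.nonNegative 0≤u}} x≤y)
    (ℚ.*-monoˡ-≤-nonNeg y {{ℚ.nonNegative 0≤y}} u≤v)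

  0≤1 : 0ℚ ℚ.≤ 1ℚ
  0≤1 = ℚ.nonNegative⁻¹ 1ℚ

  0≤^ : ∀ {x} n → 0ℚ ℚ.≤ x → 0ℚ ℚ.≤ x ^ℚ n
  0≤^ zero    0≤x = 0≤1
  0≤^ (suc n) 0≤x = 0≤* 0≤x (0≤^ n 0≤x)

  ^-mono : ∀ {x y} n → 0ℚ ℚ.≤ x → x ℚ.≤ y → x ^ℚ n ℚ.≤ y ^ℚ n
  ^-mono zero    _   _   = ℚ.≤-refl
  ^-mono (suc n) 0≤x x≤y = *-mono (0≤^ n 0≤x) (ℚ.≤-trans 0≤x x≤y) x≤y (^-mono n 0≤x x≤y)

  1^ : ∀ n → 1ℚ ^ℚ n ≡ 1ℚ
  1^ zero    = refl
  1^ (suc n) = trans (ℚ.*-identityˡ _) (1^ n)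

  1≤^ : ∀ {x} n → 1ℚ ℚ.≤ x → 1ℚ ℚ.≤ x ^ℚ n
  1≤^ {x} n 1≤x = subst (ℚ._≤ x ^ℚ n) (1^ n) (^-mono n 0≤1 1≤x)

  ^≤1 : ∀ {x} n → 0ℚ ℚ.≤ x → x ℚ.≤ 1ℚ → x ^ℚ n ℚ.≤ 1ℚ
  ^≤1 {x} n 0≤x x≤1 = subst (x ^ℚ n ℚ.≤_) (1^ n) (^-mono n 0≤x x≤1)

  ^-monoʳ : ∀ {x m n} → 1ℚ ℚ.≤ x → m ℕ.≤ n → x ^ℚ m ℚ.≤ x ^ℚ n
  ^-monoʳ {n = n} 1≤x z≤n = 1≤^ n 1≤x
  ^-monoʳ {x} {suc m} 1≤x (s≤s m≤n) =
    ℚ.*-monoˡ-≤-nonNeg x {{ℚ.nonNegative (ℚ.≤-trans 0≤1 1≤x)}} (^-monoʳ 1≤x m≤n)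

  ^-cancel-≤ : ∀ {x y} n → 1ℚ ℚ.≤ y → x ^ℚ suc n ℚ.≤ y ^ℚ suc n → x ℚ.≤ y
  ^-cancel-≤ {x} {y} n 1≤y h with x ℚ.≤? y
  ... | yes x≤y = x≤y
  ... | no  x≰y = ⊥-elim (ℚ.<-irrefl refl (ℚ.<-≤-trans lt h))
    where
    y<x : y ℚ.< x
    y<x = ℚ.≰⇒> x≰y
    0≤y = ℚ.≤-trans 0≤1 1≤y
    0<yⁿ : 0ℚ ℚ.< y ^ℚ n
    0<yⁿ = ℚ.<-≤-trans (ℚ.positive⁻¹ 1ℚ) (1≤^ n 1≤y)
    lt : y ^ℚ suc n ℚ.< x ^ℚ suc n
    lt = ℚ.<-≤-trans
      (ℚ.*-monoˡ-<-pos (y ^ℚ n) {{ℚ.positive 0<yⁿ}} y<x)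
      (ℚ.*-monoˡ-≤-nonNeg x {{ℚ.nonNegative (ℚ.≤-trans 0≤y (ℚ.<⇒≤ y<x))}}
        (^-mono n 0≤y (ℚ.<⇒≤ y<x)))

  1≤ℕ→ℚ : ∀ b → .{{NonZero b}} → 1ℚ ℚ.≤ ℕ→ℚ b
  1≤ℕ→ℚ (suc b) = ℚ.*≤* (ℤ.+≤+ (s≤s z≤n))

  0≤1/ : ∀ b → .{{_ : NonZero b}} → 0ℚ ℚ.≤ ℚ.1/ ℕ→ℚ b
  0≤1/ (suc b) = ℚ.nonNegative⁻¹ _

  1/≤1 : ∀ b → .{{_ : NonZero b}} → ℚ.1/ ℕ→ℚ b ℚ.≤ 1ℚ
  1/≤1 (suc b) = ℚ.*≤* (ℤ.+≤+ (s≤s z≤n))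

  0≤^ℤ : ∀ b → .{{_ : NonZero b}} → ∀ p → 0ℚ ℚ.≤ b ^ℤ p
  0≤^ℤ b (+ n)    = 0≤^ n (ℚ.≤-trans 0≤1 (1≤ℕ→ℚ b))
  0≤^ℤ b -[1+ n ] = 0≤^ (suc n) (0≤1/ b)

  ^ℤ-≤ : ∀ b → .{{_ : NonZero b}} → ∀ p k m → p ℤ.≤ + k ℤ.* + m → b ^ℤ p ℚ.≤ (ℕ→ℚ b ^ℚ k) ^ℚ m
  ^ℤ-≤ b (+ p) k m h = subst (b ^ℤ (+ p) ℚ.≤_) (sym (^-assocʳ (ℕ→ℚ b) k m))
    (^-monoʳ (1≤ℕ→ℚ b) (ℤ.drop‿+≤+ (subst (+ p ℤ.≤_) (sym (ℤ.pos-* k m)) h)))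
  ^ℤ-≤ b (-[1+ p ]) k m h = ℚ.≤-trans (^≤1 (suc p) (0≤1/ b) (1/≤1 b))
    (1≤^ m (1≤^ k (1≤ℕ→ℚ b)))

  ≤∣↥∣ : ∀ t → t ℚ.≤ ℕ→ℚ ∣ ↥ t ∣
  ≤∣↥∣ t = ℚ.*≤* (ℤ.≤-trans (ℤ.≤-reflexive (ℤ.*-identityʳ (↥ t)))
    (aux (↥ t) (ℚ.denominator-1 t)))
    where
    aux : ∀ p d → p ℤ.≤ + ∣ p ∣ ℤ.* + suc d
    aux (+ p)      d = subst (+ p ℤ.≤_) (ℤ.pos-* p (suc d)) (ℤ.+≤+ (ℕ.m≤m*n p (suc d)))
    aux (-[1+ p ]) d = ℤ.-≤+

  BelowPower-bound : ∀ b → .{{_ : NonZero b}} → ∀ {t s} k → t ℚ.≤ ℕ→ℚ k →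
                     BelowPower b t s → s ℚ.≤ ℕ→ℚ b ^ℚ k
  BelowPower-bound b {t} k t≤k (_ , h) =
    ^-cancel-≤ (ℚ.denominator-1 t) (1≤^ k (1≤ℕ→ℚ b))
      (ℚ.≤-trans h (^ℤ-≤ b (↥ t) k (↧ₙ t)
        (subst (ℤ._≤ + k ℤ.* ↧ t) (ℤ.*-identityʳ (↥ t)) (ℚ.drop-*≤* t≤k))))

-- b^x for a natural number b ≥ 1 and a real x, as the supremum of the
-- powers b^t with rational t < x.
_^ᴿ_ : (b : ℕ) .{{_ : NonZero b}} → ℝ → ℝ
b ^ᴿ x = sup (λ s → ∃[ t ] (x ∋ t × BelowPower b t s))
  (let (t , t∈x) = ℝ.inhabited x in 0ℚ , t , t∈x , ℚ.≤-refl ,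
     subst (ℚ._≤ b ^ℤ (↥ t)) (sym (ℚ.*-zeroˡ (0ℚ ^ℚ ℚ.denominator-1 t))) (0≤^ℤ b (↥ t)))
  (let (u , u∉x) = ℝ.proper x in ℕ→ℚ b ^ℚ ∣ ↥ u ∣ , λ s (t , t∈x , h) →
     BelowPower-bound b ∣ ↥ u ∣ (ℚ.≤-trans (∈⇒≤ x u∉x t∈x) (≤∣↥∣ u)) h)

------------------------------------------------------------------------
-- Reed–Muller codes over 𝔽_q = ℤ/q, q prime

module _ {q : ℕ} .{{_ : NonZero q}} where

  infixl 6 _+F_
  infixl 7 _*F_
  infixr 8 _^F_

  0F 1F : Fin q
  0F = 0 mod q
  1F = 1 mod q

  _+F_ _*F_ : Fin q → Fin q → Fin q
  a +F b = (toℕ a ℕ.+ toℕ b) mod q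
  a *F b = (toℕ a ℕ.* toℕ b) mod q

  _^F_ : Fin q → ℕ → Fin q
  a ^F zero  = 1F
  a ^F suc k = a *F a ^F k

toVec : ∀ {k n} → Fin (k ℕ.^ n) → Vec (Fin k) n
toVec = Vec.tabulate ∘ finToFun

fromVec : ∀ {k n} → Vec (Fin k) n → Fin (k ℕ.^ n)
fromVec = funToFin ∘ Vec.lookup

private
  toVec-fromVec : ∀ {k n} (v : Vec (Fin k) n) → toVec (fromVec v) ≡ v
  toVec-fromVec v = trans
    (Vec.tabulate-cong (Fin.finToFun-funToFin (Vec.lookup v)))
    (Vec.tabulate∘lookup v)

vectors : ∀ k n → List (Vec (Fin k) n)
vectors k n = map toVec (allFin (k ℕ.^ n))

anyVec? : ∀ {k n} {P : Vec (Fin k) n → Set} → Decidable P → Dec (∃ P)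
anyVec? {P = P} P? = map′
  (λ (i , p) → toVec i , p)
  (λ (v , p) → fromVec v , subst P (sym (toVec-fromVec v)) p)
  (Fin.any? (P? ∘ toVec))

allVec? : ∀ {k n} {P : Vec (Fin k) n → Set} → Decidable P → Dec (∀ v → P v)
allVec? {P = P} P? = map′
  (λ h v → subst P (toVec-fromVec v) (h (fromVec v)))
  (λ h i → h (toVec i))
  (Fin.all? (P? ∘ toVec))

-- The exponent vectors (m₁,…,mₙ) ∈ ℕⁿ with m₁ + … + mₙ ≤ d; each entry
-- of such a vector is at most d.
monomials : (n d : ℕ) → List (Vec ℕ n)
monomials n d = filter (λ m → Vec.sum m ℕ.≤? d) (map (Vec.map toℕ) (vectors (suc d) n))

-- A polynomial in n variables of total degree at most d, given by its
-- coefficients at the monomials of degree at most d.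
Polynomial : (q n d : ℕ) → Set
Polynomial q n d = Vec (Fin q) (length (monomials n d))

Fun : (q n : ℕ) → Set
Fun q n = Vec (Fin q) n → Fin q

module _ {q : ℕ} .{{_ : NonZero q}} {n : ℕ} where

  monomialAt : Vec ℕ n → Fun q n
  monomialAt m x = Vec.foldr′ _*F_ 1F (Vec.zipWith _^F_ x m)

  eval : ∀ {d} → Polynomial q n d → Fun q n
  eval {d} c x = Vec.foldr′ _+F_ 0F
    (Vec.zipWith (λ a m → a *F monomialAt m x) c (Vec.fromList (monomials n d)))

  infixl 7 _·_

  _·_ : Fun q n → Fun q n → Fun q n
  (f · g) x = f x *F g x

  0-fun : Fun q n
  0-fun _ = 0F

private
  0F*a+0F≡0F : ∀ {q} .{{_ : NonZero q}} (a : Fin q) → 0F *F a +F 0F ≡ 0F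
  0F*a+0F≡0F {suc q} a = refl

-- Every function 𝔽_qⁿ → 𝔽_q exactly once, up to pointwise equality.
functions : (q n : ℕ) → List (Fun q n)
functions q n = map (λ i x → finToFun i (fromVec x)) (allFin (q ℕ.^ (q ℕ.^ n)))

module _ (q : ℕ) .{{_ : NonZero q}} (n d : ℕ) where

  InReedMuller : Fun q n → Set
  InReedMuller f = ∃[ c ] (∀ x → f x ≡ eval {q} {n} {d} c x)

  inReedMuller? : Decidable InReedMuller
  inReedMuller? f = anyVec? λ c → allVec? λ x → f x Fin.≟ eval {q} {n} {d} c x

  -- The code 𝒫_q(n,d), each element listed exactly once.
  reedMuller : List (Fun q n)
  reedMuller = filter inReedMuller? (functions q n)

  private
    zero-index : Fin (q ℕ.^ (q ℕ.^ n))
    zero-index = funToFin {q ℕ.^ n} λ _ → 0F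

    eval-0 : ∀ {k} (ms : Vec (Vec ℕ n) k) x → Vec.foldr′ _+F_ 0F
      (Vec.zipWith (λ a m → a *F monomialAt {q} m x) (Vec.replicate k 0F) ms) ≡ 0F
    eval-0 []       x = refl
    eval-0 (m ∷ ms) x = trans
      (cong ((0F *F monomialAt {q} m x) +F_) (eval-0 ms x))
      (0F*a+0F≡0F (monomialAt {q} m x))

  reedMuller-nonEmpty : NonZero (length reedMuller)
  reedMuller-nonEmpty = nonEmpty (∈-filter⁺ inReedMuller?
    (∈-map⁺ _ (∈-allFin zero-index))
    (Vec.replicate _ 0F , λ x → trans
      (Fin.finToFun-funToFin (λ _ → 0F) (fromVec x))
      (sym (eval-0 (Vec.fromList (monomials n d)) x))))
    where
    nonEmpty : ∀ {A : Set} {x : A} {xs} → x ∈ xs → NonZero (length xs)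
    nonEmpty (here _)  = _
    nonEmpty (there _) = _

module _ {q : ℕ} .{{_ : NonZero q}} {n : ℕ} where

  hamming : Fun q n → Fun q n → ℕ
  hamming f g = length (filter (λ x → ¬? (f x Fin.≟ g x)) (vectors q n))

  -- Δ(f, 𝒫_q(n,d)).  The starting value of the minimum is itself one of the
  -- distances, since 0 ∈ 𝒫_q(n,d).
  distance : Fun q n → (d : ℕ) → ℕ
  distance f d = min (hamming f 0-fun) (map (hamming f) (reedMuller q n d))

Far : ∀ {q} .{{_ : NonZero q}} {n} → ℕ → Fun q n → ℕ → Set
Far Δ f d = distance f d ℕ.> Δ

-- The probability of E for a uniformly random entry of the list xs.
probability : ∀ {A : Set} (xs : List A) .{{_ : NonZero (length xs)}}
              {E : A → Set} → Decidable E → ℚ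
probability xs E? = + length (filter E? xs) ℚ./ length xs

-- Pr_P[ Δ(f·P, 𝒫_q(n,d+e)) < Δ′ ] for P uniform in 𝒫_q(n,e).
prCloseProduct : ∀ {q} .{{_ : NonZero q}} {n} → Fun q n → (d e Δ′ : ℕ) → ℚ
prCloseProduct {q} {n} f d e Δ′ =
  probability (reedMuller q n e) {{reedMuller-nonEmpty q n e}}
    (λ P → distance (f · P) (d ℕ.+ e) ℕ.<? Δ′)

{-# OPTIONS --safe #-}

-- By duality f is studied through the functional h ↦ ⟨ f , h ⟩ = Σₓ f(x) h(x) on polynomials
-- of degree ≤ N = r − 1, since 𝒫(n,d) is the annihilator of 𝒫(n,N).  A product f · P close to
-- 𝒫(n,d+e) is, on degree ≤ N − e, a combination of few point evaluations; so it suffices to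
-- find many functionals Φⱼ on 𝒫(n,e) with a nondegenerate matrix Φⱼ(Bᵢ) whose values at such
-- P are combinations of few columns of a fixed small matrix G, and to count.
--
-- Reduce the monomials of degree 2e modulo the polynomials annihilated by degree ≤ N − 2e.
-- If one of them, u, does not reduce to lower degree, take u lex-minimal: a dual witness h
-- makes the matrix ⟨ f , V W h ⟩, for V and W = u / V of degree e, triangular, and u has
-- exponentially many divisors of degree e.  If all reduce, the functional has a flat extension:
-- the coordinate functions act as commuting diagonalisable operators on a finite quotient, and
-- their joint eigenvectors exhibit the functional as a combination of evaluations at points that
-- are separated by polynomials of degree < 2e.  There are more than Δ such points because f is
-- far, and at least √Δ of them are independent for polynomials of degree e, as the products of
-- two such polynomials separate all of them.
module Submission where

open import Defs
open import Algebra.Bundles using (CommutativeRing)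
open import Algebra.Consequences.Propositional using (comm∧idˡ⇒id; comm∧invˡ⇒inv)
open import Algebra.Structures using (IsCommutativeRing)
open import Data.Empty using (⊥)
open import Data.Fin.Base
  using (Fin; toℕ; zero; suc; _↑ˡ_; _↑ʳ_; combine; finToFun; fromℕ<; funToFin; remQuot; splitAt;
         join; inject≤)
open import Data.Fin.Permutation using (permutation)
import Data.Fin.Properties as Fin
open import Data.List.Base as List using (List; []; _∷_; filter; length; allFin)
open import Data.List.Extrema.Nat using (min; min≤xs; argmin-sel)
open import Data.List.Membership.Propositional using (_∈_; find)
open import Data.List.Membership.Propositional.Properties
  using (∈-filter⁺; ∈-map⁺; ∈-allFin; ∈-filter⁻; ∈-map⁻; ∈-lookup)
import Data.List.Membership.Setoid as SetoidMembership
import Data.List.Membership.Setoid.Properties as SetoidMembershipₚ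
import Data.List.Properties as List
open import Data.List.Relation.Unary.All as All using (All; []; _∷_)
import Data.List.Relation.Unary.All.Properties as All
open import Data.List.Relation.Unary.AllPairs using (_∷_)
open import Data.List.Relation.Unary.Any as Any using (here; there)
import Data.List.Relation.Unary.Unique.Propositional.Properties as UniqueProp
open import Data.List.Relation.Unary.Unique.Setoid using (Unique)
import Data.List.Relation.Unary.Unique.Setoid.Properties as Unique
open import Data.Nat.Base as ℕ using (ℕ; NonZero; zero; suc; _%_; _∸_)
open import Data.Nat.Coprimality using (prime⇒coprime; coprime⇒GCD≡1)
open import Data.Nat.DivMod using (_mod_; %-distribˡ-+; %-distribˡ-*; m<n⇒m%n≡m)
open import Data.Nat.Divisibility using (_∣_; _∣0; ∣-refl; m%n≡0⇒n∣m; n∣m⇒m%n≡0; n∣m*n; ∣⇒≤)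
open import Data.Nat.GCD using (module Bézout)
open import Data.Nat.Induction using (<-rec)
open import Data.Nat.Primality using (Prime; euclidsLemma)
import Data.Nat.Properties as ℕ
open import Data.Product.Base using (∃-syntax; _,_; proj₁; proj₂; _×_; uncurry; Σ-syntax)
open import Data.Sum.Base as Sum using (_⊎_; inj₁; inj₂; [_,_]′)
open import Data.Vec.Base as Vec using (Vec; []; _∷_; lookup; zipWith; _++_)
import Data.Vec.Properties as Vec
open import Data.Vec.Relation.Unary.All using ([]; _∷_) renaming (All to VecAll)
open import Function.Base using (_∘_; id)
open import Level using (0ℓ)
open import Relation.Binary.Bundles using (Setoid)
open import Relation.Binary.PropositionalEquality
open import Relation.Binary.PropositionalEquality.Algebra using (isMagma)
open import Relation.Nullary using (¬_; contradiction; yes; no; Dec)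
open import Relation.Nullary.Decidable using (map′; ¬?; _×-dec_; decidable-stable)
open import Relation.Unary using (Decidable)

-- The obstacle is that n is unbounded in terms of r: m error positions among the q^n points can be
-- chosen in about q^(n m) ways, which no count depending on r alone can absorb. Both cases remove
-- n. If a monomial u survives, every test monomial divides u, so a point enters only through its
-- coordinates in the support of u, at most 2e of them, and q^(2e) patterns remain. If all reduce,
-- the tests are values at R fixed points, and closeness of f · P leaves at most m of these values
-- nonzero.
--
-- With s patterns and R tests, the number of bad P times q^R is at most the number of all P times
-- (s q)^m. For m = q^k a rank R ≥ q m² suffices in both cases. It comes from 2^p divisors with p (q
-- - 1) ≤ e in the first and from √Δ independent points in the second; this is why e has to be
-- linear in r and Δ exponential in r.
--
-- Reducts are compared only against polynomials of bounded degree, so a degree budget N takes the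
-- place of ideals and quotient algebras: a factor moved into the test uses up its degree.

-- The field of residues modulo a prime

module PrimeField (q : ℕ) .{{_ : NonZero q}} (q-prime : Prime q) where

  F : Set
  F = Fin q

  ⟦_⟧ : ℕ → F
  ⟦ m ⟧ = m mod q

  toℕ-mod : ∀ m → toℕ ⟦ m ⟧ ≡ m % q
  toℕ-mod m = Fin.toℕ-fromℕ< _

  mod-cong : ∀ {m n} → m % q ≡ n % q → ⟦ m ⟧ ≡ ⟦ n ⟧
  mod-cong {m} {n} eq = Fin.toℕ-injective (trans (toℕ-mod m) (trans eq (sym (toℕ-mod n))))

  mod-toℕ : ∀ (a : F) → ⟦ toℕ a ⟧ ≡ a
  mod-toℕ a = Fin.toℕ-injective (trans (toℕ-mod _) (m<n⇒m%n≡m (Fin.toℕ<n a)))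

  mod-+ : ∀ m n → ⟦ m ⟧ +F ⟦ n ⟧ ≡ ⟦ m ℕ.+ n ⟧
  mod-+ m n = mod-cong (trans (cong₂ (λ a b → (a ℕ.+ b) % q) (toℕ-mod m) (toℕ-mod n)) (sym (%-distribˡ-+ m n q)))

  mod-* : ∀ m n → ⟦ m ⟧ *F ⟦ n ⟧ ≡ ⟦ m ℕ.* n ⟧
  mod-* m n = mod-cong (trans (cong₂ (λ a b → (a ℕ.* b) % q) (toℕ-mod m) (toℕ-mod n)) (sym (%-distribˡ-* m n q)))

  mod-elim : ∀ {ℓ} (P : F → Set ℓ) → (∀ m → P ⟦ m ⟧) → ∀ a → P a
  mod-elim P h a = subst P (mod-toℕ a) (h (toℕ a))

  mod-q : ⟦ q ⟧ ≡ 0F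
  mod-q = mod-cong (trans (n∣m⇒m%n≡0 q q ∣-refl) (sym (n∣m⇒m%n≡0 0 q (q ∣0))))

  negF : F → F
  negF a = ⟦ q ℕ.∸ toℕ a ⟧

  +F-assoc : ∀ a b c → (a +F b) +F c ≡ a +F (b +F c)
  +F-assoc = mod-elim _ λ m → mod-elim _ λ n → mod-elim _ λ k → begin
    (⟦ m ⟧ +F ⟦ n ⟧) +F ⟦ k ⟧ ≡⟨ cong (_+F ⟦ k ⟧) (mod-+ m n) ⟩
    ⟦ m ℕ.+ n ⟧ +F ⟦ k ⟧      ≡⟨ mod-+ (m ℕ.+ n) k ⟩
    ⟦ m ℕ.+ n ℕ.+ k ⟧         ≡⟨ cong ⟦_⟧ (ℕ.+-assoc m n k) ⟩
    ⟦ m ℕ.+ (n ℕ.+ k) ⟧       ≡⟨ mod-+ m (n ℕ.+ k) ⟨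
    ⟦ m ⟧ +F ⟦ n ℕ.+ k ⟧      ≡⟨ cong (⟦ m ⟧ +F_) (mod-+ n k) ⟨
    ⟦ m ⟧ +F (⟦ n ⟧ +F ⟦ k ⟧) ∎
    where open ≡-Reasoning

  *F-assoc : ∀ a b c → (a *F b) *F c ≡ a *F (b *F c)
  *F-assoc = mod-elim _ λ m → mod-elim _ λ n → mod-elim _ λ k → begin
    (⟦ m ⟧ *F ⟦ n ⟧) *F ⟦ k ⟧ ≡⟨ cong (_*F ⟦ k ⟧) (mod-* m n) ⟩
    ⟦ m ℕ.* n ⟧ *F ⟦ k ⟧      ≡⟨ mod-* (m ℕ.* n) k ⟩
    ⟦ m ℕ.* n ℕ.* k ⟧         ≡⟨ cong ⟦_⟧ (ℕ.*-assoc m n k) ⟩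
    ⟦ m ℕ.* (n ℕ.* k) ⟧       ≡⟨ mod-* m (n ℕ.* k) ⟨
    ⟦ m ⟧ *F ⟦ n ℕ.* k ⟧      ≡⟨ cong (⟦ m ⟧ *F_) (mod-* n k) ⟨
    ⟦ m ⟧ *F (⟦ n ⟧ *F ⟦ k ⟧) ∎
    where open ≡-Reasoning

  +F-comm : ∀ a b → a +F b ≡ b +F a
  +F-comm a b = cong ⟦_⟧ (ℕ.+-comm (toℕ a) (toℕ b))

  *F-comm : ∀ a b → a *F b ≡ b *F a
  *F-comm a b = cong ⟦_⟧ (ℕ.*-comm (toℕ a) (toℕ b))

  +F-identityˡ : ∀ a → 0F +F a ≡ a
  +F-identityˡ = mod-elim _ λ m → mod-+ 0 m

  *F-identityˡ : ∀ a → 1F *F a ≡ a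
  *F-identityˡ = mod-elim _ λ m → trans (mod-* 1 m) (cong ⟦_⟧ (ℕ.*-identityˡ m))

  *F-distribˡ : ∀ a b c → a *F (b +F c) ≡ a *F b +F a *F c
  *F-distribˡ = mod-elim _ λ m → mod-elim _ λ n → mod-elim _ λ k → begin
    ⟦ m ⟧ *F (⟦ n ⟧ +F ⟦ k ⟧)          ≡⟨ cong (⟦ m ⟧ *F_) (mod-+ n k) ⟩
    ⟦ m ⟧ *F ⟦ n ℕ.+ k ⟧               ≡⟨ mod-* m (n ℕ.+ k) ⟩
    ⟦ m ℕ.* (n ℕ.+ k) ⟧                ≡⟨ cong ⟦_⟧ (ℕ.*-distribˡ-+ m n k) ⟩
    ⟦ m ℕ.* n ℕ.+ m ℕ.* k ⟧            ≡⟨ mod-+ (m ℕ.* n) (m ℕ.* k) ⟨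
    ⟦ m ℕ.* n ⟧ +F ⟦ m ℕ.* k ⟧         ≡⟨ cong₂ _+F_ (mod-* m n) (mod-* m k) ⟨
    ⟦ m ⟧ *F ⟦ n ⟧ +F ⟦ m ⟧ *F ⟦ k ⟧   ∎
    where open ≡-Reasoning

  negF-inverseˡ : ∀ a → negF a +F a ≡ 0F
  negF-inverseˡ a = begin
    ⟦ q ℕ.∸ toℕ a ⟧ +F a          ≡⟨ cong (negF a +F_) (mod-toℕ a) ⟨
    ⟦ q ℕ.∸ toℕ a ⟧ +F ⟦ toℕ a ⟧  ≡⟨ mod-+ (q ℕ.∸ toℕ a) (toℕ a) ⟩
    ⟦ q ℕ.∸ toℕ a ℕ.+ toℕ a ⟧     ≡⟨ cong ⟦_⟧ (ℕ.m∸n+n≡m (ℕ.<⇒≤ (Fin.toℕ<n a))) ⟩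
    ⟦ q ⟧                         ≡⟨ mod-q ⟩
    0F                            ∎
    where open ≡-Reasoning

  infixl 6 _+_
  infixl 7 _*_
  infix  8 -_

  -- Opaque copies of the field operations: since _+F_ and _*F_ unfold, Agda could
  -- not infer the arguments of a sum or a product from its value.
  opaque
    _+_ _*_ : F → F → F
    _+_ = _+F_
    _*_ = _*F_

    -_ : F → F
    -_ = negF

    +F≡+ : ∀ a b → a +F b ≡ a + b
    +F≡+ a b = refl

    *F≡* : ∀ a b → a *F b ≡ a * b
    *F≡* a b = refl

    isCommutativeRing : IsCommutativeRing _≡_ _+_ _*_ -_ 0F 1F
    isCommutativeRing = record
      { isRing = record
        { +-isAbelianGroup = record
          { isGroup = record
            { isMonoid = record
              { isSemigroup = record
                { isMagma = isMagma _+F_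
                ; assoc = +F-assoc }
              ; identity = comm∧idˡ⇒id +F-comm +F-identityˡ }
            ; inverse = comm∧invˡ⇒inv +F-comm negF-inverseˡ
            ; ⁻¹-cong = cong negF }
          ; comm = +F-comm }
        ; *-cong = cong₂ _*F_
        ; *-assoc = *F-assoc
        ; *-identity = comm∧idˡ⇒id *F-comm *F-identityˡ
        ; distrib = *F-distribˡ , λ a b c →
            trans (*F-comm (b +F c) a) (trans (*F-distribˡ a b c) (cong₂ _+F_ (*F-comm a b) (*F-comm a c))) }
      ; *-comm = *F-comm }

  𝔽 : CommutativeRing _ _
  𝔽 = record { isCommutativeRing = isCommutativeRing }

  open CommutativeRing 𝔽 public
    using (+-assoc; +-comm; +-identityˡ; +-identityʳ; *-assoc; *-comm; *-identityˡ; *-identityʳ;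
           distribˡ; distribʳ; zeroˡ; zeroʳ; -‿inverseˡ; -‿inverseʳ; commutativeSemiring; semiring)
  open import Algebra.Properties.Ring (CommutativeRing.ring 𝔽) public
    using (-‿distribˡ-*; -‿distribʳ-*; -1*x≈-x; -‿involutive)
  open import Algebra.Properties.AbelianGroup (CommutativeRing.+-abelianGroup 𝔽) public
    using () renaming (inverseˡ-unique to +-inverseˡ-unique; ∙-cancelˡ to +-cancelˡ; ∙-cancelʳ to +-cancelʳ)

  ⟦⟧-+ : ∀ m n → ⟦ m ⟧ + ⟦ n ⟧ ≡ ⟦ m ℕ.+ n ⟧
  ⟦⟧-+ m n = trans (sym (+F≡+ _ _)) (mod-+ m n)

  ⟦⟧-* : ∀ m n → ⟦ m ⟧ * ⟦ n ⟧ ≡ ⟦ m ℕ.* n ⟧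
  ⟦⟧-* m n = trans (sym (*F≡* _ _)) (mod-* m n)

  mod-zero⇒∣ : ∀ m → ⟦ m ⟧ ≡ 0F → q ∣ m
  mod-zero⇒∣ m eq = m%n≡0⇒n∣m m q (trans (sym (toℕ-mod m)) (trans (cong toℕ eq)
    (trans (toℕ-mod 0) (n∣m⇒m%n≡0 0 q (q ∣0)))))

  ∣⇒mod-zero : ∀ m → q ∣ m → ⟦ m ⟧ ≡ 0F
  ∣⇒mod-zero m q∣m = mod-cong (trans (n∣m⇒m%n≡0 m q q∣m) (sym (n∣m⇒m%n≡0 0 q (q ∣0))))

  noZeroDivisors : ∀ a b → a * b ≡ 0F → a ≡ 0F ⊎ b ≡ 0F
  noZeroDivisors a b ab≡0 with euclidsLemma (toℕ a) (toℕ b) q-prime (mod-zero⇒∣ _ (trans (*F≡* a b) ab≡0))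
  ... | inj₁ q∣a = inj₁ (trans (sym (mod-toℕ a)) (∣⇒mod-zero _ q∣a))
  ... | inj₂ q∣b = inj₂ (trans (sym (mod-toℕ b)) (∣⇒mod-zero _ q∣b))

  mod-inverse : ∀ k → suc k ℕ.< q → ∃[ b ] b * ⟦ suc k ⟧ ≡ 1F
  mod-inverse k k<q with Bézout.identity (coprime⇒GCD≡1 (prime⇒coprime q-prime k<q))
  ... | Bézout.Identity.+- x y eq = - ⟦ y ⟧ ,
    trans (sym (-‿distribˡ-* ⟦ y ⟧ ⟦ suc k ⟧)) (sym (+-inverseˡ-unique 1F _
      (trans (cong (1F +_) (⟦⟧-* y (suc k)))
        (trans (⟦⟧-+ 1 (y ℕ.* suc k)) (trans (cong ⟦_⟧ eq) (∣⇒mod-zero _ (n∣m*n x)))))))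
  ... | Bézout.Identity.-+ x y eq = ⟦ y ⟧ , (begin
    ⟦ y ⟧ * ⟦ suc k ⟧    ≡⟨ ⟦⟧-* y (suc k) ⟩
    ⟦ y ℕ.* suc k ⟧       ≡⟨ cong ⟦_⟧ eq ⟨
    ⟦ 1 ℕ.+ x ℕ.* q ⟧     ≡⟨ ⟦⟧-+ 1 (x ℕ.* q) ⟨
    1F + ⟦ x ℕ.* q ⟧     ≡⟨ cong (1F +_) (∣⇒mod-zero _ (n∣m*n x)) ⟩
    1F + 0F              ≡⟨ +-identityʳ 1F ⟩
    1F                    ∎)
    where open ≡-Reasoning

  inverse : ∀ a → a ≢ 0F → ∃[ b ] b * a ≡ 1F
  inverse a a≢0 = go (toℕ a) refl
    where
    go : ∀ m → toℕ a ≡ m → ∃[ b ] b * a ≡ 1F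
    go zero    eq = contradiction (trans (sym (mod-toℕ a)) (cong ⟦_⟧ eq)) a≢0
    go (suc k) eq with mod-inverse k (subst (ℕ._< q) eq (Fin.toℕ<n a))
    ... | b , b*k≡1 = b , trans (cong (b *_) (trans (sym (mod-toℕ a)) (cong ⟦_⟧ eq))) b*k≡1

-- Finite sums over indices, lists and vectors

module Sums (q : ℕ) .{{_ : NonZero q}} (q-prime : Prime q) where

  open PrimeField q q-prime
  open import Algebra.Properties.Semiring.Sum semiring public
    using (sum; sum-cong-≗; ∑-distrib-+; ∑-comm; sum-permute; *-distribˡ-sum; *-distribʳ-sum)

  sum-zero : ∀ {n} (t : Fin n → F) → (∀ i → t i ≡ 0F) → sum t ≡ 0F
  sum-zero {zero}  t h = refl
  sum-zero {suc n} t h = trans (cong₂ _+_ (h zero) (sum-zero (t ∘ suc) (h ∘ suc))) (+-identityʳ 0F)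

  sum-single : ∀ {n} (t : Fin n → F) i → (∀ j → j ≢ i → t j ≡ 0F) → sum t ≡ t i
  sum-single t zero h = trans (cong (t zero +_) (sum-zero (t ∘ suc) λ j → h (suc j) λ ())) (+-identityʳ _)
  sum-single t (suc i) h = trans
    (cong₂ _+_ (h zero λ ()) (sum-single (t ∘ suc) i λ j j≢i → h (suc j) (j≢i ∘ Fin.suc-injective)))
    (+-identityˡ _)

  sum-↑ : ∀ m {n} (t : Fin (m ℕ.+ n) → F) → sum t ≡ sum (λ i → t (i ↑ˡ n)) + sum (λ j → t (m ↑ʳ j))
  sum-↑ zero    t = sym (+-identityˡ _)
  sum-↑ (suc m) t = trans (cong (t zero +_) (sum-↑ m (t ∘ suc))) (sym (+-assoc _ _ _))

  sum-combine : ∀ m {n} (t : Fin (m ℕ.* n) → F) → sum t ≡ sum λ i → sum λ j → t (combine {m} {n} i j)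
  sum-combine zero    t = refl
  sum-combine (suc m) {n} t = trans (sum-↑ n t) (cong (sum (λ j → t (j ↑ˡ (m ℕ.* n))) +_) (sum-combine m (t ∘ (n ↑ʳ_))))

  sumL : ∀ {A : Set} → (A → F) → List A → F
  sumL g []       = 0F
  sumL g (x ∷ xs) = g x + sumL g xs

  sumL-cong : ∀ {A : Set} {g h : A → F} → (∀ x → g x ≡ h x) → ∀ xs → sumL g xs ≡ sumL h xs
  sumL-cong eq []       = refl
  sumL-cong eq (x ∷ xs) = cong₂ _+_ (eq x) (sumL-cong eq xs)

  sumL-map : ∀ {A B : Set} (g : B → F) (h : A → B) xs → sumL g (List.map h xs) ≡ sumL (g ∘ h) xs
  sumL-map g h []       = refl
  sumL-map g h (x ∷ xs) = cong (g (h x) +_) (sumL-map g h xs)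

  sumL-tabulate : ∀ {A : Set} {n} (g : A → F) (h : Fin n → A) → sumL g (List.tabulate h) ≡ sum (g ∘ h)
  sumL-tabulate {n = zero}  g h = refl
  sumL-tabulate {n = suc n} g h = cong (g (h zero) +_) (sumL-tabulate g (h ∘ suc))

  sumL-filter : ∀ {A : Set} {P : A → Set} (P? : Decidable P) (g : A → F) →
                (∀ x → ¬ P x → g x ≡ 0F) → ∀ xs → sumL g (filter P? xs) ≡ sumL g xs
  sumL-filter P? g h []       = refl
  sumL-filter P? g h (x ∷ xs) with P? x
  ... | yes _ = cong (g x +_) (sumL-filter P? g h xs)
  ... | no ¬p = trans (sumL-filter P? g h xs)
    (trans (sym (+-identityˡ _)) (cong (_+ sumL g xs) (sym (h x ¬p))))

  toVec-combine : ∀ {n} (c : F) (j : Fin (q ℕ.^ n)) → toVec {q} {suc n} (combine c j) ≡ c ∷ toVec j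
  toVec-combine {n} c j = cong₂ _∷_ (cong proj₁ (Fin.remQuot-combine c j))
    (Vec.tabulate-cong λ i → cong (λ p → finToFun {q} {n} (proj₂ p) i) (Fin.remQuot-combine {q} c j))

  opaque
    -- Recursion on the coordinates, rather than a sum over `vectors q n`, lets sums of monomials
    -- factor; `sumV-vectors` translates back where Hamming distances are involved.
    sumV : ∀ {n} → (Vec F n → F) → F
    sumV {zero}  g = g []
    sumV {suc n} g = sum λ c → sumV λ v → g (c ∷ v)

    sumV-cong : ∀ {n} {g h : Vec F n → F} → (∀ x → g x ≡ h x) → sumV g ≡ sumV h
    sumV-cong {zero}  eq = eq []
    sumV-cong {suc n} eq = sum-cong-≗ λ c → sumV-cong λ v → eq (c ∷ v)

    sumV-+ : ∀ {n} (g h : Vec F n → F) → sumV (λ x → g x + h x) ≡ sumV g + sumV h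
    sumV-+ {zero}  g h = refl
    sumV-+ {suc n} g h = trans (sum-cong-≗ λ c → sumV-+ (g ∘ (c ∷_)) (h ∘ (c ∷_))) (∑-distrib-+ {q} _ _)

    sumV-*ˡ : ∀ {n} a (g : Vec F n → F) → sumV (λ x → a * g x) ≡ a * sumV g
    sumV-*ˡ {zero}  a g = refl
    sumV-*ˡ {suc n} a g = trans (sum-cong-≗ λ c → sumV-*ˡ a (g ∘ (c ∷_))) (sym (*-distribˡ-sum {q} a _))

    sumV-zero : ∀ {n} (g : Vec F n → F) → (∀ x → g x ≡ 0F) → sumV g ≡ 0F
    sumV-zero {zero}  g h = h []
    sumV-zero {suc n} g h = sum-zero {q} _ λ c → sumV-zero _ λ v → h (c ∷ v)

    sumV-single : ∀ {n} (g : Vec F n → F) z → (∀ x → x ≢ z → g x ≡ 0F) → sumV g ≡ g z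
    sumV-single {zero}  g []      h = refl
    sumV-single {suc n} g (c ∷ z) h = trans
      (sum-single {q} _ c λ d d≢c → sumV-zero _ λ v → h (d ∷ v) (d≢c ∘ cong Vec.head))
      (sumV-single (g ∘ (c ∷_)) z λ v v≢z → h (c ∷ v) (v≢z ∘ cong Vec.tail))

    sumV-∑-comm : ∀ {n m} (g : Fin m → Vec F n → F) →
                  sumV (λ x → sum λ i → g i x) ≡ sum λ i → sumV (g i)
    sumV-∑-comm {zero}  g = refl
    sumV-∑-comm {suc n} {m} g = trans (sum-cong-≗ {q} λ c → sumV-∑-comm λ i v → g i (c ∷ v))
      (∑-comm {q} {m} λ c i → sumV λ v → g i (c ∷ v))

    sumV-[] : ∀ (g : Vec F 0 → F) → sumV g ≡ g []
    sumV-[] g = refl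

    sumV-suc : ∀ {n} (g : Vec F (suc n) → F) → sumV g ≡ sum λ c → sumV λ v → g (c ∷ v)
    sumV-suc g = refl

    sumV-toVec : ∀ {n} (g : Vec F n → F) → sumV g ≡ sum (g ∘ toVec)
    sumV-toVec {zero}  g = sym (+-identityʳ _)
    sumV-toVec {suc n} g = trans
      (sum-cong-≗ {q} λ c → trans (sumV-toVec (g ∘ (c ∷_)))
        (sum-cong-≗ {q ℕ.^ n} λ j → cong g (sym (toVec-combine c j))))
      (sym (sum-combine q (g ∘ toVec)))

  sumV-vectors : ∀ {n} (g : Vec F n → F) → sumV g ≡ sumL g (vectors q n)
  sumV-vectors g = trans (sumV-toVec g) (sym (trans (sumL-map g toVec (List.allFin _)) (sumL-tabulate (g ∘ toVec) id)))

-- Polynomial functions of bounded degree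

module Polynomials (q : ℕ) .{{_ : NonZero q}} (q-prime : Prime q) where

  open PrimeField q q-prime
  open Sums q q-prime
  open import Algebra.Solver.Ring.NaturalCoefficients.Default commutativeSemiring
    using (solve; _:+_; _:*_; _:=_)

  private variable
    n k l : ℕ
    f g h : Fun q n

  infixr 8 _^_

  _^_ : F → ℕ → F
  a ^ zero  = 1F
  a ^ suc k = a * a ^ k

  mon : Vec ℕ n → Fun q n
  mon []      []      = 1F
  mon (m ∷ t) (c ∷ x) = c ^ m * mon t x

  ^F≡^ : ∀ a m → a ^F m ≡ a ^ m
  ^F≡^ a zero    = refl
  ^F≡^ a (suc m) = trans (*F≡* a _) (cong (a *_) (^F≡^ a m))

  monomialAt≡mon : ∀ (t : Vec ℕ n) x → monomialAt t x ≡ mon t x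
  monomialAt≡mon []      []      = refl
  monomialAt≡mon (m ∷ t) (c ∷ x) = trans (*F≡* _ _) (cong₂ _*_ (^F≡^ c m) (monomialAt≡mon t x))

  -- Code membership as an inductive predicate on functions. Each constructor carries a pointwise
  -- equation, which replaces function extensionality, and closure under sums and products becomes
  -- structural; `Deg⇒InReedMuller` and `InReedMuller⇒Deg` connect it with coefficient vectors.
  data Deg {n} (k : ℕ) : Fun q n → Set where
    mono : ∀ {f} c t → Vec.sum t ℕ.≤ k → (∀ x → f x ≡ c * mon t x) → Deg k f
    plus : ∀ {f g h} → Deg k g → Deg k h → (∀ x → f x ≡ g x + h x) → Deg k f

  Deg-ext : Deg k g → (∀ x → f x ≡ g x) → Deg k f
  Deg-ext (mono c t s e) eq = mono c t s λ x → trans (eq x) (e x)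
  Deg-ext (plus a b e)   eq = plus a b λ x → trans (eq x) (e x)

  Deg-weaken : k ℕ.≤ l → Deg k f → Deg l f
  Deg-weaken k≤l (mono c t s e) = mono c t (ℕ.≤-trans s k≤l) e
  Deg-weaken k≤l (plus a b e)   = plus (Deg-weaken k≤l a) (Deg-weaken k≤l b) e

  Deg-scale : ∀ a → Deg k f → Deg k (λ x → a * f x)
  Deg-scale a (mono c t s e) = mono (a * c) t s λ x → trans (cong (a *_) (e x)) (sym (*-assoc a c _))
  Deg-scale a (plus p r e)   = plus (Deg-scale a p) (Deg-scale a r) λ x → trans (cong (a *_) (e x)) (distribˡ a _ _)

  Deg-mon : ∀ (t : Vec ℕ n) → Deg (Vec.sum t) (mon t)
  Deg-mon t = mono 1F t ℕ.≤-refl λ x → sym (*-identityˡ _)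

  sum-replicate-0 : ∀ n → Vec.sum (Vec.replicate n 0) ≡ 0
  sum-replicate-0 zero    = refl
  sum-replicate-0 (suc n) = sum-replicate-0 n

  mon-replicate-0 : ∀ (x : Vec F n) → mon (Vec.replicate n 0) x ≡ 1F
  mon-replicate-0 []      = refl
  mon-replicate-0 (c ∷ x) = trans (*-identityˡ _) (mon-replicate-0 x)

  mon-sum-0 : ∀ (t : Vec ℕ n) → Vec.sum t ≡ 0 → ∀ x → mon t x ≡ 1F
  mon-sum-0 []         _  []      = refl
  mon-sum-0 (zero ∷ t) eq (c ∷ x) = trans (*-identityˡ _) (mon-sum-0 t eq x)

  Deg-const : ∀ a → Deg {n} k (λ _ → a)
  Deg-const {n} a = mono a (Vec.replicate n 0) (subst (ℕ._≤ _) (sym (sum-replicate-0 n)) ℕ.z≤n)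
    λ x → sym (trans (cong (a *_) (mon-replicate-0 x)) (*-identityʳ a))

  Deg-∑ : ∀ {m} (g : Fin m → Fun q n) → (∀ i → Deg k (g i)) → Deg k (λ x → sum λ i → g i x)
  Deg-∑ {m = zero}  g h = Deg-const 0F
  Deg-∑ {m = suc m} g h = plus (h zero) (Deg-∑ (g ∘ suc) (h ∘ suc)) λ _ → refl

  ^-+ : ∀ (a : F) m n → a ^ (m ℕ.+ n) ≡ a ^ m * a ^ n
  ^-+ a zero    n = sym (*-identityˡ _)
  ^-+ a (suc m) n = trans (cong (a *_) (^-+ a m n)) (sym (*-assoc a _ _))

  mon-+ : ∀ (s t : Vec ℕ n) x → mon (zipWith ℕ._+_ s t) x ≡ mon s x * mon t x
  mon-+ []      []      []      = sym (*-identityˡ _)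
  mon-+ (i ∷ s) (j ∷ t) (c ∷ x) = trans (cong₂ _*_ (^-+ c i j) (mon-+ s t x))
    (solve 4 (λ a b c d → (a :* b) :* (c :* d) := (a :* c) :* (b :* d)) refl (c ^ i) (c ^ j) (mon s x) (mon t x))

  sum-+ : ∀ (s t : Vec ℕ n) → Vec.sum (zipWith ℕ._+_ s t) ≡ Vec.sum s ℕ.+ Vec.sum t
  sum-+ []      []      = refl
  sum-+ (i ∷ s) (j ∷ t) = trans (cong (i ℕ.+ j ℕ.+_) (sum-+ s t)) (solve′ i j (Vec.sum s) (Vec.sum t))
    where
    open import Data.Nat.Solver using (module +-*-Solver)
    solve′ : ∀ i j s t → i ℕ.+ j ℕ.+ (s ℕ.+ t) ≡ i ℕ.+ s ℕ.+ (j ℕ.+ t)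
    solve′ = +-*-Solver.solve 4 (λ i j s t → i +-*-Solver.:+ j +-*-Solver.:+ (s +-*-Solver.:+ t)
      +-*-Solver.:= i +-*-Solver.:+ s +-*-Solver.:+ (j +-*-Solver.:+ t)) refl

  Deg-* : Deg k f → Deg l g → Deg (k ℕ.+ l) (λ x → f x * g x)
  Deg-* (mono c s cs ce) (mono d t ds de) = mono (c * d) (zipWith ℕ._+_ s t)
    (subst (ℕ._≤ _) (sym (sum-+ s t)) (ℕ.+-mono-≤ cs ds))
    λ x → trans (cong₂ _*_ (ce x) (de x)) (trans
      (solve 4 (λ a b c d → (a :* b) :* (c :* d) := (a :* c) :* (b :* d)) refl c (mon s x) d (mon t x))
      (cong (c * d *_) (sym (mon-+ s t x))))
  Deg-* p@(mono _ _ _ _) (plus a b e) = plus (Deg-* p a) (Deg-* p b) λ x → trans (cong (_ *_) (e x)) (distribˡ _ _ _)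
  Deg-* (plus a b e) p = plus (Deg-* a p) (Deg-* b p) λ x → trans (cong (_* _) (e x)) (distribʳ _ _ _)

  Deg-tail : Deg k g → Deg {suc n} k (g ∘ Vec.tail)
  Deg-tail (mono c t s e) = mono c (0 ∷ t) s λ where (a ∷ x) → trans (e x) (cong (c *_) (sym (*-identityˡ _)))
  Deg-tail (plus a b e) = plus (Deg-tail a) (Deg-tail b) λ x → e (Vec.tail x)

  Deg-var : ∀ (i : Fin n) → Deg 1 (λ x → lookup x i)
  Deg-var {suc n} zero = mono 1F (1 ∷ Vec.replicate n 0) (ℕ.≤-reflexive (cong suc (sum-replicate-0 n))) λ where
    (a ∷ x) → sym (trans (*-identityˡ _) (trans (cong₂ _*_ (*-identityʳ a) (mon-replicate-0 x)) (*-identityʳ a)))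
  Deg-var (suc i) = Deg-ext (Deg-tail (Deg-var i)) λ where (a ∷ x) → refl

  split : ∀ (t : Vec ℕ n) j → j ℕ.≤ Vec.sum t →
          ∃[ t₁ ] ∃[ t₂ ] (zipWith ℕ._+_ t₁ t₂ ≡ t × Vec.sum t₁ ≡ j)
  split []      zero ℕ.z≤n = [] , [] , refl , refl
  split {suc n} (m ∷ t) j j≤ with j ℕ.≤? m
  ... | yes j≤m = j ∷ Vec.replicate n 0 , m ∸ j ∷ t ,
    cong₂ _∷_ (ℕ.m+[n∸m]≡n j≤m) (Vec.zipWith-identityˡ ℕ.+-identityˡ t) ,
    trans (cong (j ℕ.+_) (sum-replicate-0 n)) (ℕ.+-identityʳ j)
  ... | no  j≰m with split t (j ∸ m) (ℕ.m≤n+o⇒m∸n≤o j m j≤)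
  ...   | t₁ , t₂ , eq , s = m ∷ t₁ , 0 ∷ t₂ , cong₂ _∷_ (ℕ.+-identityʳ m) eq ,
    trans (cong (m ℕ.+_) s) (ℕ.m+[n∸m]≡n (ℕ.<⇒≤ (ℕ.≰⇒> j≰m)))

  peel : ∀ (t : Vec ℕ n) {s} → Vec.sum t ≡ suc s →
         ∃[ i ] ∃[ t′ ] (Vec.sum t′ ≡ s × ∀ x → mon t x ≡ lookup x i * mon t′ x)
  peel (suc m ∷ t) eq = zero , m ∷ t , ℕ.suc-injective eq , λ where (c ∷ x) → *-assoc c _ _
  peel (zero  ∷ t) eq with peel t eq
  ... | i , t′ , s , e = suc i , 0 ∷ t′ , s , λ where
    (c ∷ x) → trans (*-identityˡ _) (trans (e x) (cong (lookup x i *_) (sym (*-identityˡ _))))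

  toVec-fromVec : ∀ {k n} (v : Vec (Fin k) n) → toVec (fromVec v) ≡ v
  toVec-fromVec v = trans (Vec.tabulate-cong (Fin.finToFun-funToFin (lookup v))) (Vec.tabulate∘lookup v)

  ∈-vectors : ∀ {k n} (v : Vec (Fin k) n) → v ∈ vectors k n
  ∈-vectors v = subst (_∈ vectors _ _) (toVec-fromVec v) (∈-map⁺ toVec (∈-allFin (fromVec v)))

  module _ {n d : ℕ} where

    private
      evalList : ∀ (ms : List (Vec ℕ n)) → Vec F (List.length ms) → Fun q n
      evalList []       []      x = 0F
      evalList (m ∷ ms) (a ∷ c) x = a * mon m x + evalList ms c x

      eval≡ : ∀ ms c x →
        Vec.foldr′ _+F_ 0F (zipWith (λ a m → a *F monomialAt m x) c (Vec.fromList ms)) ≡ evalList ms c x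
      eval≡ []       []      x = refl
      eval≡ (m ∷ ms) (a ∷ c) x = trans (+F≡+ _ _)
        (cong₂ _+_ (trans (*F≡* a _) (cong (a *_) (monomialAt≡mon m x))) (eval≡ ms c x))

      Deg-evalList : ∀ ms c → All (λ m → Vec.sum m ℕ.≤ d) ms → Deg d (evalList ms c)
      Deg-evalList []       []      []       = Deg-const 0F
      Deg-evalList (m ∷ ms) (a ∷ c) (s ∷ ss) = plus (mono a m s λ _ → refl) (Deg-evalList ms c ss) λ _ → refl

      evalList-0 : ∀ ms x → evalList ms (Vec.replicate _ 0F) x ≡ 0F
      evalList-0 []       x = refl
      evalList-0 (m ∷ ms) x = trans (cong₂ _+_ (zeroˡ _) (evalList-0 ms x)) (+-identityʳ 0F)

      evalList-mono : ∀ {m ms} a → m ∈ ms → ∃[ c ] (∀ x → a * mon m x ≡ evalList ms c x)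
      evalList-mono {ms = m ∷ ms} a (here refl) = a ∷ Vec.replicate _ 0F ,
        λ x → sym (trans (cong (a * mon m x +_) (evalList-0 ms x)) (+-identityʳ _))
      evalList-mono a (there m∈) with evalList-mono a m∈
      ... | c , e = 0F ∷ c , λ x → trans (e x) (sym (trans (cong (_+ _) (zeroˡ _)) (+-identityˡ _)))

      evalList-+ : ∀ ms c c′ x → evalList ms c x + evalList ms c′ x ≡ evalList ms (zipWith _+_ c c′) x
      evalList-+ []       []      []        x = +-identityʳ 0F
      evalList-+ (m ∷ ms) (a ∷ c) (a′ ∷ c′) x = trans
        (solve 5 (λ a a′ m e e′ → (a :* m :+ e) :+ (a′ :* m :+ e′) := (a :+ a′) :* m :+ (e :+ e′)) refl a a′ (mon m x) _ _)
        (cong ((a + a′) * mon m x +_) (evalList-+ ms c c′ x))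

      bounded : ∀ {m} (t : Vec ℕ m) → Vec.sum t ℕ.≤ d → ∃[ v ] Vec.map (toℕ {suc d}) v ≡ t
      bounded []      _ = [] , refl
      bounded (i ∷ t) h with bounded t (ℕ.≤-trans (ℕ.m≤n+m _ i) h)
      ... | v , eq = fromℕ< (ℕ.s≤s (ℕ.≤-trans (ℕ.m≤m+n i _) h)) ∷ v , cong₂ _∷_ (Fin.toℕ-fromℕ< _) eq

    ∈-monomials : ∀ t → Vec.sum t ℕ.≤ d → t ∈ monomials n d
    ∈-monomials t h with bounded t h
    ... | v , refl = ∈-filter⁺ (λ m → Vec.sum m ℕ.≤? d) (∈-map⁺ (Vec.map toℕ) (∈-vectors v)) h

    Deg-eval : ∀ (c : Polynomial q n d) → Deg d (eval c)
    Deg-eval c = Deg-ext (Deg-evalList (monomials n d) c (All.all-filter (λ m → Vec.sum m ℕ.≤? d) (List.map (Vec.map toℕ) (vectors (suc d) n))))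
      (eval≡ (monomials n d) c)

    InReedMuller⇒Deg : InReedMuller q n d f → Deg d f
    InReedMuller⇒Deg (c , e) = Deg-ext (Deg-eval c) e

    Deg⇒InReedMuller : Deg d f → InReedMuller q n d f
    Deg⇒InReedMuller (mono a t s e) with evalList-mono a (∈-monomials t s)
    ... | c , e′ = c , λ x → trans (e x) (trans (e′ x) (sym (eval≡ (monomials n d) c x)))
    Deg⇒InReedMuller (plus p r e) with Deg⇒InReedMuller p | Deg⇒InReedMuller r
    ... | c , eq | c′ , eq′ = zipWith _+_ c c′ , λ x →
      trans (e x) (trans (cong₂ _+_ (trans (eq x) (eval≡ (monomials n d) c x)) (trans (eq′ x) (eval≡ (monomials n d) c′ x)))
        (trans (evalList-+ (monomials n d) c c′ x) (sym (eval≡ (monomials n d) (zipWith _+_ c c′) x))))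

-- The pairing of functions and the vanishing of power sums

module Pairing (q : ℕ) .{{_ : NonZero q}} (q-prime : Prime q) where

  open PrimeField q q-prime
  open Sums q q-prime
  open Polynomials q q-prime
  open import Algebra.Properties.Group (CommutativeRing.+-group 𝔽) using (identityʳ-unique)
  open import Algebra.Solver.Ring.NaturalCoefficients.Default commutativeSemiring
    using (solve; _:+_; _:*_; _:=_)

  private variable
    n k : ℕ
    f g h : Fun q n

  opaque
    ⟨_,_⟩ : Fun q n → Fun q n → F
    ⟨ f , h ⟩ = sumV λ x → f x * h x

    ⟨⟩-cong : ∀ (f : Fun q n) → (∀ x → g x ≡ h x) → ⟨ f , g ⟩ ≡ ⟨ f , h ⟩
    ⟨⟩-cong f e = sumV-cong λ x → cong (f x *_) (e x)

    ⟨⟩-+ : ∀ (f g h : Fun q n) → ⟨ f , (λ x → g x + h x) ⟩ ≡ ⟨ f , g ⟩ + ⟨ f , h ⟩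
    ⟨⟩-+ f g h = trans (sumV-cong λ x → distribˡ (f x) (g x) (h x)) (sumV-+ _ _)

    ⟨⟩-* : ∀ (f : Fun q n) a h → ⟨ f , (λ x → a * h x) ⟩ ≡ a * ⟨ f , h ⟩
    ⟨⟩-* f a h = trans (sumV-cong λ x → solve 3 (λ f a h → f :* (a :* h) := a :* (f :* h)) refl (f x) a (h x)) (sumV-*ˡ a _)

    ⟨⟩≡sumV : ∀ (f h : Fun q n) → ⟨ f , h ⟩ ≡ sumV λ x → f x * h x
    ⟨⟩≡sumV f h = refl

  1≤q∸1 : 1 ℕ.≤ q ∸ 1
  1≤q∸1 = go q-prime
    where
    go : ∀ {q} → Prime q → 1 ℕ.≤ q ∸ 1
    go {suc (suc _)} _ = ℕ.s≤s ℕ.z≤n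

  suc[q∸1]≡q : suc (q ∸ 1) ≡ q
  suc[q∸1]≡q = ℕ.suc-pred q

  sum-shift : ∀ (g : F → F) → sum (λ a → g (a + 1F)) ≡ sum g
  sum-shift g = sym (sum-permute g (permutation (_+ 1F) (_+ (- 1F))
    (λ a → trans (+-assoc a (- 1F) 1F) (trans (cong (a +_) (-‿inverseˡ 1F)) (+-identityʳ a)))
    (λ a → trans (+-assoc a 1F (- 1F)) (trans (cong (a +_) (-‿inverseʳ 1F)) (+-identityʳ a)))))

  private
    -- Combinations of powers below m: the part of (a + 1)^(m+1) whose coefficients need not be
    -- known.
    data Lower (m : ℕ) : (F → F) → Set where
      low-zero : Lower m (λ _ → 0F)
      low-term : ∀ {g} c j → j ℕ.< m → Lower m g → Lower m (λ a → c * a ^ j + g a)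

    lower-suc : ∀ {m g} → Lower m g → Lower (suc m) g
    lower-suc low-zero           = low-zero
    lower-suc (low-term c j h p) = low-term c j (ℕ.m<n⇒m<1+n h) (lower-suc p)

    lower-* : ∀ {m g} → Lower m g → ∃[ h ] Lower (suc m) h × (∀ a → h a ≡ (a + 1F) * g a)
    lower-* low-zero = _ , low-zero , λ a → sym (zeroʳ _)
    lower-* (low-term {g} c j j<m p) with lower-* p
    ... | h , ph , eq = _ , low-term c (suc j) (ℕ.s≤s j<m) (low-term c j (ℕ.m<n⇒m<1+n j<m) ph) , λ a →
      trans (cong (λ z → c * (a * a ^ j) + (c * a ^ j + z)) (eq a))
        (trans (cong (λ z → c * (a * a ^ j) + (z + (a + 1F) * g a)) (sym (*-identityˡ _)))
          (solve 5 (λ c a o p g → c :* (a :* p) :+ (o :* (c :* p) :+ (a :+ o) :* g) := (a :+ o) :* (c :* p :+ g))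
            refl c a 1F (a ^ j) (g a)))

    [a+1]^[1+m] : ∀ m → ∃[ g ] Lower m g × (∀ a → (a + 1F) ^ suc m ≡ a ^ suc m + (⟦ suc m ⟧ * a ^ m + g a))
    [a+1]^[1+m] zero = _ , low-zero , λ a → trans (*-identityʳ _)
      (cong₂ _+_ (sym (*-identityʳ a)) (sym (trans (+-identityʳ _) (*-identityʳ _))))
    [a+1]^[1+m] (suc m) with [a+1]^[1+m] m
    ... | g , p , eq with lower-* p
    ...   | h , ph , eq′ = _ , low-term ⟦ suc m ⟧ m ℕ.≤-refl ph , λ a → begin
      (a + 1F) * (a + 1F) ^ suc m
        ≡⟨ cong ((a + 1F) *_) (eq a) ⟩
      (a + 1F) * (a ^ suc m + (⟦ suc m ⟧ * a ^ m + g a))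
        ≡⟨ solve 6 (λ a o r s b g → (a :+ o) :* (r :+ (s :* b :+ g)) :=
             a :* r :+ ((o :* r :+ s :* (a :* b)) :+ (o :* (s :* b) :+ (a :+ o) :* g)))
             refl a 1F (a ^ suc m) ⟦ suc m ⟧ (a ^ m) (g a) ⟩
      a * a ^ suc m + ((1F * a ^ suc m + ⟦ suc m ⟧ * (a * a ^ m)) + (1F * (⟦ suc m ⟧ * a ^ m) + (a + 1F) * g a))
        ≡⟨ cong (a * a ^ suc m +_) (cong₂ _+_
             (trans (sym (distribʳ (a ^ suc m) 1F ⟦ suc m ⟧)) (cong (_* a ^ suc m) (⟦⟧-+ 1 (suc m))))
             (cong₂ _+_ (*-identityˡ _) (sym (eq′ a)))) ⟩
      a ^ suc (suc m) + (⟦ suc (suc m) ⟧ * a ^ suc m + (⟦ suc m ⟧ * a ^ m + h a)) ∎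
      where open ≡-Reasoning

  -- Translation invariance: (a + 1)^(m+1) and a^(m+1) have the same sum over 𝔽. Expanding, (m + 1)
  -- Σ a^m plus multiples of lower power sums is zero, and the lower ones vanish by induction. Since
  -- 0 < m + 1 < q, the factor m + 1 is nonzero in 𝔽.
  power-sum : ∀ m → m ℕ.< q ∸ 1 → sum (λ (a : F) → a ^ m) ≡ 0F
  power-sum = <-rec _ step
    where
    step : ∀ m → (∀ {j} → j ℕ.< m → j ℕ.< q ∸ 1 → sum (λ (a : F) → a ^ j) ≡ 0F) →
           m ℕ.< q ∸ 1 → sum (λ (a : F) → a ^ m) ≡ 0F
    step m rec m<q-1 with [a+1]^[1+m] m
    ... | g , p , eq with noZeroDivisors ⟦ suc m ⟧ (sum λ (a : F) → a ^ m) product≡0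
      where
      lower-sum : ∀ {g} → Lower m g → sum g ≡ 0F
      lower-sum low-zero = sum-zero {q} _ λ _ → refl
      lower-sum (low-term c j j<m p) = trans (∑-distrib-+ {q} _ _) (trans (cong₂ _+_
        (trans (sym (*-distribˡ-sum {q} c _)) (trans (cong (c *_) (rec j<m (ℕ.<-trans j<m m<q-1))) (zeroʳ c)))
        (lower-sum p)) (+-identityʳ 0F))

      product≡0 : ⟦ suc m ⟧ * sum (λ (a : F) → a ^ m) ≡ 0F
      product≡0 = identityʳ-unique (sum λ (a : F) → a ^ suc m) _ (begin
        sum (λ (a : F) → a ^ suc m) + ⟦ suc m ⟧ * sum (λ (a : F) → a ^ m)
          ≡⟨ cong (sum (λ (a : F) → a ^ suc m) +_) (trans (*-distribˡ-sum {q} ⟦ suc m ⟧ _)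
               (sym (trans (cong (sum (λ (a : F) → ⟦ suc m ⟧ * a ^ m) +_) (lower-sum p)) (+-identityʳ _)))) ⟩
        sum (λ (a : F) → a ^ suc m) + (sum (λ (a : F) → ⟦ suc m ⟧ * a ^ m) + sum g)
          ≡⟨ cong (sum (λ (a : F) → a ^ suc m) +_) (sym (∑-distrib-+ {q} _ g)) ⟩
        sum (λ (a : F) → a ^ suc m) + sum (λ a → ⟦ suc m ⟧ * a ^ m + g a)
          ≡⟨ sym (∑-distrib-+ {q} _ _) ⟩
        sum (λ a → a ^ suc m + (⟦ suc m ⟧ * a ^ m + g a))
          ≡⟨ sum-cong-≗ {q} (λ a → sym (eq a)) ⟩
        sum (λ a → (a + 1F) ^ suc m)
          ≡⟨ sum-shift (_^ suc m) ⟩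
        sum (λ (a : F) → a ^ suc m) ∎)
        where open ≡-Reasoning
    ...   | inj₂ S≡0 = S≡0
    ...   | inj₁ m+1≡0 = contradiction (∣⇒≤ (mod-zero⇒∣ (suc m) m+1≡0))
      (ℕ.<⇒≱ (subst (suc m ℕ.<_) suc[q∸1]≡q (ℕ.s≤s m<q-1)))

  -- The sum factors over the coordinates. If every exponent were at least q - 1, the degree would
  -- reach n (q - 1); so one of the factors is a vanishing power sum.
  sumV-mon : ∀ (t : Vec ℕ n) → Vec.sum t ℕ.< n ℕ.* (q ∸ 1) → sumV (mon t) ≡ 0F
  sumV-mon {suc n} (m ∷ t) h = trans
    (trans (trans (sumV-suc (mon (m ∷ t))) (sum-cong-≗ {q} λ c → sumV-*ˡ (c ^ m) (mon t))) (sym (*-distribʳ-sum {q} (sumV (mon t)) (_^ m)))) product≡0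
    where
    product≡0 : sum (λ (c : F) → c ^ m) * sumV (mon t) ≡ 0F
    product≡0 with m ℕ.<? q ∸ 1
    ... | yes m<q-1 = trans (cong (_* sumV (mon t)) (power-sum m m<q-1)) (zeroˡ _)
    ... | no  m≮q-1 = trans (cong (sum (λ (c : F) → c ^ m) *_) (sumV-mon t
      (ℕ.+-cancelˡ-< (q ∸ 1) _ _ (ℕ.≤-<-trans (ℕ.+-monoˡ-≤ (Vec.sum t) (ℕ.≮⇒≥ m≮q-1)) h)))) (zeroʳ _)

  sumV-Deg : Deg {n} k f → k ℕ.< n ℕ.* (q ∸ 1) → sumV f ≡ 0F
  sumV-Deg (mono c t s e) h = trans (sumV-cong e) (trans (sumV-*ˡ c (mon t))
    (trans (cong (c *_) (sumV-mon t (ℕ.≤-<-trans s h))) (zeroʳ c)))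
  sumV-Deg (plus p r e) h = trans (sumV-cong e) (trans (sumV-+ _ _)
    (trans (cong₂ _+_ (sumV-Deg p h) (sumV-Deg r h)) (+-identityʳ 0F)))

-- Indicator polynomials and the duality of Reed-Muller codes

module Indicators (q : ℕ) .{{_ : NonZero q}} (q-prime : Prime q) where

  open PrimeField q q-prime
  open Sums q q-prime
  open Polynomials q q-prime
  open Pairing q q-prime
  open import Algebra.Properties.Group (CommutativeRing.+-group 𝔽) using (x∙y⁻¹≈ε⇒x≈y)
  open import Algebra.Solver.Ring.NaturalCoefficients.Default commutativeSemiring
    using (solve; _:+_; _:*_; _:=_)

  private variable
    n k : ℕ

  x-x≡0 : ∀ (a : F) → a + - a ≡ 0F
  x-x≡0 = -‿inverseʳ

  x-y≡0⇒x≡y : ∀ (a b : F) → a + - b ≡ 0F → a ≡ b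
  x-y≡0⇒x≡y = x∙y⁻¹≈ε⇒x≈y

  <q⇒mod≢0 : ∀ k → suc k ℕ.< q → ⟦ suc k ⟧ ≢ 0F
  <q⇒mod≢0 k k<q eq = contradiction (∣⇒≤ (mod-zero⇒∣ (suc k) eq)) (ℕ.<⇒≱ k<q)

  1F≢0F : 1F {q} ≢ 0F
  1F≢0F = <q⇒mod≢0 0 (subst (1 ℕ.<_) suc[q∸1]≡q (ℕ.s≤s 1≤q∸1))

  *-nonZero : ∀ {a b : F} → a ≢ 0F → b ≢ 0F → a * b ≢ 0F
  *-nonZero {a} {b} a≢0 b≢0 eq with noZeroDivisors a b eq
  ... | inj₁ a≡0 = a≢0 a≡0
  ... | inj₂ b≡0 = b≢0 b≡0

  *-cancelʳ-≢0 : ∀ {a b c : F} → c ≢ 0F → a * c ≡ b * c → a ≡ b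
  *-cancelʳ-≢0 {a} {b} {c} c≢0 eq with noZeroDivisors (a + - b) c
    (trans (distribʳ c a (- b)) (trans (cong₂ _+_ eq (sym (-‿distribˡ-* b c))) (x-x≡0 (b * c))))
  ... | inj₁ a-b≡0 = x-y≡0⇒x≡y a b a-b≡0
  ... | inj₂ c≡0   = contradiction c≡0 c≢0

  *-separates : ∀ {a b c : F} → a ≢ b → a * c ≡ b * c → c ≡ 0F
  *-separates {a} {b} {c} a≢b eq with c Fin.≟ 0F
  ... | yes c≡0 = c≡0
  ... | no  c≢0 = contradiction (*-cancelʳ-≢0 c≢0 eq) a≢b

  -- The product of t + j for 1 ≤ j ≤ m. For m = q - 1 its roots are exactly the nonzero elements,
  -- so after scaling it is the indicator of 0, without recourse to Fermat's theorem.
  rising : ℕ → F → F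
  rising zero    t = 1F
  rising (suc m) t = (t + ⟦ suc m ⟧) * rising m t

  rising-0 : ∀ m → m ℕ.< q → rising m 0F ≢ 0F
  rising-0 zero    h = 1F≢0F
  rising-0 (suc m) h = *-nonZero (λ eq → <q⇒mod≢0 m h (trans (sym (+-identityˡ _)) eq)) (rising-0 m (ℕ.<⇒≤ h))

  rising-root : ∀ m k t → suc k ℕ.≤ m → t + ⟦ suc k ⟧ ≡ 0F → rising m t ≡ 0F
  rising-root (suc m) k t h eq with k ℕ.≟ m
  ... | yes refl = trans (cong (_* rising m t) eq) (zeroˡ _)
  ... | no  k≢m  = trans (cong ((t + ⟦ suc m ⟧) *_) (rising-root m k t (ℕ.≤∧≢⇒< (ℕ.s≤s⁻¹ h) k≢m) eq)) (zeroʳ _)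

  rising-≢0 : ∀ t → t ≢ 0F → rising (q ∸ 1) t ≡ 0F
  rising-≢0 t t≢0 = go (toℕ t) refl
    where
    go : ∀ m → toℕ t ≡ m → rising (q ∸ 1) t ≡ 0F
    go zero    eq = contradiction (trans (sym (mod-toℕ t)) (cong ⟦_⟧ eq)) t≢0
    -- The vanishing factor is t + j with j = q - t, written as a successor because the factors
    -- start at j = 1.
    go (suc m) eq = rising-root (q ∸ 1) (q ∸ 2 ∸ m) t bound (begin
      t + ⟦ suc (q ∸ 2 ∸ m) ⟧                ≡⟨ cong (_+ ⟦ suc (q ∸ 2 ∸ m) ⟧) (trans (sym (mod-toℕ t)) (cong ⟦_⟧ eq)) ⟩
      ⟦ suc m ⟧ + ⟦ suc (q ∸ 2 ∸ m) ⟧        ≡⟨ ⟦⟧-+ (suc m) _ ⟩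
      ⟦ suc m ℕ.+ suc (q ∸ 2 ∸ m) ⟧          ≡⟨ cong ⟦_⟧ sum≡q ⟩
      ⟦ q ⟧                                  ≡⟨ mod-q ⟩
      0F                                     ∎)
      where
      open ≡-Reasoning
      m+2≤q : suc (suc m) ℕ.≤ q
      m+2≤q = subst (ℕ._< q) eq (Fin.toℕ<n t)
      sum≡q : suc m ℕ.+ suc (q ∸ 2 ∸ m) ≡ q
      sum≡q = trans (ℕ.+-suc (suc m) _) (trans (cong (λ z → suc (suc (m ℕ.+ z))) (ℕ.∸-+-assoc q 2 m)) (ℕ.m+[n∸m]≡n m+2≤q))
      bound : suc (q ∸ 2 ∸ m) ℕ.≤ q ∸ 1
      bound = ℕ.≤-trans (ℕ.s≤s (ℕ.m∸n≤m (q ∸ 2) m)) (ℕ.≤-reflexive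
        (trans (sym (ℕ.+-∸-assoc 1 (ℕ.≤-trans (ℕ.s≤s (ℕ.s≤s ℕ.z≤n)) m+2≤q))) refl))

  opaque
    ind : F → F
    ind t = proj₁ (inverse _ (rising-0 (q ∸ 1) (ℕ.≤-reflexive suc[q∸1]≡q))) * rising (q ∸ 1) t

    ind-0 : ind 0F ≡ 1F
    ind-0 = proj₂ (inverse _ (rising-0 (q ∸ 1) (ℕ.≤-reflexive suc[q∸1]≡q)))

    ind-≢0 : ∀ {t} → t ≢ 0F → ind t ≡ 0F
    ind-≢0 {t} t≢0 = trans (cong (_ *_) (rising-≢0 t t≢0)) (zeroʳ _)

    Deg-ind : ∀ {v : Fun q n} → Deg 1 v → Deg (q ∸ 1) (ind ∘ v)
    Deg-ind {n} {v} dv = Deg-scale _ (Deg-rising (q ∸ 1))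
      where
      Deg-rising : ∀ m → Deg m (rising m ∘ v)
      Deg-rising zero    = Deg-const 1F
      Deg-rising (suc m) = Deg-* (plus dv (Deg-const ⟦ suc m ⟧) λ _ → refl) (Deg-rising m)

  δ : F → F → F
  δ c x = ind (x + - c)

  δ-≡ : ∀ c → δ c c ≡ 1F
  δ-≡ c = trans (cong ind (x-x≡0 c)) ind-0

  δ-≢ : ∀ {c x} → x ≢ c → δ c x ≡ 0F
  δ-≢ {c} {x} x≢c = ind-≢0 (x≢c ∘ x-y≡0⇒x≡y x c)

  -- `δ c` is an eigenvector, with eigenvalue c, of multiplication by the variable; the joint
  -- eigenvectors below are built from this.
  δ-* : ∀ c x → x * δ c x ≡ c * δ c x
  δ-* c x with x Fin.≟ c
  ... | yes refl = refl
  ... | no  x≢c = trans (cong (x *_) (δ-≢ x≢c)) (trans (zeroʳ x) (sym (trans (cong (c *_) (δ-≢ x≢c)) (zeroʳ c))))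

  ∑-δ : ∀ x → sum (λ c → δ c x) ≡ 1F
  ∑-δ x = trans (sum-single {q} (λ c → δ c x) x (λ c c≢x → δ-≢ (c≢x ∘ sym))) (δ-≡ x)

  Deg-δ : ∀ c {v : Fun q n} → Deg 1 v → Deg (q ∸ 1) (δ c ∘ v)
  Deg-δ c dv = Deg-ind (plus dv (Deg-const (- c)) λ _ → refl)

  -- Lagrange interpolation over all of 𝔽.
  Deg-unary : ∀ (g : F → F) {v : Fun q n} → Deg 1 v → Deg (q ∸ 1) (g ∘ v)
  Deg-unary g {v} dv = Deg-ext (Deg-∑ {m = q} _ λ c → Deg-scale (g c) (Deg-δ c dv)) λ x → sym (trans
    (sum-single {q} (λ c → g c * δ c (v x)) (v x) λ c c≢x → trans (cong (g c *_) (δ-≢ (c≢x ∘ sym))) (zeroʳ _))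
    (trans (cong (g (v x) *_) (δ-≡ (v x))) (*-identityʳ _)))

  prod : ∀ {m} → (Fin m → F) → F
  prod {zero}  g = 1F
  prod {suc m} g = g zero * prod (g ∘ suc)

  prod-1 : ∀ {m} (g : Fin m → F) → (∀ i → g i ≡ 1F) → prod g ≡ 1F
  prod-1 {zero}  g h = refl
  prod-1 {suc m} g h = trans (cong₂ _*_ (h zero) (prod-1 (g ∘ suc) (h ∘ suc))) (*-identityʳ 1F)

  prod-0 : ∀ {m} (g : Fin m → F) i → g i ≡ 0F → prod g ≡ 0F
  prod-0 g zero    h = trans (cong (_* prod (g ∘ suc)) h) (zeroˡ _)
  prod-0 g (suc i) h = trans (cong (g zero *_) (prod-0 (g ∘ suc) i h)) (zeroʳ _)

  Deg-prod : ∀ {m} (g : Fin m → Fun q n) → (∀ i → Deg k (g i)) → Deg (m ℕ.* k) (λ x → prod λ i → g i x)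
  Deg-prod {m = zero}  g h = Deg-const 1F
  Deg-prod {m = suc m} g h = Deg-* (h zero) (Deg-prod (g ∘ suc) (h ∘ suc))

  ≢⇒lookup≢ : ∀ {A : Set} (_≟_ : ∀ (a b : A) → Dec (a ≡ b)) (x y : Vec A n) → x ≢ y → ∃[ i ] lookup x i ≢ lookup y i
  ≢⇒lookup≢ _≟_ []      []      x≢y = contradiction refl x≢y
  ≢⇒lookup≢ _≟_ (a ∷ x) (b ∷ y) x≢y with a ≟ b
  ... | no a≢b   = zero , a≢b
  ... | yes refl with ≢⇒lookup≢ _≟_ x y (x≢y ∘ cong (a ∷_))
  ...   | i , ne = suc i , ne

  -- The indicator of the diagonal of 𝔽ⁿ × 𝔽ⁿ, that is, the reproducing kernel of the pairing, as
  -- one polynomial function in 2n variables.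
  δV : Fun q (n ℕ.+ n)
  δV {n} w = prod λ (i : Fin n) → ind (lookup w (i ↑ˡ n) + - lookup w (n ↑ʳ i))

  Deg-δV : Deg (n ℕ.* (q ∸ 1)) (δV {n})
  Deg-δV {n} = Deg-prod {m = n} _ λ i → Deg-ind
    (plus (Deg-var (i ↑ˡ n)) (Deg-ext (Deg-scale (- 1F) (Deg-var (n ↑ʳ i))) λ x → sym (-1*x≈-x _)) λ _ → refl)

  δV-factor : ∀ (x z : Vec F n) i →
    ind (lookup (x ++ z) (i ↑ˡ n) + - lookup (x ++ z) (n ↑ʳ i)) ≡ δ (lookup z i) (lookup x i)
  δV-factor x z i = cong₂ (λ a b → ind (a + - b)) (Vec.lookup-++ˡ x z i) (Vec.lookup-++ʳ x z i)

  δV-≡ : ∀ (x : Vec F n) → δV {n} (x ++ x) ≡ 1F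
  δV-≡ {n} x = prod-1 {n} _ λ i → trans (δV-factor x x i) (δ-≡ _)

  δV-≢ : ∀ {x z : Vec F n} → x ≢ z → δV {n} (x ++ z) ≡ 0F
  δV-≢ {n} {x} {z} x≢z with ≢⇒lookup≢ Fin._≟_ x z x≢z
  ... | i , ne = prod-0 {n} _ i (trans (δV-factor x z i) (δ-≢ ne))

  mon-++ : ∀ {m} (s : Vec ℕ n) (t : Vec ℕ m) x z → mon (s ++ t) (x ++ z) ≡ mon s x * mon t z
  mon-++ []      t []      z = sym (*-identityˡ _)
  mon-++ (i ∷ s) t (c ∷ x) z = trans (cong (c ^ i *_) (mon-++ s t x z)) (sym (*-assoc _ _ _))

  sum-++ : ∀ {m} (s : Vec ℕ n) (t : Vec ℕ m) → Vec.sum (s ++ t) ≡ Vec.sum s ℕ.+ Vec.sum t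
  sum-++ []      t = refl
  sum-++ (i ∷ s) t = trans (cong (i ℕ.+_) (sum-++ s t)) (sym (ℕ.+-assoc i _ _))

  -- Each monomial of K is a product of a monomial in x and one in z; if the latter
  -- has degree at most N it is annihilated by g, otherwise the former has degree
  -- at most D − N − 1.
  Deg-convolution : ∀ {m D N K} → Deg {n ℕ.+ m} D K → (g : Fun q m) → (∀ {h} → Deg N h → ⟨ g , h ⟩ ≡ 0F) →
                    Deg (D ∸ suc N) (λ x → ⟨ g , (λ z → K (x ++ z)) ⟩)
  Deg-convolution {n} {m} {D} {N} {K} (mono c w s e) g ann with Vec.splitAt n w
  ... | t₁ , t₂ , refl with Vec.sum t₂ ℕ.≤? N
  ...   | yes t₂≤N = Deg-ext (Deg-const 0F) λ x → trans (⟨⟩-cong g λ z → trans (e (x ++ z)) (trans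
            (cong (c *_) (mon-++ t₁ t₂ x z)) (sym (*-assoc _ _ _))))
          (trans (⟨⟩-* g _ _) (trans (cong (_ *_) (ann (Deg-weaken t₂≤N (Deg-mon t₂)))) (zeroʳ _)))
  ...   | no t₂≰N = mono (c * ⟨ g , mon t₂ ⟩) t₁
            (ℕ.m+n≤o⇒m≤o∸n _ (ℕ.≤-trans (ℕ.+-monoʳ-≤ _ (ℕ.≰⇒> t₂≰N)) (subst (ℕ._≤ D) (sum-++ t₁ t₂) s)))
            λ x → trans (⟨⟩-cong g λ z → trans (e (x ++ z)) (trans
              (cong (c *_) (mon-++ t₁ t₂ x z)) (sym (*-assoc _ _ _))))
            (trans (⟨⟩-* g _ _) (solve 3 (λ c m b → c :* m :* b := c :* b :* m) refl c (mon t₁ x) ⟨ g , mon t₂ ⟩))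
  Deg-convolution {n} {m} (plus a b e) g ann =
    plus (Deg-convolution {n} {m} a g ann) (Deg-convolution {n} {m} b g ann)
      λ x → trans (⟨⟩-cong g λ z → e (x ++ z)) (⟨⟩-+ g _ _)

  -- Pairing g with the kernel `δV` in its second half returns g, while `Deg-convolution` lowers the
  -- degree n (q - 1) of the kernel by N + 1. This direction of Reed-Muller duality is thus obtained
  -- without counting dimensions.
  annihilator⇒Deg : ∀ {N} (g : Fun q n) → (∀ {h} → Deg N h → ⟨ g , h ⟩ ≡ 0F) → Deg (n ℕ.* (q ∸ 1) ∸ suc N) g
  annihilator⇒Deg {n} g ann = Deg-ext (Deg-convolution {n} {n} (Deg-δV {n}) g ann) λ x → sym (begin
    ⟨ g , (λ z → δV {n} (x ++ z)) ⟩       ≡⟨ ⟨⟩≡sumV g _ ⟩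
    sumV (λ z → g z * δV {n} (x ++ z))    ≡⟨ sumV-single _ x (λ z z≢x → trans (cong (g z *_) (δV-≢ (z≢x ∘ sym))) (zeroʳ _)) ⟩
    g x * δV {n} (x ++ x)                 ≡⟨ cong (g x *_) (δV-≡ x) ⟩
    g x * 1F                              ≡⟨ *-identityʳ _ ⟩
    g x                                   ∎)
    where open ≡-Reasoning

-- Linear functionals, dual bases and linear dependence

module LinearAlgebra (q : ℕ) .{{_ : NonZero q}} (q-prime : Prime q) where

  open PrimeField q q-prime
  open Sums q q-prime
  open Polynomials q q-prime
  open Pairing q q-prime
  open Indicators q q-prime
  open import Algebra.Solver.Ring.NaturalCoefficients.Default commutativeSemiring
    using (solve; _:+_; _:*_; _:=_)

  private variable
    n : ℕ

  module _ {k n : ℕ} {Q : Fun q n → Set} (Q-ext : ∀ {f g} → (∀ x → f x ≡ g x) → Q f → Q g) (Q? : Decidable Q) where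

    -- There are only finitely many coefficient vectors to search. This makes the case distinctions
    -- of the proof decidable, so that no excluded middle is invoked.
    anyDeg? : Dec (∃[ h ] (Deg k h × Q h))
    anyDeg? = map′ (λ (c , Qc) → eval c , Deg-eval c , Qc)
      (λ (h , dh , Qh) → let (c , e) = Deg⇒InReedMuller dh in c , Q-ext e Qh)
      (anyVec? λ (c : Polynomial q n k) → Q? (eval c))

    allDeg? : Dec (∀ h → Deg k h → Q h)
    allDeg? = map′ (λ all h dh → let (c , e) = Deg⇒InReedMuller dh in Q-ext (λ x → sym (e x)) (all c))
      (λ all c → all _ (Deg-eval c))
      (allVec? λ (c : Polynomial q n k) → Q? (eval c))

  record Linear (φ : Fun q n → F) : Set where
    field
      ext     : ∀ {g h} → (∀ x → g x ≡ h x) → φ g ≡ φ h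
      +-homo  : ∀ g h → φ (λ x → g x + h x) ≡ φ g + φ h
      *-homo  : ∀ a h → φ (λ x → a * h x) ≡ a * φ h

    0-homo : φ (λ _ → 0F) ≡ 0F
    0-homo = trans (ext λ _ → sym (zeroˡ 0F)) (trans (*-homo 0F _) (zeroˡ _))

    ∑-homo : ∀ {m} (g : Fin m → Fun q n) → φ (λ x → sum λ i → g i x) ≡ sum λ i → φ (g i)
    ∑-homo {zero}  g = 0-homo
    ∑-homo {suc m} g = trans (+-homo _ _) (cong (φ (g zero) +_) (∑-homo (g ∘ suc)))

    linearCombination : ∀ {m} (c : Fin m → F) (g : Fin m → Fun q n) →
                        φ (λ x → sum λ i → c i * g i x) ≡ sum λ i → c i * φ (g i)
    linearCombination {m} c g = trans (∑-homo λ i x → c i * g i x) (sum-cong-≗ {m} λ i → *-homo (c i) (g i))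

  open Linear

  ev-linear : ∀ (z : Vec F n) → Linear (λ h → h z)
  ev-linear z = record { ext = λ e → e z ; +-homo = λ _ _ → refl ; *-homo = λ _ _ → refl }

  ⟨⟩-linear : ∀ (f u : Fun q n) → Linear (λ h → ⟨ f , (λ x → u x * h x) ⟩)
  ⟨⟩-linear f u = record
    { ext = λ e → ⟨⟩-cong f λ x → cong (u x *_) (e x)
    ; +-homo = λ g h → trans (⟨⟩-cong f λ x → distribˡ (u x) (g x) (h x)) (⟨⟩-+ f _ _)
    ; *-homo = λ a h → trans (⟨⟩-cong f λ x → solve 3 (λ u a h → u :* (a :* h) := a :* (u :* h)) refl (u x) a (h x)) (⟨⟩-* f a _)
    }

  -- A maximal subfamily of the functionals `α a`, `a ∈ as`, independent on degree ≤ k, with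
  -- biorthogonal polynomials. Maximality is stated in `spans` as an inclusion of kernels;
  -- `expansion` recovers the coefficients.
  record DualBasis {A : Set} (α : A → Fun q n → F) (k : ℕ) (as : List A) : Set where
    field
      size      : ℕ
      elem      : Fin size → A
      elem∈     : ∀ i → elem i ∈ as
      dual      : Fin size → Fun q n
      dual-Deg  : ∀ i → Deg k (dual i)
      dual-≡    : ∀ i → α (elem i) (dual i) ≡ 1F
      dual-≢    : ∀ i j → i ≢ j → α (elem i) (dual j) ≡ 0F
      spans     : ∀ {h} → Deg k h → (∀ i → α (elem i) h ≡ 0F) → ∀ {a} → a ∈ as → α a h ≡ 0F

  module _ {A : Set} {α : A → Fun q n → F} (lin : ∀ a → Linear (α a)) {k : ℕ} where

    -- Gaussian elimination: a new functional is kept when some h is killed by all kept ones but not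
    -- by it. As h is killed by the old functionals, subtracting multiples of it from the old dual
    -- polynomials leaves the old values unchanged.
    dualBasis : ∀ as → DualBasis α k as
    dualBasis [] = record
      { size = 0 ; elem = λ () ; elem∈ = λ () ; dual = λ () ; dual-Deg = λ ()
      ; dual-≡ = λ () ; dual-≢ = λ () ; spans = λ _ _ () }
    dualBasis (a ∷ as) with dualBasis as
    ... | B with anyDeg? {k} {Q = λ h → (∀ i → α (DualBasis.elem B i) h ≡ 0F) × α a h ≢ 0F}
                (λ e (p , ne) → (λ i → trans (sym (ext (lin _) e)) (p i)) , ne ∘ trans (ext (lin a) e))
                (λ h → Fin.all? (λ i → α (DualBasis.elem B i) h Fin.≟ 0F) ×-dec ¬? (α a h Fin.≟ 0F))
    ...   | no none = record
      { DualBasis B hiding (elem∈; spans)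
      ; elem∈ = λ i → there (DualBasis.elem∈ B i)
      ; spans = λ where
          dh p (here refl) → spans-head dh p
          dh p (there b∈)  → DualBasis.spans B dh p b∈
      }
      where
      spans-head : ∀ {h} → Deg k h → (∀ i → α (DualBasis.elem B i) h ≡ 0F) → α a h ≡ 0F
      spans-head {h} dh p with α a h Fin.≟ 0F
      ... | yes eq = eq
      ... | no  ne = contradiction (h , dh , p , ne) none
    ...   | yes (h , dh , p , ne) = record
      { size = suc size
      ; elem = λ where zero → a
                       (suc i) → elem i
      ; elem∈ = λ where zero → here refl
                        (suc i) → there (elem∈ i)
      ; dual = λ where zero → h₀
                       (suc j) → dual′ j
      ; dual-Deg = λ where zero → Deg-scale _ dh
                           (suc j) → plus (dual-Deg j) (Deg-scale _ (Deg-scale _ dh)) λ _ → refl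
      ; dual-≡ = λ where zero → α-h₀
                         (suc i) → trans (α-elem-dual′ i i) (dual-≡ i)
      ; dual-≢ = λ where
          zero    zero    0≢0 → contradiction refl 0≢0
          zero    (suc j) _   → α-a-dual′ j
          (suc i) zero    _   → α-elem-h₀ i
          (suc i) (suc j) i≢j → trans (α-elem-dual′ i j) (dual-≢ i j (i≢j ∘ cong suc))
      ; spans = λ where
          dh′ p′ (here refl) → p′ zero
          dh′ p′ (there b∈)  → spans dh′ (p′ ∘ suc) b∈
      }
      where
      open DualBasis B
      c = proj₁ (inverse (α a h) ne)
      h₀ : Fun q n
      h₀ x = c * h x
      dual′ : Fin size → Fun q n
      dual′ j x = dual j x + - α a (dual j) * h₀ x
      α-h₀ : α a h₀ ≡ 1F
      α-h₀ = trans (*-homo (lin a) c h) (proj₂ (inverse (α a h) ne))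
      α-elem-h₀ : ∀ i → α (elem i) h₀ ≡ 0F
      α-elem-h₀ i = trans (*-homo (lin _) c h) (trans (cong (c *_) (p i)) (zeroʳ c))
      α-dual′ : ∀ b j → α b (dual′ j) ≡ α b (dual j) + - α a (dual j) * α b h₀
      α-dual′ b j = trans (+-homo (lin b) _ _) (cong (α b (dual j) +_) (*-homo (lin b) _ _))
      α-elem-dual′ : ∀ i j → α (elem i) (dual′ j) ≡ α (elem i) (dual j)
      α-elem-dual′ i j = trans (α-dual′ (elem i) j) (trans
        (cong (α (elem i) (dual j) +_) (trans (cong (- α a (dual j) *_) (α-elem-h₀ i)) (zeroʳ _))) (+-identityʳ _))
      α-a-dual′ : ∀ j → α a (dual′ j) ≡ 0F
      α-a-dual′ j = trans (α-dual′ a j) (trans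
        (cong (α a (dual j) +_) (trans (cong (- α a (dual j) *_) α-h₀) (*-identityʳ _))) (x-x≡0 _))

    module _ {as} (B : DualBasis α k as) where
      open DualBasis B

      elem-combination : ∀ (c : Fin size → F) i → α (elem i) (λ x → sum λ j → c j * dual j x) ≡ c i
      elem-combination c i = trans (linearCombination (lin _) c dual) (trans
        (sum-single {size} _ i λ j j≢i → trans (cong (c j *_) (dual-≢ i j (j≢i ∘ sym))) (zeroʳ _))
        (trans (cong (c i *_) (dual-≡ i)) (*-identityʳ _)))

      -- Subtracting from h its interpolant in the dual polynomials leaves a remainder killed by
      -- every selected functional, hence by ψ.
      expansion : ∀ {ψ : Fun q n → F} → Linear ψ → (∀ {h} → Deg k h → (∀ i → α (elem i) h ≡ 0F) → ψ h ≡ 0F) →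
                  ∀ {h} → Deg k h → ψ h ≡ sum λ j → α (elem j) h * ψ (dual j)
      expansion {ψ} ψ-lin ψ-ann {h} dh = trans (x-y≡0⇒x≡y _ _ (trans (sym (remainder ψ-lin)) (ψ-ann remainder-Deg
          λ i → trans (remainder (lin (elem i))) (trans (cong (λ z → α (elem i) h + - z) (elem-combination c i)) (x-x≡0 _)))))
        (linearCombination ψ-lin c dual)
        where
        c : Fin size → F
        c j = α (elem j) h
        remainder-Deg : Deg k (λ x → h x + (- 1F) * (sum λ j → c j * dual j x))
        remainder-Deg = plus dh (Deg-scale _ (Deg-∑ {m = size} _ λ j → Deg-scale (c j) (dual-Deg j))) λ _ → refl
        remainder : ∀ {φ} → Linear φ → φ (λ x → h x + (- 1F) * (sum λ j → c j * dual j x)) ≡ φ h + - φ (λ x → sum λ j → c j * dual j x)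
        remainder {φ} φ-lin = trans (+-homo φ-lin _ _) (cong (φ h +_) (trans (*-homo φ-lin (- 1F) _) (-1*x≈-x _)))

  ∑-difference : ∀ {m} (a b u : Fin m → F) →
    sum (λ i → (a i + - b i) * u i) ≡ sum (λ i → a i * u i) + - sum (λ i → b i * u i)
  ∑-difference {m} a b u = begin
    sum (λ i → (a i + - b i) * u i)
      ≡⟨ sum-cong-≗ {m} (λ i → trans (distribʳ (u i) _ _) (cong (_ +_) (trans (sym (-‿distribˡ-* _ _)) (sym (-1*x≈-x _))))) ⟩
    sum (λ i → a i * u i + - 1F * (b i * u i))
      ≡⟨ ∑-distrib-+ {m} _ _ ⟩
    sum (λ i → a i * u i) + sum (λ i → - 1F * (b i * u i))
      ≡⟨ cong (sum (λ i → a i * u i) +_) (trans (sym (*-distribˡ-sum {m} (- 1F) _)) (-1*x≈-x _)) ⟩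
    sum (λ i → a i * u i) + - sum (λ i → b i * u i) ∎
    where open ≡-Reasoning

  finToFun-injective : ∀ {m n} {i j : Fin (m ℕ.^ n)} → (∀ l → finToFun {m} {n} i l ≡ finToFun j l) → i ≡ j
  finToFun-injective {n = zero}  {zero} {zero} h = refl
  finToFun-injective {m} {suc n} {i} {j} h = trans (sym (Fin.combine-remQuot {m} (m ℕ.^ n) i))
    (trans (cong₂ combine (h zero) (finToFun-injective {m} {n} (h ∘ suc))) (Fin.combine-remQuot {m} (m ℕ.^ n) j))

  1<q : 1 ℕ.< q
  1<q = subst (1 ℕ.<_) suc[q∸1]≡q (ℕ.s≤s 1≤q∸1)

  -- Pigeonhole instead of rank: q^w coefficient vectors have at most q^d < q^w values, and the
  -- difference of two colliding vectors is the dependency.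
  dependency : ∀ {w d} → d ℕ.< w → (M : Fin w → Fin d → F) →
               ∃[ c ] (∃[ i ] c i ≢ 0F) × (∀ j → sum (λ i → c i * M i j) ≡ 0F)
  dependency {w} {d} d<w M with Fin.pigeonhole (ℕ.^-monoʳ-< q 1<q d<w)
    (λ γ → funToFin λ j → sum λ i → finToFun {q} {w} γ i * M i j)
  ... | γ , γ′ , γ<γ′ , eq = c , nonZero , combination≡0
    where
    c : Fin w → F
    c i = finToFun γ i + - finToFun γ′ i
    value : Fin (q ℕ.^ w) → Fin d → F
    value γ j = sum λ i → finToFun {q} {w} γ i * M i j
    value≡ : ∀ j → value γ j ≡ value γ′ j
    value≡ j = trans (sym (Fin.finToFun-funToFin (value γ) j))
      (trans (cong (λ z → finToFun {q} {d} z j) eq) (Fin.finToFun-funToFin (value γ′) j))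
    nonZero : ∃[ i ] c i ≢ 0F
    nonZero with Fin.any? (λ i → ¬? (c i Fin.≟ 0F))
    ... | yes p = p
    ... | no none = contradiction (finToFun-injective λ i → x-y≡0⇒x≡y _ _ (zero-entry i)) (Fin.<⇒≢ γ<γ′)
      where
      zero-entry : ∀ i → c i ≡ 0F
      zero-entry i with c i Fin.≟ 0F
      ... | yes e = e
      ... | no ne = contradiction (i , ne) none
    combination≡0 : ∀ j → sum (λ i → c i * M i j) ≡ 0F
    combination≡0 j = trans (∑-difference (finToFun γ) (finToFun γ′) (λ i → M i j))
      (trans (cong (λ z → z + - value γ′ j) (value≡ j)) (x-x≡0 _))

-- Enumeration of the code, distances and the counting argument

module Codewords (q : ℕ) .{{_ : NonZero q}} (q-prime : Prime q) where

  open PrimeField q q-prime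
  open Sums q q-prime
  open Polynomials q q-prime
  open Pairing q q-prime
  open Indicators q q-prime
  open LinearAlgebra q q-prime

  private variable
    n : ℕ
    f g h : Fun q n

  open Linear

  lookup-injective : ∀ {a ℓ} (S : Setoid a ℓ) {xs} → Unique S xs → ∀ i j →
                     Setoid._≈_ S (List.lookup xs i) (List.lookup xs j) → i ≡ j
  lookup-injective S {x ∷ xs} (x∉ ∷ u) zero    zero    eq = refl
  lookup-injective S {x ∷ xs} (x∉ ∷ u) zero    (suc j) eq = contradiction eq (All.lookup x∉ (∈-lookup {xs = xs} j))
  lookup-injective S {x ∷ xs} (x∉ ∷ u) (suc i) zero    eq =
    contradiction (Setoid.sym S eq) (All.lookup x∉ (∈-lookup {xs = xs} i))
  lookup-injective S {x ∷ xs} (x∉ ∷ u) (suc i) (suc j) eq = cong suc (lookup-injective S u i j eq)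

  min-map≤ : ∀ {A : Set} (φ : A → ℕ) {xs} m {x} → x ∈ xs → min m (List.map φ xs) ℕ.≤ φ x
  min-map≤ φ m x∈ = All.lookup (min≤xs m _) (∈-map⁺ φ x∈)

  min-map< : ∀ {A : Set} (φ : A → ℕ) xs {m l} → min m (List.map φ xs) ℕ.< l → m ℕ.< l ⊎ (∃[ x ] x ∈ xs × φ x ℕ.< l)
  min-map< φ xs {m} lt with argmin-sel id m (List.map φ xs)
  ... | inj₁ eq = inj₁ (subst (ℕ._< _) eq lt)
  ... | inj₂ ∈map with ∈-map⁻ φ ∈map
  ...   | x , x∈ , eq = inj₂ (x , x∈ , subst (ℕ._< _) eq lt)

  FunSetoid : ℕ → Setoid 0ℓ 0ℓ
  FunSetoid n = Vec F n →-setoid F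

  module _ {n : ℕ} where

    open SetoidMembership (FunSetoid n) using () renaming (_∈_ to _∈≗_)

    fromVec-toVec : ∀ (i : Fin (q ℕ.^ n)) → fromVec {q} {n} (toVec i) ≡ i
    fromVec-toVec i = finToFun-injective {q} {n} λ l → trans
      (Fin.finToFun-funToFin (lookup (toVec i)) l) (Vec.lookup∘tabulate (finToFun i) l)

    functions-unique : Unique (FunSetoid n) (functions q n)
    functions-unique = Unique.map⁺ (setoid _) (FunSetoid n) (λ {i} {j} eq → finToFun-injective λ l →
      trans (cong (finToFun i) (sym (fromVec-toVec l))) (trans (eq (toVec l)) (cong (finToFun j) (fromVec-toVec l))))
      (UniqueProp.allFin⁺ _)

    ∈-functions : ∀ (f : Fun q n) → f ∈≗ functions q n
    ∈-functions f = Any.map (λ { refl x → sym (trans (Fin.finToFun-funToFin (f ∘ toVec) (fromVec x)) (cong f (toVec-fromVec x))) })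
      (∈-map⁺ (λ i x → finToFun i (fromVec x)) (∈-allFin (funToFin (f ∘ toVec))))

    Deg⇒∈reedMuller : ∀ {d} → Deg d f → f ∈≗ reedMuller q n d
    Deg⇒∈reedMuller {f} {d} df = SetoidMembershipₚ.∈-filter⁺ (FunSetoid n) (inReedMuller? q n d)
      (λ e (c , eq) → c , λ x → trans (sym (e x)) (eq x)) (∈-functions f) (Deg⇒InReedMuller df)

    ∈reedMuller⇒Deg : ∀ {d} → f ∈ reedMuller q n d → Deg d f
    ∈reedMuller⇒Deg {f} {d} f∈ = InReedMuller⇒Deg {n} {d} {f}
      (proj₂ (∈-filter⁻ {P = InReedMuller q n d} (inReedMuller? q n d) {v = f} {xs = functions q n} f∈))

    -- (P, c) ↦ (P + Σ cⱼ Bⱼ, code of Φ P) is injective: nondegeneracy recovers c from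
    -- the values of Φ at P and at P + Σ cⱼ Bⱼ.
    fiber-count : ∀ {e R K} (RM : List (Fun q n)) → Unique (FunSetoid n) RM →
      (∀ {f} → f ∈ RM → Deg e f) → (∀ {f} → Deg e f → f ∈≗ RM) →
      {E : Fun q n → Set} (E? : Decidable E)
      (Φ : Fin R → Fun q n → F) (Φ-linear : ∀ j → Linear (Φ j))
      (B : Fin R → Fun q n) (B-Deg : ∀ i → Deg e (B i)) →
      (∀ c → (∀ j → sum (λ i → c i * Φ j (B i)) ≡ 0F) → ∀ i → c i ≡ 0F) →
      (dec : Fin K → Fin R → F) → (∀ {P} → Deg e P → E P → ∃[ t ] ∀ j → Φ j P ≡ dec t j) →
      length (filter E? RM) ℕ.* q ℕ.^ R ℕ.≤ length RM ℕ.* K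
    fiber-count {e} {R} {K} RM RM-unique sound complete {E} E? Φ Φ-linear B B-Deg nondegenerate dec code = Fin.injective⇒≤ embed-injective
      where
      ER = filter E? RM
      P : Fin (length ER) → Fun q n
      P = List.lookup ER
      P∈ : ∀ a → P a ∈ RM × E (P a)
      P∈ a = ∈-filter⁻ E? {xs = RM} (∈-lookup {xs = ER} a)
      P-code : ∀ a → ∃[ t ] ∀ j → Φ j (P a) ≡ dec t j
      P-code a = code (sound (proj₁ (P∈ a))) (proj₂ (P∈ a))
      shift : Fin (q ℕ.^ R) → Fun q n
      shift γ x = sum λ i → finToFun {q} {R} γ i * B i x
      Q : Fin (length ER) → Fin (q ℕ.^ R) → Fun q n
      Q a γ x = P a x + shift γ x
      Q∈ : ∀ a γ → Q a γ ∈≗ RM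
      Q∈ a γ = complete (plus (sound (proj₁ (P∈ a)))
        (Deg-∑ {m = R} _ λ i → Deg-scale (finToFun γ i) (B-Deg i)) λ _ → refl)
      pair : Fin (length ER) → Fin (q ℕ.^ R) → Fin (length RM ℕ.* K)
      pair a γ = combine (Any.index (Q∈ a γ)) (proj₁ (P-code a))
      pair-injective : ∀ a γ a′ γ′ → pair a γ ≡ pair a′ γ′ → a ≡ a′ × γ ≡ γ′
      pair-injective a γ a′ γ′ eq with Fin.combine-injective (Any.index (Q∈ a γ)) _ _ _ eq
      ... | index≡ , code≡ = lookup-injective (FunSetoid n) ER-unique a a′ P≗P′ , γ≡γ′
        where
        Q≗Q′ : ∀ x → Q a γ x ≡ Q a′ γ′ x
        Q≗Q′ = SetoidMembershipₚ.index-injective (FunSetoid n) (Q∈ a γ) (Q∈ a′ γ′) index≡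
        ΦP≡ΦP′ : ∀ j → Φ j (P a) ≡ Φ j (P a′)
        ΦP≡ΦP′ j = trans (proj₂ (P-code a) j) (trans (cong (λ t → dec t j) code≡) (sym (proj₂ (P-code a′) j)))
        Φshift≡ : ∀ j → Φ j (shift γ) ≡ Φ j (shift γ′)
        Φshift≡ j = +-cancelˡ (Φ j (P a)) _ _ (trans (sym (+-homo (Φ-linear j) _ _)) (trans (ext (Φ-linear j) Q≗Q′)
          (trans (+-homo (Φ-linear j) _ _) (cong (_+ Φ j (shift γ′)) (sym (ΦP≡ΦP′ j))))))
        c : Fin R → F
        c i = finToFun γ i + - finToFun γ′ i
        γ≡γ′ : γ ≡ γ′
        γ≡γ′ = finToFun-injective λ i → x-y≡0⇒x≡y _ _ (nondegenerate c (λ j → begin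
          sum (λ i → c i * Φ j (B i))
            ≡⟨ ∑-difference (finToFun γ) (finToFun γ′) (λ i → Φ j (B i)) ⟩
          sum (λ i → finToFun γ i * Φ j (B i)) + - sum (λ i → finToFun γ′ i * Φ j (B i))
            ≡⟨ cong₂ (λ u v → u + - v) (linearCombination (Φ-linear j) (finToFun γ) B) (linearCombination (Φ-linear j) (finToFun γ′) B) ⟨
          Φ j (shift γ) + - Φ j (shift γ′)
            ≡⟨ cong (_+ - Φ j (shift γ′)) (Φshift≡ j) ⟩
          Φ j (shift γ′) + - Φ j (shift γ′)
            ≡⟨ x-x≡0 _ ⟩
          0F ∎) i)
          where open ≡-Reasoning
        P≗P′ : ∀ x → P a x ≡ P a′ x
        P≗P′ x = +-cancelʳ (shift γ x) _ _ (trans (Q≗Q′ x) (cong (λ δ → P a′ x + shift δ x) (sym γ≡γ′)))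
        ER-unique : Unique (FunSetoid n) ER
        ER-unique = Unique.filter⁺ (FunSetoid n) E? RM-unique
      embed : Fin (length ER ℕ.* q ℕ.^ R) → Fin (length RM ℕ.* K)
      embed i = uncurry pair (remQuot {length ER} (q ℕ.^ R) i)
      embed-injective : ∀ {i j} → embed i ≡ embed j → i ≡ j
      embed-injective {i} {j} eq with pair-injective _ _ _ _ eq
      ... | a≡ , γ≡ = trans (sym (Fin.combine-remQuot {length ER} (q ℕ.^ R) i))
        (trans (cong₂ combine a≡ γ≡) (Fin.combine-remQuot {length ER} (q ℕ.^ R) j))

    reedMuller-unique : ∀ d → Unique (FunSetoid n) (reedMuller q n d)
    reedMuller-unique d = Unique.filter⁺ (FunSetoid n) (inReedMuller? q n d) functions-unique

    hamming-cong : ∀ (f : Fun q n) → (∀ x → g x ≡ h x) → hamming f g ≡ hamming f h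
    hamming-cong {g} {h} f e = cong length (List.filter-≐ (λ x → ¬? (f x Fin.≟ g x)) (λ x → ¬? (f x Fin.≟ h x))
      ((λ {x} ne eq → ne (trans eq (sym (e x)))) , λ {x} ne eq → ne (trans eq (e x))) (vectors q n))

    distance≤hamming : ∀ {d} (f : Fun q n) → Deg d g → distance f d ℕ.≤ hamming f g
    distance≤hamming {g} {d} f dg with find (Deg⇒∈reedMuller dg)
    ... | g′ , g′∈ , g≗g′ = ℕ.≤-trans (min-map≤ (hamming f) _ g′∈) (ℕ.≤-reflexive (hamming-cong f λ x → sym (g≗g′ x)))

    distance<⇒near : ∀ {d m} (f : Fun q n) → distance f d ℕ.< m → ∃[ g ] Deg d g × hamming f g ℕ.< m
    distance<⇒near {d} {m} f lt with min-map< (hamming f) (reedMuller q n d) lt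
    ... | inj₁ 0<m = 0-fun , Deg-const 0F , 0<m
    ... | inj₂ (g , g∈ , g<m) = g , ∈reedMuller⇒Deg g∈ , g<m

-- Lex-minimal monomials and nondegenerate families of divisors

module Divisors (q : ℕ) .{{_ : NonZero q}} (q-prime : Prime q) where

  open PrimeField q q-prime
  open Sums q q-prime
  open Polynomials q q-prime
  open Pairing q q-prime
  open Indicators q q-prime
  open LinearAlgebra q q-prime
  open import Algebra.Solver.Ring.NaturalCoefficients.Default commutativeSemiring
    using (solve; _:+_; _:*_; _:=_)

  private variable
    n k : ℕ

  infix 4 _<ₗ_

  _<ₗ_ : Vec ℕ n → Vec ℕ n → Set
  []      <ₗ []      = ⊥
  (a ∷ s) <ₗ (b ∷ t) = a ℕ.< b ⊎ (a ≡ b × s <ₗ t)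

  LexMinimal : ℕ → (Vec ℕ n → Set) → Vec ℕ n → Set
  LexMinimal k Q u = Vec.sum u ≡ k × Q u × (∀ t → Vec.sum t ≡ k → t <ₗ u → ¬ Q t)

  -- The first exponent j is tried in increasing order, `fuel` counting the candidates left. The
  -- first j with a witness among the tails, joined to the minimal such tail, is the minimum.
  lexMinimal? : ∀ {n} k {Q : Vec ℕ n → Set} → Decidable Q →
                (∀ t → Vec.sum t ≡ k → ¬ Q t) ⊎ ∃[ u ] LexMinimal k Q u
  lexMinimal? {zero} k Q? with k ℕ.≟ 0 | Q? []
  ... | yes refl | yes Q[] = inj₂ ([] , refl , Q[] , λ where [] _ ())
  ... | yes refl | no ¬Q[] = inj₁ λ where [] _ → ¬Q[]
  ... | no k≢0   | _       = inj₁ λ where [] eq → contradiction (sym eq) k≢0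
  lexMinimal? {suc n} k {Q} Q? = go 0 (suc k) refl λ _ ()
    where
    go : ∀ j fuel → j ℕ.+ fuel ≡ suc k → (∀ i → i ℕ.< j → ∀ t → i ℕ.+ Vec.sum t ≡ k → ¬ Q (i ∷ t)) →
         (∀ t → Vec.sum t ≡ k → ¬ Q t) ⊎ ∃[ u ] LexMinimal k Q u
    go j zero eq below = inj₁ λ where
      (i ∷ t) s → below i (subst (i ℕ.<_) (trans (sym eq) (ℕ.+-identityʳ j))
        (ℕ.s≤s (subst (i ℕ.≤_) s (ℕ.m≤m+n i (Vec.sum t))))) t s
    go j (suc fuel) eq below with lexMinimal? {n} (k ∸ j) {Q ∘ (j ∷_)} (Q? ∘ (j ∷_))
    ... | inj₂ (u , s , Qu , min) = inj₂ (j ∷ u , trans (cong (j ℕ.+_) s) (ℕ.m+[n∸m]≡n j≤k) , Qu , λ where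
            (i ∷ t) s′ (inj₁ i<j)         → below i i<j t s′
            (i ∷ t) s′ (inj₂ (refl , t<u)) → min t (trans (sym (ℕ.m+n∸m≡n j (Vec.sum t))) (cong (_∸ j) s′)) t<u)
      where
      j≤k : j ℕ.≤ k
      j≤k = ℕ.s≤s⁻¹ (subst (suc j ℕ.≤_) (trans (sym (ℕ.+-suc j fuel)) eq) (ℕ.s≤s (ℕ.m≤m+n j fuel)))
    ... | inj₁ none = go (suc j) fuel (trans (sym (ℕ.+-suc j fuel)) eq) λ i i<1+j t s → below′ i i<1+j t s
      where
      below′ : ∀ i → i ℕ.< suc j → ∀ t → i ℕ.+ Vec.sum t ≡ k → ¬ Q (i ∷ t)
      below′ i i<1+j t s with i ℕ.≟ j
      ... | yes refl = none t (trans (sym (ℕ.m+n∸m≡n j (Vec.sum t))) (cong (_∸ j) s))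
      ... | no i≢j   = below i (ℕ.≤∧≢⇒< (ℕ.s≤s⁻¹ i<1+j) i≢j) t s

  Deg-^ : ∀ {v : Fun q n} → Deg 1 v → ∀ m → Deg m (λ x → v x ^ m)
  Deg-^ dv zero    = Deg-const 1F
  Deg-^ dv (suc m) = Deg-* dv (Deg-^ dv m)

  -- As a function, a monomial with an exponent ≥ q has smaller degree, because
  -- every function of one variable is a polynomial of degree ≤ q − 1.
  reduced? : ∀ (t : Vec ℕ n) → VecAll (ℕ._≤ q ∸ 1) t ⊎ (∃[ k ] k ℕ.< Vec.sum t × Deg k (mon t))
  reduced? []      = inj₁ []
  reduced? (m ∷ t) with m ℕ.≤? q ∸ 1
  ... | no m≰ = inj₂ (q ∸ 1 ℕ.+ Vec.sum t , ℕ.+-monoˡ-< (Vec.sum t) (ℕ.≰⇒> m≰) ,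
          Deg-ext (Deg-* (Deg-unary (_^ m) (Deg-var zero)) (Deg-tail (Deg-mon t))) λ where (c ∷ x) → refl)
  ... | yes m≤ with reduced? t
  ...   | inj₁ r = inj₁ (m≤ ∷ r)
  ...   | inj₂ (k , k< , d) = inj₂ (m ℕ.+ k , ℕ.+-monoʳ-< m k< ,
            Deg-ext (Deg-* (Deg-^ (Deg-var zero) m) (Deg-tail d)) λ where (c ∷ x) → refl)

  -- `Supp w u`: the support of the exponent vector w lies in that of u. All divisors of u are of
  -- this kind.
  data Supp : Vec ℕ n → Vec ℕ n → Set where
    []   : Supp [] []
    skip : ∀ {w u : Vec ℕ n} → Supp w u → Supp (0 ∷ w) (0 ∷ u)
    keep : ∀ {a m} {w u : Vec ℕ n} → Supp w u → Supp (a ∷ w) (suc m ∷ u)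

  supp-+ : ∀ (s t : Vec ℕ n) → Supp t (zipWith ℕ._+_ s t)
  supp-+ []          []          = []
  supp-+ (zero  ∷ s) (zero  ∷ t) = skip (supp-+ s t)
  supp-+ (zero  ∷ s) (suc _ ∷ t) = keep (supp-+ s t)
  supp-+ (suc _ ∷ s) (_     ∷ t) = keep (supp-+ s t)

  spread : Vec ℕ n → Vec F k → Vec F n
  spread []          σ       = []
  spread (zero  ∷ u) σ       = 0F ∷ spread u σ
  spread (suc m ∷ u) []      = 0F ∷ spread u []
  spread (suc m ∷ u) (c ∷ σ) = c ∷ spread u σ

  -- At most `Vec.sum u ≤ k` entries of u are nonzero, so σ has room for the coordinates of y at
  -- these positions, and a monomial supported there sees nothing else. The number q^k of patterns σ
  -- does not involve n.
  project : ∀ (u : Vec ℕ n) → Vec.sum u ℕ.≤ k → ∀ y → ∃[ σ ] ∀ {w} → Supp w u → mon w y ≡ mon w (spread {k = k} u σ)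
  project {k = k} [] _ [] = Vec.replicate k 0F , λ where [] → refl
  project (zero ∷ u) u≤k (c ∷ y) with project u u≤k y
  ... | σ , eq = σ , λ where (skip s) → cong (1F *_) (eq s)
  project {k = suc k} (suc m ∷ u) (ℕ.s≤s u≤k) (c ∷ y) with project u (ℕ.≤-trans (ℕ.m≤n+m _ m) u≤k) y
  ... | σ , eq = c ∷ σ , λ where (keep {a = a} s) → cong (c ^ a *_) (eq s)

  -- 2^p, in the additive form that matches the two blocks of `divisorFamily`.
  double : ℕ → ℕ
  double zero    = 1
  double (suc p) = double p ℕ.+ double p

  Nondegenerate : ∀ {R} → (Fin R → Fin R → F) → Set
  Nondegenerate {R} A = ∀ (c : Fin R → F) → (∀ j → sum (λ i → c i * A i j) ≡ 0F) → ∀ i → c i ≡ 0F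

  -- For u = m ∷ _ the matrix Λ(Vᵢ + Wⱼ) is block triangular: 0 ∷ V₀ and (m − 1) ∷ W₁ add up
  -- to an exponent vector lex-smaller than u.
  divisorFamily : ∀ (Λ : Vec ℕ n → F) u → Λ u ≢ 0F → (∀ t → Vec.sum t ≡ Vec.sum u → t <ₗ u → Λ t ≡ 0F) →
    VecAll (ℕ._≤ q ∸ 1) u → ∀ p e → p ℕ.* (q ∸ 1) ℕ.≤ e → e ℕ.+ p ℕ.* (q ∸ 1) ℕ.≤ Vec.sum u →
    Σ[ V ∈ (Fin (double p) → Vec ℕ n) ] Σ[ W ∈ (Fin (double p) → Vec ℕ n) ] (∀ i → Vec.sum (V i) ≡ e) × (∀ i → e ℕ.+ Vec.sum (W i) ≡ Vec.sum u) × (∀ i → Supp (W i) u) ×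
      Nondegenerate (λ i j → Λ (zipWith ℕ._+_ (V i) (W j)))
  divisorFamily Λ u Λu≢0 min red zero e _ e≤u with split u e (subst (ℕ._≤ Vec.sum u) (ℕ.+-identityʳ e) e≤u)
  ... | V , W , refl , s = (λ _ → V) , (λ _ → W) , (λ _ → s) , (λ _ → trans (cong (ℕ._+ Vec.sum W) (sym s)) (sym (sum-+ V W))) ,
    (λ _ → supp-+ V W) , λ c eq → λ where zero → nonDeg c (trans (sym (+-identityʳ _)) (eq zero))
    where
    nonDeg : ∀ (c : Fin 1 → F) → c zero * Λ (zipWith ℕ._+_ V W) ≡ 0F → c zero ≡ 0F
    nonDeg c eq with noZeroDivisors _ _ eq
    ... | inj₁ c≡0 = c≡0
    ... | inj₂ Λ≡0 = contradiction Λ≡0 Λu≢0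
  divisorFamily Λ [] Λu≢0 min red (suc p) e h e+≤0 =
    contradiction (ℕ.≤-trans (ℕ.≤-trans 1≤q∸1 (ℕ.≤-trans (ℕ.m≤m+n (q ∸ 1) _) (ℕ.m≤n+m _ e))) e+≤0) λ ()
  divisorFamily Λ (zero ∷ u) Λu≢0 min (_ ∷ red) p@(suc _) e h e+≤u
    with divisorFamily (Λ ∘ (0 ∷_)) u Λu≢0 (λ t s t<u → min (0 ∷ t) s (inj₂ (refl , t<u))) red p e h e+≤u
  ... | V , W , sV , sW , supp , nondeg = (0 ∷_) ∘ V , (0 ∷_) ∘ W , sV , sW , skip ∘ supp , nondeg
  divisorFamily {suc n} Λ (suc m ∷ u) Λu≢0 min (m<q ∷ red) (suc p) (suc e) h e+≤u
    with divisorFamily (Λ ∘ (suc m ∷_)) u Λu≢0 (λ t s t<u → min (suc m ∷ t) (cong (suc m ℕ.+_) s) (inj₂ (refl , t<u))) red p (suc e)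
           (ℕ.≤-trans (ℕ.m≤n+m _ (q ∸ 1)) h) bound₀
       | divisorFamily (Λ ∘ (suc m ∷_)) u Λu≢0 (λ t s t<u → min (suc m ∷ t) (cong (suc m ℕ.+_) s) (inj₂ (refl , t<u))) red p e
           (ℕ.s≤s⁻¹ (ℕ.≤-trans (ℕ.+-monoˡ-≤ (p ℕ.* (q ∸ 1)) 1≤q∸1) h)) (ℕ.≤-trans (ℕ.n≤1+n _) bound₀)
    where
    open import Data.Nat.Solver using (module +-*-Solver)
    open +-*-Solver using () renaming (solve to solveℕ; _:+_ to _⊕_; _:=_ to _⊜_; con to #)
    -- As u is reduced, dropping its first variable lowers the degree by at most q - 1, which is
    -- what one step of p releases. So every q - 1 units of degree pay for one doubling of the
    -- family.
    bound₀ : suc e ℕ.+ p ℕ.* (q ∸ 1) ℕ.≤ Vec.sum u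
    bound₀ = ℕ.+-cancelˡ-≤ (q ∸ 1) _ _ (ℕ.≤-trans (ℕ.≤-reflexive
      (solveℕ 3 (λ a b c → a ⊕ (b ⊕ c) ⊜ b ⊕ (a ⊕ c)) refl (q ∸ 1) (suc e) (p ℕ.* (q ∸ 1))))
      (ℕ.≤-trans e+≤u (ℕ.+-monoˡ-≤ (Vec.sum u) m<q)))
  ... | V₀ , W₀ , sV₀ , sW₀ , supp₀ , nondeg₀ | V₁ , W₁ , sV₁ , sW₁ , supp₁ , nondeg₁ =
    V , W , sV , sW , supp , nondeg
    where
    D = double p
    V W : Fin (D ℕ.+ D) → Vec ℕ (suc n)
    V = [ (0 ∷_) ∘ V₀ , (1 ∷_) ∘ V₁ ]′ ∘ splitAt D
    W = [ (suc m ∷_) ∘ W₀ , (m ∷_) ∘ W₁ ]′ ∘ splitAt D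
    sV : ∀ i → Vec.sum (V i) ≡ suc e
    sV i with splitAt D i
    ... | inj₁ i₀ = sV₀ i₀
    ... | inj₂ i₁ = cong suc (sV₁ i₁)
    comm : ∀ a b c → a ℕ.+ (b ℕ.+ c) ≡ b ℕ.+ (a ℕ.+ c)
    comm a b c = trans (sym (ℕ.+-assoc a b c)) (trans (cong (ℕ._+ c) (ℕ.+-comm a b)) (ℕ.+-assoc b a c))
    sW : ∀ i → suc e ℕ.+ Vec.sum (W i) ≡ suc m ℕ.+ Vec.sum u
    sW i with splitAt D i
    ... | inj₁ i₀ = trans (comm (suc e) (suc m) _) (cong (suc m ℕ.+_) (sW₀ i₀))
    ... | inj₂ i₁ = cong suc (trans (comm e m _) (cong (m ℕ.+_) (sW₁ i₁)))
    supp : ∀ i → Supp (W i) (suc m ∷ u)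
    supp i with splitAt D i
    ... | inj₁ i₀ = keep (supp₀ i₀)
    ... | inj₂ i₁ = keep (supp₁ i₁)
    A : Fin (D ℕ.+ D) → Fin (D ℕ.+ D) → F
    A i j = Λ (zipWith ℕ._+_ (V i) (W j))
    Vˡ : ∀ i → V (i ↑ˡ D) ≡ 0 ∷ V₀ i
    Vˡ i = cong [ (0 ∷_) ∘ V₀ , (1 ∷_) ∘ V₁ ]′ (Fin.splitAt-↑ˡ D i D)
    Vʳ : ∀ i → V (D ↑ʳ i) ≡ 1 ∷ V₁ i
    Vʳ i = cong [ (0 ∷_) ∘ V₀ , (1 ∷_) ∘ V₁ ]′ (Fin.splitAt-↑ʳ D D i)
    Wˡ : ∀ i → W (i ↑ˡ D) ≡ suc m ∷ W₀ i
    Wˡ i = cong [ (suc m ∷_) ∘ W₀ , (m ∷_) ∘ W₁ ]′ (Fin.splitAt-↑ˡ D i D)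
    Wʳ : ∀ i → W (D ↑ʳ i) ≡ m ∷ W₁ i
    Wʳ i = cong [ (suc m ∷_) ∘ W₀ , (m ∷_) ∘ W₁ ]′ (Fin.splitAt-↑ʳ D D i)
    A-ll : ∀ i j → A (i ↑ˡ D) (j ↑ˡ D) ≡ Λ (suc m ∷ zipWith ℕ._+_ (V₀ i) (W₀ j))
    A-ll i j = cong₂ (λ v w → Λ (zipWith ℕ._+_ v w)) (Vˡ i) (Wˡ j)
    A-rr : ∀ i j → A (D ↑ʳ i) (D ↑ʳ j) ≡ Λ (suc m ∷ zipWith ℕ._+_ (V₁ i) (W₁ j))
    A-rr i j = cong₂ (λ v w → Λ (zipWith ℕ._+_ v w)) (Vʳ i) (Wʳ j)
    A-lr : ∀ i j → A (i ↑ˡ D) (D ↑ʳ j) ≡ 0F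
    A-lr i j = min _ (trans (sum-+ (V (i ↑ˡ D)) (W (D ↑ʳ j))) (trans (cong (ℕ._+ Vec.sum (W (D ↑ʳ j))) (sV _)) (sW (D ↑ʳ j))))
      (subst₂ (λ v w → zipWith ℕ._+_ v w <ₗ suc m ∷ u) (sym (Vˡ i)) (sym (Wʳ j)) (inj₁ ℕ.≤-refl))
    nondeg : Nondegenerate A
    nondeg c eq i = subst (λ i → c i ≡ 0F) (Fin.join-splitAt D D i) (cases (splitAt D i))
      where
      blocks : ∀ j → sum (λ i → c (i ↑ˡ D) * A (i ↑ˡ D) j) + sum (λ i → c (D ↑ʳ i) * A (D ↑ʳ i) j) ≡ 0F
      blocks j = trans (sym (sum-↑ D (λ i → c i * A i j))) (eq j)
      right : ∀ i → c (D ↑ʳ i) ≡ 0F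
      right = nondeg₁ (λ i → c (D ↑ʳ i)) λ j → trans
        (sum-cong-≗ {D} λ i → cong (c (D ↑ʳ i) *_) (sym (A-rr i j)))
        (trans (sym (+-identityˡ _)) (trans (cong (_+ sum (λ i → c (D ↑ʳ i) * A (D ↑ʳ i) (D ↑ʳ j)))
          (sym (sum-zero {D} _ λ i → trans (cong (c (i ↑ˡ D) *_) (A-lr i j)) (zeroʳ _)))) (blocks (D ↑ʳ j))))
      left : ∀ i → c (i ↑ˡ D) ≡ 0F
      left = nondeg₀ (λ i → c (i ↑ˡ D)) λ j → trans
        (sum-cong-≗ {D} λ i → cong (c (i ↑ˡ D) *_) (sym (A-ll i j)))
        (trans (sym (+-identityʳ _)) (trans (cong (sum (λ i → c (i ↑ˡ D) * A (i ↑ˡ D) (j ↑ˡ D)) +_)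
          (sym (sum-zero {D} _ λ i → trans (cong (_* A (D ↑ʳ i) (j ↑ˡ D)) (right i)) (zeroˡ _)))) (blocks (j ↑ˡ D))))
      cases : ∀ s → c (join D D s) ≡ 0F
      cases (inj₁ i) = left i
      cases (inj₂ i) = right i
  divisorFamily Λ (suc m ∷ u) Λu≢0 min red (suc p) zero h e+≤u =
    contradiction (ℕ.≤-trans 1≤q∸1 (ℕ.≤-trans (ℕ.m≤m+n (q ∸ 1) _) h)) λ ()

-- Families of tests, and those coming from divisors of a monomial

module DivisorTests (q : ℕ) .{{_ : NonZero q}} (q-prime : Prime q) where

  open PrimeField q q-prime
  open Sums q q-prime
  open Polynomials q q-prime
  open Pairing q q-prime
  open Indicators q q-prime
  open LinearAlgebra q q-prime
  open Divisors q q-prime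
  open import Algebra.Solver.Ring.NaturalCoefficients.Default commutativeSemiring
    using (solve; _:+_; _:*_; _:=_)

  private variable
    n : ℕ

  open Linear

  -- The syndrome of a sparse error: on degree ≤ M the functional of f · P is a combination of at
  -- most m point evaluations, at unknown points.
  Near : ℕ → Fun q n → ℕ → Fun q n → Set
  Near {n} M f m P = Σ[ ys ∈ List (Vec F n × F) ] length ys ℕ.≤ m ×
    (∀ {h} → Deg M h → ⟨ f , (λ x → P x * h x) ⟩ ≡ sumL (λ (y , v) → v * h y) ys)

  -- The interface of the two cases. `nondegenerate` makes a shift of P by a combination of the
  -- `B i` recognisable from the values of Φ, whereas `code` confines these values, for P close in
  -- the sense of `Near`, to about (s q)^m possibilities.
  record TestFamily (f : Fun q n) (e M s R : ℕ) : Set where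
    field
      Φ              : Fin R → Fun q n → F
      Φ-linear       : ∀ j → Linear (Φ j)
      B              : Fin R → Fun q n
      B-Deg          : ∀ i → Deg e (B i)
      nondegenerate  : Nondegenerate (λ i j → Φ j (B i))
      G              : Fin s → Fin R → F
      code           : ∀ {m P} → Deg e P → Near M f m P → Σ[ ys ∈ List (Fin s × F) ]
                         length ys ℕ.≤ m × (∀ j → Φ j P ≡ sumL (λ (σ , v) → v * G σ j) ys)

  divisorTests : ∀ (f : Fun q n) {e T M} → T ℕ.+ e ℕ.≤ M → {h₀ : Fun q n} → Deg T h₀ → ∀ u → Vec.sum u ≡ e ℕ.+ e →
    ⟨ f , (λ x → mon u x * h₀ x) ⟩ ≢ 0F →
    (∀ t → Vec.sum t ≡ Vec.sum u → t <ₗ u → ⟨ f , (λ x → mon t x * h₀ x) ⟩ ≡ 0F) →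
    (∀ {g k} → k ℕ.< e ℕ.+ e → Deg k g → ⟨ f , (λ x → g x * h₀ x) ⟩ ≡ 0F) →
    ∀ p → p ℕ.* (q ∸ 1) ℕ.≤ e → TestFamily f e M (q ℕ.^ (e ℕ.+ e)) (double p)
  divisorTests {n} f {e} {T} {M} T+e≤M {h₀} dh₀ u sum-u Λu≢0 min low p p≤e with reduced? u
  -- A monomial that is not reduced has smaller degree as a function, and h₀ annihilates all smaller
  -- degrees.
  ... | inj₂ (k , k< , d) = contradiction (low (subst (k ℕ.<_) sum-u k<) d) Λu≢0
  ... | inj₁ reduced with divisorFamily (λ t → ⟨ f , (λ x → mon t x * h₀ x) ⟩) u Λu≢0 min reduced p e p≤e
          (subst (e ℕ.+ p ℕ.* (q ∸ 1) ℕ.≤_) (sym sum-u) (ℕ.+-monoʳ-≤ e p≤e))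
  ...   | V , W , sum-V , sum-W , supp , nondeg = record
    -- The test h₀ · Wⱼ has degree at most T + e ≤ M, so `Near` applies to it. The value of h₀ at an
    -- error point is absorbed in the coefficient; only the value of Wⱼ has to be recorded in G.
    { Φ = λ j P → ⟨ f , (λ x → (h₀ x * mon (W j) x) * P x) ⟩
    ; Φ-linear = λ j → ⟨⟩-linear f _
    ; B = mon ∘ V
    ; B-Deg = λ i → subst (λ k → Deg k (mon (V i))) (sum-V i) (Deg-mon (V i))
    ; nondegenerate = λ c eq → nondeg c λ j → trans
        (sum-cong-≗ {double p} λ i → cong (c i *_) (⟨⟩-cong f λ x → trans (cong (_* h₀ x) (mon-+ (V i) (W j) x))
          (solve 3 (λ v w h → v :* w :* h := h :* w :* v) refl (mon (V i) x) (mon (W j) x) (h₀ x)))) (eq j)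
    ; G = λ σ j → mon (W j) (spread u (toVec {q} {e ℕ.+ e} σ))
    ; code = λ {m} {P} dP (ys , ys≤m , near) → List.map pattern-of ys ,
        subst (ℕ._≤ m) (sym (List.length-map pattern-of ys)) ys≤m , λ j → begin
          ⟨ f , (λ x → (h₀ x * mon (W j) x) * P x) ⟩          ≡⟨ ⟨⟩-cong f (λ x → *-comm _ (P x)) ⟩
          ⟨ f , (λ x → P x * (h₀ x * mon (W j) x)) ⟩          ≡⟨ near (test-Deg j) ⟩
          sumL (λ (y , v) → v * (h₀ y * mon (W j) y)) ys      ≡⟨ sumL-cong (λ (y , v) → trans (sym (*-assoc v (h₀ y) _))
                                                                    (cong (v * h₀ y *_) (pattern-mon y j))) ys ⟩
          sumL (λ yv → proj₂ (pattern-of yv) * mon (W j) (spread u (toVec (proj₁ (pattern-of yv))))) ys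
                                                               ≡⟨ sumL-map _ pattern-of ys ⟨
          sumL (λ (σ , v) → v * mon (W j) (spread u (toVec {q} {e ℕ.+ e} σ))) (List.map pattern-of ys) ∎
    }
    where
    open ≡-Reasoning
    u≤2e : Vec.sum u ℕ.≤ e ℕ.+ e
    u≤2e = ℕ.≤-reflexive sum-u
    pattern-of : Vec F n × F → Fin (q ℕ.^ (e ℕ.+ e)) × F
    pattern-of (y , v) = fromVec (proj₁ (project u u≤2e y)) , v * h₀ y
    pattern-mon : ∀ y j → mon (W j) y ≡ mon (W j) (spread u (toVec {q} {e ℕ.+ e} (fromVec (proj₁ (project u u≤2e y)))))
    pattern-mon y j = trans (proj₂ (project u u≤2e y) (supp j))
      (cong (mon (W j) ∘ spread u) (sym (toVec-fromVec (proj₁ (project u u≤2e y)))))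
    sum-W≡e : ∀ j → Vec.sum (W j) ≡ e
    sum-W≡e j = ℕ.+-cancelˡ-≡ e _ _ (trans (sum-W j) sum-u)
    test-Deg : ∀ j → Deg M (λ x → h₀ x * mon (W j) x)
    test-Deg j = Deg-weaken T+e≤M (Deg-* dh₀ (subst (λ k → Deg k (mon (W j))) (sum-W≡e j) (Deg-mon (W j))))

-- Reduction modulo annihilators of bounded degree

module Reduction (q : ℕ) .{{_ : NonZero q}} (q-prime : Prime q) where

  open PrimeField q q-prime
  open Sums q q-prime
  open Polynomials q q-prime
  open Pairing q q-prime
  open Indicators q q-prime
  open LinearAlgebra q q-prime
  open import Algebra.Solver.Ring.NaturalCoefficients.Default commutativeSemiring
    using (solve; _:+_; _:*_; _:=_)

  open Linear

  module Functional {n : ℕ} (f : Fun q n) where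

    private variable
      g g′ h : Fun q n

    ⟪_,_⟫ : Fun q n → Fun q n → F
    ⟪ g , h ⟫ = ⟨ f , (λ x → g x * h x) ⟩

    ⟪⟫-comm : ∀ g h → ⟪ g , h ⟫ ≡ ⟪ h , g ⟫
    ⟪⟫-comm g h = ⟨⟩-cong f λ x → *-comm (g x) (h x)

    ⟪⟫-congˡ : ∀ h → (∀ x → g x ≡ g′ x) → ⟪ g , h ⟫ ≡ ⟪ g′ , h ⟫
    ⟪⟫-congˡ h e = ⟨⟩-cong f λ x → cong (_* h x) (e x)

    ⟪⟫-shift : ∀ (u g h : Fun q n) → ⟪ (λ x → u x * g x) , h ⟫ ≡ ⟪ g , (λ x → u x * h x) ⟫
    ⟪⟫-shift u g h = ⟨⟩-cong f λ x → solve 3 (λ u g h → u :* g :* h := g :* (u :* h)) refl (u x) (g x) (h x)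

    ⟪⟫-linearˡ : ∀ h → Linear (λ g → ⟪ g , h ⟫)
    ⟪⟫-linearˡ h = record
      { ext = ⟪⟫-congˡ h
      ; +-homo = λ g g′ → trans (⟪⟫-comm (λ x → g x + g′ x) h) (trans (+-homo (⟨⟩-linear f h) g g′) (cong₂ _+_ (⟪⟫-comm h g) (⟪⟫-comm h g′)))
      ; *-homo = λ a g → trans (⟪⟫-comm (λ x → a * g x) h) (trans (*-homo (⟨⟩-linear f h) a g) (cong (a *_) (⟪⟫-comm h g))) }

    infix 4 _≈[_]_
    -- Congruence modulo the annihilator of degree ≤ s; larger s is finer. Multiplying both sides by
    -- a factor of degree k costs k of the s degrees, because the factor moves into the test.
    _≈[_]_ : Fun q n → ℕ → Fun q n → Set
    g ≈[ s ] g′ = ∀ {h} → Deg s h → ⟪ g , h ⟫ ≡ ⟪ g′ , h ⟫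

    -- The dual form of: u is not congruent to a polynomial of degree ≤ a modulo the
    -- annihilator of degree ≤ T.
    Irreducible : ℕ → ℕ → Fun q n → Set
    Irreducible a T u = ∃[ h ] (Deg T h × (∀ p → Deg a p → ⟪ p , h ⟫ ≡ 0F) × ⟪ u , h ⟫ ≢ 0F)

    irreducible? : ∀ a T → Decidable (Irreducible a T)
    irreducible? a T u = anyDeg?
      (λ e (p , ne) → (λ g dg → trans (sym (⟨⟩-cong f λ x → cong (g x *_) (e x))) (p g dg)) ,
        ne ∘ trans (⟨⟩-cong f λ x → cong (u x *_) (e x)))
      (λ h → allDeg? {Q = λ p → ⟪ p , h ⟫ ≡ 0F} (λ e eq → trans (sym (⟪⟫-congˡ h e)) eq) (λ p → ⟪ p , h ⟫ Fin.≟ 0F)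
        ×-dec ¬? (⟪ u , h ⟫ Fin.≟ 0F))

    -- Finite-dimensional duality: with no witness h, the functional of u vanishes wherever those of
    -- the monomials of degree ≤ a do, so it is a combination of them; the coefficients are read off
    -- at the dual polynomials.
    reducible : ∀ {a T u} → ¬ Irreducible a T u → ∃[ p ] Deg a p × u ≈[ T ] p
    reducible {a} {T} {u} ¬irr = p , p-Deg , λ {h} dh → trans
      (expansion α-linear D (⟨⟩-linear f u) annihilates dh)
      (sym (trans (linearCombination (⟪⟫-linearˡ h) c (mon ∘ elem)) (sum-cong-≗ {size} λ j → *-comm (c j) _)))
      where
      α : Vec ℕ n → Fun q n → F
      α t h = ⟪ mon t , h ⟫
      α-linear : ∀ t → Linear (α t)
      α-linear t = ⟨⟩-linear f (mon t)
      D : DualBasis α T (monomials n a)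
      D = dualBasis α-linear (monomials n a)
      open DualBasis D
      c : Fin size → F
      c j = ⟪ u , dual j ⟫
      p : Fun q n
      p x = sum λ j → c j * mon (elem j) x
      sum-elem : ∀ j → Vec.sum (elem j) ℕ.≤ a
      sum-elem j = proj₂ (∈-filter⁻ {P = λ m → Vec.sum m ℕ.≤ a} (λ m → Vec.sum m ℕ.≤? a)
        {xs = List.map (Vec.map toℕ) (vectors (suc a) n)} (elem∈ j))
      p-Deg : Deg a p
      p-Deg = Deg-∑ {m = size} _ λ j → Deg-scale (c j) (Deg-weaken (sum-elem j) (Deg-mon (elem j)))
      annihilates : ∀ {h} → Deg T h → (∀ i → α (elem i) h ≡ 0F) → ⟪ u , h ⟫ ≡ 0F
      annihilates {h} dh eq with ⟪ u , h ⟫ Fin.≟ 0F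
      ... | yes u≡0 = u≡0
      ... | no  u≢0 = contradiction (h , dh , (λ p → low) , u≢0) ¬irr
        where
        low : ∀ {p} → Deg a p → ⟪ p , h ⟫ ≡ 0F
        low (mono c t s e) = trans (⟪⟫-congˡ h e) (trans (*-homo (⟪⟫-linearˡ h) c (mon t))
          (trans (cong (c *_) (spans dh eq (∈-monomials t s))) (zeroʳ c)))
        low (plus p r e) = trans (⟪⟫-congˡ h e) (trans (+-homo (⟪⟫-linearˡ h) _ _)
          (trans (cong₂ _+_ (low p) (low r)) (+-identityʳ 0F)))

    -- Flat extension: representatives of degree at most a in every degree

    module FlatExtension {a T N : ℕ} (1+a+T≡N : suc a ℕ.+ T ≡ N)
      (top : ∀ u → Vec.sum u ≡ suc a → ∃[ p ] Deg a p × mon u ≈[ T ] p) where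

      Reduct : ℕ → Fun q n → Set
      Reduct s g = ∃[ p ] Deg a p × g ≈[ s ] p

      reduct-span : ∀ {k s} → (∀ t → Vec.sum t ℕ.≤ k → Reduct s (mon t)) → Deg k g → Reduct s g
      reduct-span H (mono c t s e) with H t s
      ... | p , dp , eq = _ , Deg-scale c dp , λ {h} dh → trans (⟪⟫-congˡ h e) (trans (*-homo (⟪⟫-linearˡ h) c (mon t))
        (trans (cong (c *_) (eq dh)) (sym (*-homo (⟪⟫-linearˡ h) c p))))
      reduct-span H (plus d d′ e) with reduct-span H d | reduct-span H d′
      ... | p , dp , eq | p′ , dp′ , eq′ = _ , plus dp dp′ (λ _ → refl) , λ {h} dh → trans (⟪⟫-congˡ h e)
        (trans (+-homo (⟪⟫-linearˡ h) _ _) (trans (cong₂ _+_ (eq dh) (eq′ dh)) (sym (+-homo (⟪⟫-linearˡ h) p p′))))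

      reduct-top : Deg (suc a) g → Reduct T g
      reduct-top = reduct-span λ t s → case t s
        where
        case : ∀ t → Vec.sum t ℕ.≤ suc a → Reduct T (mon t)
        case t s with Vec.sum t ℕ.≤? a
        ... | yes t≤a = mon t , Deg-weaken t≤a (Deg-mon t) , λ _ → refl
        ... | no  t≰a = top t (ℕ.≤-antisym s (ℕ.≰⇒> t≰a))

      complement-≤T : ∀ {s s′} → s ℕ.+ s′ ≡ N → suc a ℕ.≤ s → s′ ℕ.≤ T
      complement-≤T {s} {s′} eq a<s = ℕ.+-cancelˡ-≤ (suc a) _ _
        (ℕ.≤-trans (ℕ.+-monoˡ-≤ s′ a<s) (ℕ.≤-reflexive (trans eq (sym 1+a+T≡N))))

      -- Monomial and test share the budget N. Peel off one variable, reduce the rest against tests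
      -- of one degree more, and bring the product, now of degree a + 1, down once more by `top`;
      -- the tests have degree at most T as soon as s > a.
      reduct-mon : ∀ s s′ → s ℕ.+ s′ ≡ N → ∀ t → Vec.sum t ℕ.≤ s → Reduct s′ (mon t)
      reduct-mon s s′ eq t t≤s with s ℕ.≤? a
      ... | yes s≤a = mon t , Deg-weaken (ℕ.≤-trans t≤s s≤a) (Deg-mon t) , λ _ → refl
      reduct-mon zero    s′ eq t t≤s | no s≰a = contradiction ℕ.z≤n s≰a
      reduct-mon (suc s) s′ eq t t≤s | no s≰a with Vec.sum t ℕ.≤? s
      ... | yes t≤s₀ with reduct-mon s (suc s′) (trans (ℕ.+-suc s s′) eq) t t≤s₀
      ...   | p , dp , e = p , dp , e ∘ Deg-weaken (ℕ.n≤1+n s′)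
      reduct-mon (suc s) s′ eq t t≤s | no s≰a | no t≰s with peel t (ℕ.≤-antisym t≤s (ℕ.≰⇒> t≰s))
      ... | i , t′ , t′≡s , mon-t with reduct-mon s (suc s′) (trans (ℕ.+-suc s s′) eq) t′ (ℕ.≤-reflexive t′≡s)
      ...   | p , dp , e with reduct-top (Deg-* (Deg-var i) dp)
      ...     | p′ , dp′ , e′ = p′ , dp′ , λ {h} dh → begin
        ⟪ mon t , h ⟫                                   ≡⟨ ⟪⟫-congˡ h mon-t ⟩
        ⟪ (λ x → lookup x i * mon t′ x) , h ⟫           ≡⟨ ⟪⟫-shift (λ x → lookup x i) (mon t′) h ⟩
        ⟪ mon t′ , (λ x → lookup x i * h x) ⟫           ≡⟨ e (Deg-* (Deg-var i) dh) ⟩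
        ⟪ p , (λ x → lookup x i * h x) ⟫                ≡⟨ ⟪⟫-shift (λ x → lookup x i) p h ⟨
        ⟪ (λ x → lookup x i * p x) , h ⟫                ≡⟨ e′ (Deg-weaken (complement-≤T eq (ℕ.≰⇒> s≰a)) dh) ⟩
        ⟪ p′ , h ⟫                                      ∎
        where open ≡-Reasoning

      reduct : ∀ {s s′} → s ℕ.+ s′ ≡ N → Deg s g → Reduct s′ g
      reduct eq = reduct-span (reduct-mon _ _ eq)

      -- The pairing is symmetric, so the test can be reduced as well: h may be replaced by a reduct
      -- of degree ≤ a as long as g and g′ stay within the remaining budget.
      ≈-lift : ∀ {s s′} → s ℕ.+ s′ ≡ N → Deg s g → Deg s g′ → g ≈[ a ] g′ → g ≈[ s′ ] g′
      ≈-lift {g} {g′} {s} {s′} eq dg dg′ g≈g′ {h} dh with reduct (trans (ℕ.+-comm s′ s) eq) dh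
      ... | p , dp , h≈p = begin
        ⟪ g , h ⟫  ≡⟨ ⟪⟫-comm g h ⟩
        ⟪ h , g ⟫  ≡⟨ h≈p dg ⟩
        ⟪ p , g ⟫  ≡⟨ ⟪⟫-comm p g ⟩
        ⟪ g , p ⟫  ≡⟨ g≈g′ dp ⟩
        ⟪ g′ , p ⟫ ≡⟨ ⟪⟫-comm g′ p ⟩
        ⟪ p , g′ ⟫ ≡⟨ h≈p dg′ ⟨
        ⟪ h , g′ ⟫ ≡⟨ ⟪⟫-comm h g′ ⟩
        ⟪ g′ , h ⟫ ∎
        where open ≡-Reasoning

      -- Joint eigenvectors of the coordinates, and the support they determine

      module Points (b : ℕ) (w+a+b≡N : (q ∸ 1 ℕ.+ a) ℕ.+ b ≡ N) (w+a≤T : q ∸ 1 ℕ.+ a ℕ.≤ T) where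

        a≤T : a ℕ.≤ T
        a≤T = ℕ.≤-trans (ℕ.m≤n+m a (q ∸ 1)) w+a≤T

        w+b≡1+T : q ∸ 1 ℕ.+ b ≡ suc T
        w+b≡1+T = ℕ.+-cancelˡ-≡ a _ _ (begin
          a ℕ.+ (q ∸ 1 ℕ.+ b)    ≡⟨ ℕ.+-assoc a (q ∸ 1) b ⟨
          a ℕ.+ (q ∸ 1) ℕ.+ b    ≡⟨ cong (ℕ._+ b) (ℕ.+-comm a (q ∸ 1)) ⟩
          q ∸ 1 ℕ.+ a ℕ.+ b      ≡⟨ trans w+a+b≡N (sym 1+a+T≡N) ⟩
          suc a ℕ.+ T            ≡⟨ ℕ.+-suc a T ⟨
          a ℕ.+ suc T            ∎)
          where open ≡-Reasoning

        b≤1+T : b ℕ.≤ suc T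
        b≤1+T = ℕ.≤-trans (ℕ.m≤n+m b (q ∸ 1)) (ℕ.≤-reflexive w+b≡1+T)

        1+a≤b : suc a ℕ.≤ b
        1+a≤b = ℕ.+-cancelˡ-≤ (q ∸ 1) _ _ (ℕ.≤-trans (ℕ.≤-reflexive (ℕ.+-suc (q ∸ 1) a))
          (ℕ.≤-trans (ℕ.s≤s w+a≤T) (ℕ.≤-reflexive (sym w+b≡1+T))))

        a≤b : a ℕ.≤ b
        a≤b = ℕ.≤-trans (ℕ.n≤1+n a) 1+a≤b

        -- E is z is a reduct of the indicator function of {x : x_{is j} = z_j for all j},
        -- obtained by imposing one coordinate at a time.
        E : ∀ {m} → Vec (Fin n) m → Vec F m → ∃[ p ] Deg a p
        E-step : ∀ {m} i c (is : Vec (Fin n) m) z → Reduct b (λ x → δ c (lookup x i) * proj₁ (E is z) x)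
        E []       []      = (λ _ → 1F) , Deg-const 1F
        E (i ∷ is) (c ∷ z) = let (p , dp , _) = E-step i c is z in p , dp
        E-step i c is z = reduct w+a+b≡N (Deg-* (Deg-δ c (Deg-var i)) (proj₂ (E is z)))

        -- The new equation comes from `δ-*`; the old ones persist because multiplications commute.
        -- By `≈-lift` tests of degree ≤ a suffice, and for these there is room to move a
        -- coordinate, as a + 1 ≤ b, or an indicator, as q - 1 + a ≤ T, into the test.
        E-eigen : ∀ {m} (is : Vec (Fin n) m) z j →
          (λ x → lookup x (lookup is j) * proj₁ (E is z) x) ≈[ T ] (λ x → lookup z j * proj₁ (E is z) x)
        E-eigen (i ∷ is) (c ∷ z) j = ≈-lift 1+a+T≡N (Deg-* (Deg-var _) (proj₂ (E (i ∷ is) (c ∷ z))))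
          (Deg-weaken (ℕ.n≤1+n a) (Deg-scale _ (proj₂ (E (i ∷ is) (c ∷ z))))) (on-low j)
          where
          open ≡-Reasoning
          e₀ e₁ : Fun q n
          e₀ = proj₁ (E is z)
          e₁ = proj₁ (E (i ∷ is) (c ∷ z))
          δe₀ : Fun q n
          δe₀ x = δ c (lookup x i) * e₀ x
          step : δe₀ ≈[ b ] e₁
          step = proj₂ (proj₂ (E-step i c is z))
          scale : ∀ (v : F) {h} → Deg a h → ⟪ (λ x → v * δe₀ x) , h ⟫ ≡ ⟪ (λ x → v * e₁ x) , h ⟫
          scale v {h} dh = trans (*-homo (⟪⟫-linearˡ h) v δe₀)
            (trans (cong (v *_) (step (Deg-weaken a≤b dh))) (sym (*-homo (⟪⟫-linearˡ h) v e₁)))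
          unfold : ∀ i′ {h} → Deg a h → ⟪ (λ x → lookup x i′ * e₁ x) , h ⟫ ≡ ⟪ (λ x → lookup x i′ * δe₀ x) , h ⟫
          unfold i′ {h} dh = trans (⟪⟫-shift (λ x → lookup x i′) e₁ h)
            (trans (sym (step (Deg-weaken 1+a≤b (Deg-* (Deg-var i′) dh)))) (sym (⟪⟫-shift (λ x → lookup x i′) δe₀ h)))
          on-low : ∀ j → (λ x → lookup x (lookup (i ∷ is) j) * e₁ x) ≈[ a ] (λ x → lookup (c ∷ z) j * e₁ x)
          on-low zero {h} dh = begin
            ⟪ (λ x → lookup x i * e₁ x) , h ⟫      ≡⟨ unfold i dh ⟩
            ⟪ (λ x → lookup x i * δe₀ x) , h ⟫     ≡⟨ ⟪⟫-congˡ h (λ x → trans (sym (*-assoc _ _ _))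
                                                        (trans (cong (_* e₀ x) (δ-* c (lookup x i))) (*-assoc _ _ _))) ⟩
            ⟪ (λ x → c * δe₀ x) , h ⟫              ≡⟨ scale c dh ⟩
            ⟪ (λ x → c * e₁ x) , h ⟫               ∎
          on-low (suc j) {h} dh = begin
            ⟪ (λ x → lookup x i′ * e₁ x) , h ⟫                      ≡⟨ unfold i′ dh ⟩
            ⟪ (λ x → lookup x i′ * δe₀ x) , h ⟫                     ≡⟨ swap (λ x → lookup x i′) ⟩
            ⟪ (λ x → lookup x i′ * e₀ x) , (λ x → δ c (lookup x i) * h x) ⟫
              ≡⟨ E-eigen is z j (Deg-weaken w+a≤T (Deg-* (Deg-δ c (Deg-var i)) dh)) ⟩
            ⟪ (λ x → lookup z j * e₀ x) , (λ x → δ c (lookup x i) * h x) ⟫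
              ≡⟨ swap (λ _ → lookup z j) ⟨
            ⟪ (λ x → lookup z j * δe₀ x) , h ⟫                      ≡⟨ scale (lookup z j) dh ⟩
            ⟪ (λ x → lookup z j * e₁ x) , h ⟫                       ∎
            where
            i′ = lookup is j
            swap : ∀ (u : Fun q n) → ⟪ (λ x → u x * δe₀ x) , h ⟫ ≡ ⟪ (λ x → u x * e₀ x) , (λ x → δ c (lookup x i) * h x) ⟫
            swap u = ⟨⟩-cong f λ x → solve 4 (λ u d e h → u :* (d :* e) :* h := u :* e :* (d :* h)) refl
              (u x) (δ c (lookup x i)) (e₀ x) (h x)

        -- The indicators `δ c` form a partition of unity in each coordinate.
        E-partition : ∀ {m} (is : Vec (Fin n) m) → Deg b h → sumV (λ z → ⟪ proj₁ (E is z) , h ⟫) ≡ ⟨ f , h ⟩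
        E-partition {h} [] dh = trans (sumV-[] _) (⟨⟩-cong f λ x → *-identityˡ (h x))
        E-partition {h} (i ∷ is) dh = begin
          sumV (λ z → ⟪ proj₁ (E (i ∷ is) z) , h ⟫)
            ≡⟨ sumV-suc _ ⟩
          sum (λ c → sumV λ z → ⟪ proj₁ (E (i ∷ is) (c ∷ z)) , h ⟫)
            ≡⟨ sum-cong-≗ {q} (λ c → sumV-cong λ z → sym (proj₂ (proj₂ (E-step i c is z)) dh)) ⟩
          sum (λ c → sumV λ z → ⟪ (λ x → δ c (lookup x i) * proj₁ (E is z) x) , h ⟫)
            ≡⟨ sumV-∑-comm (λ c z → ⟪ (λ x → δ c (lookup x i) * proj₁ (E is z) x) , h ⟫) ⟨
          sumV (λ z → sum λ c → ⟪ (λ x → δ c (lookup x i) * proj₁ (E is z) x) , h ⟫)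
            ≡⟨ sumV-cong (λ z → sym (∑-homo (⟪⟫-linearˡ h) λ c x → δ c (lookup x i) * proj₁ (E is z) x)) ⟩
          sumV (λ z → ⟪ (λ x → sum λ c → δ c (lookup x i) * proj₁ (E is z) x) , h ⟫)
            ≡⟨ sumV-cong (λ z → ⟪⟫-congˡ h λ x → trans (sym (*-distribʳ-sum {q} (proj₁ (E is z) x) (λ c → δ c (lookup x i))))
                 (trans (cong (_* proj₁ (E is z) x) (∑-δ (lookup x i))) (*-identityˡ _))) ⟩
          sumV (λ z → ⟪ proj₁ (E is z) , h ⟫)
            ≡⟨ E-partition is dh ⟩
          ⟨ f , h ⟩ ∎
          where open ≡-Reasoning

        opaque
          -- A representative of degree ≤ a of the indicator of the point z, an idempotent of the
          -- quotient. It is sealed, as only the three properties that follow are used.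
          idem : Vec F n → Fun q n
          idem z = proj₁ (E (Vec.allFin n) z)

          idem-Deg : ∀ z → Deg a (idem z)
          idem-Deg z = proj₂ (E (Vec.allFin n) z)

          idem-eigen : ∀ z i → (λ x → lookup x i * idem z x) ≈[ T ] (λ x → lookup z i * idem z x)
          idem-eigen z i {h} dh = trans (⟪⟫-congˡ h λ x → cong (λ i → lookup x i * idem z x) (sym (Vec.lookup-allFin i)))
            (E-eigen (Vec.allFin n) z i dh)

          idem-partition : Deg b h → sumV (λ z → ⟪ idem z , h ⟫) ≡ ⟨ f , h ⟩
          idem-partition = E-partition (Vec.allFin n)

        weight : Fun q n
        weight z = ⟨ f , idem z ⟩

        -- The eigenvalue equations replace the variables of Q by the coordinates of z, one at a
        -- time. Degree T + 1 is reached because peeling off a variable leaves a test of degree at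
        -- most T.
        idem-evaluates : ∀ {Q} → Deg (suc T) Q → ∀ z → ⟪ Q , idem z ⟫ ≡ Q z * weight z
        idem-evaluates dQ z = span dQ
          where
          open ≡-Reasoning
          on-mon : ∀ s t → Vec.sum t ≡ s → s ℕ.≤ suc T → ⟪ mon t , idem z ⟫ ≡ mon t z * weight z
          on-mon zero t t≡0 _ = trans (⟨⟩-cong f λ x → trans (cong (_* idem z x) (mon-sum-0 t t≡0 x)) (*-identityˡ _))
            (sym (trans (cong (_* weight z) (mon-sum-0 t t≡0 z)) (*-identityˡ _)))
          on-mon (suc s) t t≡1+s 1+s≤ with peel t t≡1+s
          ... | i , t′ , t′≡s , mon-t = begin
            ⟪ mon t , idem z ⟫                                  ≡⟨ ⟪⟫-congˡ (idem z) mon-t ⟩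
            ⟪ (λ x → lookup x i * mon t′ x) , idem z ⟫          ≡⟨ ⟪⟫-shift (λ x → lookup x i) (mon t′) (idem z) ⟩
            ⟪ mon t′ , (λ x → lookup x i * idem z x) ⟫          ≡⟨ ⟪⟫-comm (mon t′) (λ x → lookup x i * idem z x) ⟩
            ⟪ (λ x → lookup x i * idem z x) , mon t′ ⟫
              ≡⟨ idem-eigen z i (Deg-weaken (ℕ.≤-trans (ℕ.≤-reflexive t′≡s) (ℕ.s≤s⁻¹ 1+s≤)) (Deg-mon t′)) ⟩
            ⟪ (λ x → lookup z i * idem z x) , mon t′ ⟫          ≡⟨ *-homo (⟪⟫-linearˡ (mon t′)) (lookup z i) (idem z) ⟩
            lookup z i * ⟪ idem z , mon t′ ⟫
              ≡⟨ cong (lookup z i *_) (trans (⟪⟫-comm (idem z) (mon t′)) (on-mon s t′ t′≡s (ℕ.≤-trans (ℕ.n≤1+n s) 1+s≤))) ⟩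
            lookup z i * (mon t′ z * weight z)                  ≡⟨ *-assoc _ _ _ ⟨
            lookup z i * mon t′ z * weight z                    ≡⟨ cong (_* weight z) (mon-t z) ⟨
            mon t z * weight z                                  ∎
          span : ∀ {Q} → Deg (suc T) Q → ⟪ Q , idem z ⟫ ≡ Q z * weight z
          span (mono c t s e) = trans (⟪⟫-congˡ (idem z) e) (trans (*-homo (⟪⟫-linearˡ (idem z)) c (mon t))
            (trans (cong (c *_) (on-mon _ t refl s)) (trans (sym (*-assoc _ _ _)) (cong (_* weight z) (sym (e z))))))
          span (plus p r e) = trans (⟪⟫-congˡ (idem z) e) (trans (+-homo (⟪⟫-linearˡ (idem z)) _ _)
            (trans (cong₂ _+_ (span p) (span r)) (trans (sym (distribʳ _ _ _)) (cong (_* weight z) (sym (e z))))))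

        -- Up to degree b, evaluate g against the partition into the `idem z`. Above that, exchange
        -- a factor of degree a + 1 of the monomial for its reduct p: this lowers the degree on the
        -- side of f, and changes nothing on the other side because p and the factor agree wherever
        -- `weight` is nonzero.
        representation : ∀ s → s ℕ.≤ N → Deg s g → ⟨ f , g ⟩ ≡ ⟨ weight , g ⟩
        representation-mon : ∀ s → suc s ℕ.≤ N → suc a ℕ.≤ s → ∀ t → Vec.sum t ℕ.≤ suc s → ⟨ f , mon t ⟩ ≡ ⟨ weight , mon t ⟩
        representation {g} s s≤N dg with s ℕ.≤? b
        ... | yes s≤b = trans (sym (idem-partition (Deg-weaken s≤b dg))) (trans
            (sumV-cong λ z → trans (⟪⟫-comm (idem z) g) (trans (idem-evaluates (Deg-weaken (ℕ.≤-trans s≤b b≤1+T) dg) z) (*-comm _ _)))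
            (sym (⟨⟩≡sumV weight g)))
        representation zero    s≤N dg | no s≰b = contradiction ℕ.z≤n s≰b
        representation (suc s) s≤N dg | no s≰b = span dg
          where
          span : ∀ {g} → Deg (suc s) g → ⟨ f , g ⟩ ≡ ⟨ weight , g ⟩
          span (mono c t t≤s e) = trans (⟨⟩-cong f e) (trans (⟨⟩-* f c (mon t)) (trans
            (cong (c *_) (representation-mon s s≤N (ℕ.≤-trans 1+a≤b (ℕ.s≤s⁻¹ (ℕ.≰⇒> s≰b))) t t≤s))
            (trans (sym (⟨⟩-* weight c (mon t))) (⟨⟩-cong weight λ x → sym (e x)))))
          span (plus p r e) = trans (⟨⟩-cong f e) (trans (⟨⟩-+ f _ _) (trans (cong₂ _+_ (span p) (span r))
            (trans (sym (⟨⟩-+ weight _ _)) (⟨⟩-cong weight λ x → sym (e x)))))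
        representation-mon s 1+s≤N a<s t t≤ with Vec.sum t ℕ.≤? s
        ... | yes t≤s = representation s (ℕ.≤-trans (ℕ.n≤1+n s) 1+s≤N) (Deg-weaken t≤s (Deg-mon t))
        ... | no t≰s with split t (suc a) (ℕ.≤-trans a<s (ℕ.<⇒≤ (ℕ.≰⇒> t≰s)))
        ...   | t₁ , t₂ , refl , t₁≡ with top t₁ t₁≡
        ...     | p , dp , e = begin
          ⟨ f , mon (zipWith ℕ._+_ t₁ t₂) ⟩          ≡⟨ ⟨⟩-cong f (mon-+ t₁ t₂) ⟩
          ⟪ mon t₁ , mon t₂ ⟫                        ≡⟨ e (Deg-weaken t₂≤T (Deg-mon t₂)) ⟩
          ⟪ p , mon t₂ ⟫                             ≡⟨ representation s (ℕ.≤-trans (ℕ.n≤1+n s) 1+s≤N) (Deg-weaken a+t₂≤s (Deg-* dp (Deg-mon t₂))) ⟩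
          ⟨ weight , (λ x → p x * mon t₂ x) ⟩        ≡⟨ ⟨⟩≡sumV weight _ ⟩
          sumV (λ z → weight z * (p z * mon t₂ z))   ≡⟨ sumV-cong (λ z → trans (rearrange (weight z) (p z) (mon t₂ z))
                                                          (trans (cong (_* mon t₂ z) (p≡mon z)) (sym (rearrange (weight z) (mon t₁ z) (mon t₂ z))))) ⟩
          sumV (λ z → weight z * (mon t₁ z * mon t₂ z)) ≡⟨ ⟨⟩≡sumV weight _ ⟨
          ⟨ weight , (λ x → mon t₁ x * mon t₂ x) ⟩   ≡⟨ ⟨⟩-cong weight (mon-+ t₁ t₂) ⟨
          ⟨ weight , mon (zipWith ℕ._+_ t₁ t₂) ⟩     ∎
          where
          open ≡-Reasoning
          sums : suc a ℕ.+ Vec.sum t₂ ℕ.≤ suc s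
          sums = subst (ℕ._≤ suc s) (trans (sum-+ t₁ t₂) (cong (ℕ._+ Vec.sum t₂) t₁≡)) t≤
          a+t₂≤s : a ℕ.+ Vec.sum t₂ ℕ.≤ s
          a+t₂≤s = ℕ.s≤s⁻¹ sums
          t₂≤T : Vec.sum t₂ ℕ.≤ T
          t₂≤T = ℕ.+-cancelˡ-≤ (suc a) _ _ (ℕ.≤-trans sums (ℕ.≤-trans 1+s≤N (ℕ.≤-reflexive (sym 1+a+T≡N))))
          rearrange : ∀ u v w → u * (v * w) ≡ v * u * w
          rearrange = solve 3 (λ u v w → u :* (v :* w) := v :* u :* w) refl
          p≡mon : ∀ z → p z * weight z ≡ mon t₁ z * weight z
          p≡mon z = trans (sym (idem-evaluates (Deg-weaken (ℕ.≤-trans a≤T (ℕ.n≤1+n T)) dp) z))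
            (trans (sym (e (Deg-weaken a≤T (idem-Deg z))))
              (idem-evaluates (Deg-weaken (ℕ.≤-trans (ℕ.≤-reflexive t₁≡) (ℕ.s≤s a≤T)) (Deg-mon t₁)) z))

        -- Multiplication by a coordinate is self-adjoint for `⟪_,_⟫`, and at a coordinate where z
        -- and z′ differ the two eigenvalues are distinct.
        idem-orthogonal : ∀ {z z′} → z ≢ z′ → ⟪ idem z , idem z′ ⟫ ≡ 0F
        idem-orthogonal {z} {z′} z≢z′ = *-separates (proj₂ (≢⇒lookup≢ Fin._≟_ z z′ z≢z′)) (eigen-swap _)
          where
          open ≡-Reasoning
          eigen-swap : ∀ i → lookup z i * ⟪ idem z , idem z′ ⟫ ≡ lookup z′ i * ⟪ idem z , idem z′ ⟫
          eigen-swap i = begin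
            lookup z i * ⟪ idem z , idem z′ ⟫            ≡⟨ *-homo (⟪⟫-linearˡ (idem z′)) (lookup z i) (idem z) ⟨
            ⟪ (λ x → lookup z i * idem z x) , idem z′ ⟫  ≡⟨ idem-eigen z i (Deg-weaken a≤T (idem-Deg z′)) ⟨
            ⟪ (λ x → lookup x i * idem z x) , idem z′ ⟫  ≡⟨ ⟪⟫-shift (λ x → lookup x i) (idem z) (idem z′) ⟩
            ⟪ idem z , (λ x → lookup x i * idem z′ x) ⟫  ≡⟨ ⟪⟫-comm (idem z) (λ x → lookup x i * idem z′ x) ⟩
            ⟪ (λ x → lookup x i * idem z′ x) , idem z ⟫  ≡⟨ idem-eigen z′ i (Deg-weaken a≤T (idem-Deg z)) ⟩
            ⟪ (λ x → lookup z′ i * idem z′ x) , idem z ⟫ ≡⟨ *-homo (⟪⟫-linearˡ (idem z)) (lookup z′ i) (idem z′) ⟩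
            lookup z′ i * ⟪ idem z′ , idem z ⟫           ≡⟨ cong (lookup z′ i *_) (⟪⟫-comm (idem z′) (idem z)) ⟩
            lookup z′ i * ⟪ idem z , idem z′ ⟫           ∎

        -- Together with `idem-≡` this says that on the support of `weight` the `idem z` are
        -- Lagrange interpolation polynomials, so degree a separates its points.
        idem-≢ : ∀ {z z′} → weight z ≢ 0F → z ≢ z′ → idem z′ z ≡ 0F
        idem-≢ {z} {z′} wz≢0 z≢z′ = *-cancelʳ-≢0 wz≢0 (begin
          idem z′ z * weight z        ≡⟨ idem-evaluates (Deg-weaken (ℕ.≤-trans a≤T (ℕ.n≤1+n T)) (idem-Deg z′)) z ⟨
          ⟪ idem z′ , idem z ⟫        ≡⟨ idem-orthogonal (z≢z′ ∘ sym) ⟩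
          0F                          ≡⟨ zeroˡ (weight z) ⟨
          0F * weight z               ∎)
          where open ≡-Reasoning

        idem-≡ : ∀ {z} → weight z ≢ 0F → idem z z ≡ 1F
        idem-≡ {z} wz≢0 = *-cancelʳ-≢0 wz≢0 (begin
          idem z z * weight z            ≡⟨ idem-evaluates (Deg-weaken (ℕ.≤-trans a≤T (ℕ.n≤1+n T)) (idem-Deg z)) z ⟨
          ⟪ idem z , idem z ⟫            ≡⟨ sumV-single (λ y → ⟪ idem y , idem z ⟫) z (λ y y≢z → idem-orthogonal y≢z) ⟨
          sumV (λ y → ⟪ idem y , idem z ⟫) ≡⟨ idem-partition (Deg-weaken a≤b (idem-Deg z)) ⟩
          weight z                       ≡⟨ *-identityˡ _ ⟨
          1F * weight z                  ∎)
          where open ≡-Reasoning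

-- Tests at independent points of the support

module Interpolation (q : ℕ) .{{_ : NonZero q}} (q-prime : Prime q) where

  open PrimeField q q-prime
  open Sums q q-prime
  open Polynomials q q-prime
  open Pairing q q-prime
  open Indicators q q-prime
  open LinearAlgebra q q-prime
  open Codewords q q-prime
  open Divisors q q-prime
  open DivisorTests q q-prime
  open import Algebra.Solver.Ring.NaturalCoefficients.Default commutativeSemiring
    using (solve; _:+_; _:*_; _:=_)

  open Linear

  sumL-zero : ∀ {A : Set} (g : A → F) xs → (∀ i → g (List.lookup xs i) ≡ 0F) → sumL g xs ≡ 0F
  sumL-zero g []       h = refl
  sumL-zero g (x ∷ xs) h = trans (cong₂ _+_ (h zero) (sumL-zero g xs (h ∘ suc))) (+-identityʳ 0F)

  vectors-unique : ∀ n → Unique (setoid (Vec F n)) (vectors q n)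
  vectors-unique n = Unique.map⁺ (setoid _) (setoid _)
    (λ {i} {j} eq → trans (sym (fromVec-toVec {n} i)) (trans (cong fromVec eq) (fromVec-toVec {n} j))) (UniqueProp.allFin⁺ _)

  ev : ∀ {n} → Vec F n → Fun q n → F
  ev z h = h z

  kronecker : ∀ {R} → Fin R → Fin R → F
  kronecker i j with i Fin.≟ j
  ... | yes _ = 1F
  ... | no  _ = 0F

  kronecker-≡ : ∀ {R} (j : Fin R) → kronecker j j ≡ 1F
  kronecker-≡ j with j Fin.≟ j
  ... | yes _ = refl
  ... | no ne = contradiction refl ne

  kronecker-≢ : ∀ {R} {i j : Fin R} → i ≢ j → kronecker i j ≡ 0F
  kronecker-≢ {i = i} {j} i≢j with i Fin.≟ j
  ... | yes eq = contradiction eq i≢j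
  ... | no _ = refl

  module PointTests {n e a D M : ℕ} (f weight : Fun q n) (idem : Vec F n → Fun q n)
    (idem-Deg : ∀ z → Deg a (idem z)) (a≤2e : a ℕ.≤ e ℕ.+ e) (e+a≤D : e ℕ.+ a ℕ.≤ D) (2a≤M : a ℕ.+ a ℕ.≤ M)
    (evaluates : ∀ {Q} → Deg D Q → ∀ z → ⟨ f , (λ x → Q x * idem z x) ⟩ ≡ Q z * weight z)
    (idem-≢ : ∀ {z z′} → weight z ≢ 0F → z ≢ z′ → idem z′ z ≡ 0F)
    (idem-≡ : ∀ {z} → weight z ≢ 0F → idem z z ≡ 1F)
    (Z : List (Vec F n)) (Z-unique : Unique (setoid (Vec F n)) Z) (∈Z⇒≢0 : ∀ {z} → z ∈ Z → weight z ≢ 0F)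
    (basis : DualBasis ev e Z) where

    private
      interpolate : ∀ {m} (c : Fin m → F) (p : Fin m → Vec F n) → (∀ i → weight (p i) ≢ 0F) →
        (∀ i j → p i ≡ p j → i ≡ j) → ∀ j → sum (λ i → c i * idem (p i) (p j)) ≡ c j
      interpolate {m} c p w≢0 inj j = trans
        (sum-single {m} _ j λ i i≢j → trans (cong (c i *_) (idem-≢ (w≢0 j) (i≢j ∘ sym ∘ inj j i))) (zeroʳ _))
        (trans (cong (c j *_) (idem-≡ (w≢0 j))) (*-identityʳ _))

      interpolateᵀ : ∀ {m} (c : Fin m → F) (p : Fin m → Vec F n) → (∀ i → weight (p i) ≢ 0F) →
        (∀ i j → p i ≡ p j → i ≡ j) → ∀ j → sum (λ i → c i * idem (p j) (p i)) ≡ c j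
      interpolateᵀ {m} c p w≢0 inj j = trans
        (sum-single {m} _ j λ i i≢j → trans (cong (c i *_) (idem-≢ (w≢0 i) (i≢j ∘ inj i j))) (zeroʳ _))
        (trans (cong (c j *_) (idem-≡ (w≢0 j))) (*-identityʳ _))

    open DualBasis basis

    private
      point : Fin (length Z) → Vec F n
      point = List.lookup Z

      point-≢0 : ∀ i → weight (point i) ≢ 0F
      point-≢0 i = ∈Z⇒≢0 (∈-lookup {xs = Z} i)

      point-injective : ∀ i j → point i ≡ point j → i ≡ j
      point-injective i j = lookup-injective (setoid (Vec F n)) Z-unique i j

      weighted-linear : ∀ (w : Fin (length Z) → F) → Linear (λ Q → sum λ i → w i * Q (point i))
      weighted-linear w = record
        { ext = λ e → sum-cong-≗ {length Z} λ i → cong (w i *_) (e _)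
        ; +-homo = λ g h → trans (sum-cong-≗ {length Z} λ i → distribˡ (w i) (g (point i)) (h (point i))) (∑-distrib-+ {length Z} _ _)
        ; *-homo = λ b h → trans (sum-cong-≗ {length Z} λ i → solve 3 (λ w b h → w :* (b :* h) := b :* (w :* h)) refl (w i) b (h (point i)))
            (sym (*-distribˡ-sum {length Z} b _)) }

      weighted-vanish : ∀ (w : Fin (length Z) → F) → (∀ m → sum (λ i → w i * dual m (point i)) ≡ 0F) →
                        ∀ {Q} → Deg e Q → sum (λ i → w i * Q (point i)) ≡ 0F
      weighted-vanish w w⊥ {Q} dQ = trans
        (expansion ev-linear basis (weighted-linear w)
          (λ dh h⊥ → sum-zero {length Z} _ λ i → trans (cong (w i *_) (spans dh h⊥ (∈-lookup {xs = Z} i))) (zeroʳ _)) dQ)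
        (sum-zero {size} _ λ m → trans (cong (Q (elem m) *_) (w⊥ m)) (zeroʳ _))

    -- The products of two dual polynomials span all functions on the support,
    -- since polynomials of degree ≤ 2e do.
    support≤size² : length Z ℕ.≤ size ℕ.* size
    support≤size² = ℕ.≮⇒≥ λ small → refute (dependency small λ i lm →
        dual (proj₁ (remQuot {size} size lm)) (point i) * dual (proj₂ (remQuot {size} size lm)) (point i))
      where
      refute : ¬ (∃[ c ] (∃[ i ] c i ≢ 0F) × (∀ lm → sum (λ i → c i *
        (dual (proj₁ (remQuot {size} size lm)) (point i) * dual (proj₂ (remQuot {size} size lm)) (point i))) ≡ 0F))
      refute (c , (i₀ , c≢0) , c⊥) = c≢0 (trans (sym (interpolateᵀ c point point-≢0 point-injective i₀))
        (all (Deg-weaken a≤2e (idem-Deg (point i₀)))))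
        where
        dual-dual : ∀ l m → sum (λ i → c i * dual m (point i) * dual l (point i)) ≡ 0F
        dual-dual l m = trans (sum-cong-≗ {length Z} λ i → trans
            (solve 3 (λ c u v → c :* u :* v := c :* (v :* u)) refl (c i) (dual m (point i)) (dual l (point i)))
            (cong (λ lm → c i * (dual (proj₁ lm) (point i) * dual (proj₂ lm) (point i))) (sym (Fin.remQuot-combine l m))))
          (c⊥ (combine l m))
        dual-any : ∀ {Q} → Deg e Q → ∀ m → sum (λ i → c i * Q (point i) * dual m (point i)) ≡ 0F
        dual-any {Q} dQ m = trans
          (sum-cong-≗ {length Z} λ i → solve 3 (λ c u v → c :* u :* v := c :* v :* u) refl (c i) (Q (point i)) (dual m (point i)))
          (weighted-vanish (λ i → c i * dual m (point i)) (λ l → dual-dual l m) dQ)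
        products : ∀ {Q Q′} → Deg e Q → Deg e Q′ → sum (λ i → c i * (Q (point i) * Q′ (point i))) ≡ 0F
        products {Q} {Q′} dQ dQ′ = trans (sum-cong-≗ {length Z} λ i → sym (*-assoc _ _ _))
          (weighted-vanish (λ i → c i * Q (point i)) (dual-any dQ) dQ′)
        monomial : ∀ t → Vec.sum t ℕ.≤ e ℕ.+ e → sum (λ i → c i * mon t (point i)) ≡ 0F
        monomial t t≤2e with Vec.sum t ℕ.≤? e
        ... | yes t≤e = trans (sum-cong-≗ {length Z} λ i → cong (c i *_) (sym (*-identityʳ _)))
                          (products (Deg-weaken t≤e (Deg-mon t)) (Deg-const 1F))
        ... | no t≰e with split t e (ℕ.<⇒≤ (ℕ.≰⇒> t≰e))
        ...   | t₁ , t₂ , refl , t₁≡e = trans (sum-cong-≗ {length Z} λ i → cong (c i *_) (mon-+ t₁ t₂ (point i)))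
                  (products (Deg-weaken (ℕ.≤-reflexive t₁≡e) (Deg-mon t₁)) (Deg-weaken t₂≤e (Deg-mon t₂)))
          where
          t₂≤e : Vec.sum t₂ ℕ.≤ e
          t₂≤e = ℕ.+-cancelˡ-≤ e _ _ (subst (ℕ._≤ e ℕ.+ e) (trans (sum-+ t₁ t₂) (cong (ℕ._+ Vec.sum t₂) t₁≡e)) t≤2e)
        all : ∀ {Q} → Deg (e ℕ.+ e) Q → sum (λ i → c i * Q (point i)) ≡ 0F
        all (mono b t s eq) = trans (ext (weighted-linear c) eq) (trans (*-homo (weighted-linear c) b (mon t))
          (trans (cong (b *_) (monomial t s)) (zeroʳ b)))
        all (plus {g = g} {h = h} p r eq) = trans (ext (weighted-linear c) eq) (trans (+-homo (weighted-linear c) g h)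
          (trans (cong₂ _+_ (all p) (all r)) (+-identityʳ 0F)))

    module _ {R : ℕ} (R²≤Z : R ℕ.* R ℕ.≤ length Z) where

      private
        R≤size : R ℕ.≤ size
        R≤size = ℕ.≮⇒≥ λ size<R → ℕ.<-irrefl refl
          (ℕ.<-≤-trans (ℕ.*-mono-< size<R size<R) (ℕ.≤-trans R²≤Z support≤size²))
        ι : Fin R → Fin size
        ι l = inject≤ l R≤size
        ι-injective : ∀ {i j} → ι i ≡ ι j → i ≡ j
        ι-injective = Fin.inject≤-injective R≤size R≤size _ _
        p : Fin R → Vec F n
        p l = elem (ι l)
        p-≢0 : ∀ l → weight (p l) ≢ 0F
        p-≢0 l = ∈Z⇒≢0 (elem∈ (ι l))
        p-injective : ∀ i j → p i ≡ p j → i ≡ j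
        p-injective i j eq = decidable-stable (i Fin.≟ j) λ i≢j → 1F≢0F (trans (sym (dual-≡ (ι j)))
          (trans (cong (dual (ι j)) (sym eq)) (dual-≢ (ι i) (ι j) (i≢j ∘ ι-injective))))
        nonzero? : ∀ (P : Fun q n) → Decidable (λ l → P (p l) ≢ 0F)
        nonzero? P l = ¬? (P (p l) Fin.≟ 0F)
        nonzero : Fun q n → List (Fin R)
        nonzero P = filter (nonzero? P) (allFin R)
        values : ∀ (P : Fun q n) j → P (p j) ≡ sumL (λ (σ , v) → v * kronecker σ j) (List.map (λ l → l , P (p l)) (nonzero P))
        values P j = sym (begin
          sumL (λ (σ , v) → v * kronecker σ j) (List.map (λ l → l , P (p l)) (nonzero P))
            ≡⟨ sumL-map _ (λ l → l , P (p l)) (nonzero P) ⟩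
          sumL (λ l → P (p l) * kronecker l j) (nonzero P)
            ≡⟨ sumL-filter (nonzero? P) (λ l → P (p l) * kronecker l j) vanish (allFin R) ⟩
          sumL (λ l → P (p l) * kronecker l j) (allFin R)
            ≡⟨ sumL-tabulate (λ l → P (p l) * kronecker l j) id ⟩
          sum (λ l → P (p l) * kronecker l j)
            ≡⟨ sum-single {R} _ j (λ l l≢j → trans (cong (P (p l) *_) (kronecker-≢ l≢j)) (zeroʳ _)) ⟩
          P (p j) * kronecker j j
            ≡⟨ trans (cong (P (p j) *_) (kronecker-≡ j)) (*-identityʳ _) ⟩
          P (p j) ∎)
          where
          open ≡-Reasoning
          vanish : ∀ l → ¬ (P (p l) ≢ 0F) → P (p l) * kronecker l j ≡ 0F
          vanish l ¬≢ = trans (cong (_* kronecker l j) (decidable-stable (P (p l) Fin.≟ 0F) ¬≢)) (zeroˡ _)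
        -- Otherwise a nontrivial combination C of the polynomials idem (p l), P (p l) ≠ 0,
        -- vanishes at all points of ys, and testing f · P against C · idem (p l) shows
        -- that its l-th coefficient is zero.
        few : ∀ {P} → Deg e P → ∀ ys →
              (∀ {h} → Deg M h → ⟨ f , (λ x → P x * h x) ⟩ ≡ sumL (λ (y , v) → v * h y) ys) →
              length (nonzero P) ℕ.≤ length ys
        few {P} dP ys near = ℕ.≮⇒≥ λ ys<W → refute (dependency ys<W λ i j → idem (pt i) (proj₁ (List.lookup ys j)))
          where
          W = nonzero P
          pt : Fin (length W) → Vec F n
          pt i = p (List.lookup W i)
          P-≢0 : ∀ i → P (pt i) ≢ 0F
          P-≢0 i = proj₂ (∈-filter⁻ {P = λ l → P (p l) ≢ 0F} (nonzero? P) {xs = allFin R} (∈-lookup {xs = W} i))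
          pt-injective : ∀ i j → pt i ≡ pt j → i ≡ j
          pt-injective i j eq = lookup-injective (setoid (Fin R))
            (Unique.filter⁺ (setoid (Fin R)) (nonzero? P) (UniqueProp.allFin⁺ R)) i j (p-injective _ _ eq)
          refute : ¬ (∃[ c ] (∃[ i ] c i ≢ 0F) × (∀ j → sum (λ i → c i * idem (pt i) (proj₁ (List.lookup ys j))) ≡ 0F))
          refute (c , (i₀ , c≢0) , c⊥) = *-nonZero (*-nonZero (P-≢0 i₀) C-≢0) (p-≢0 (List.lookup W i₀)) (begin
            P (pt i₀) * C (pt i₀) * weight (pt i₀)
              ≡⟨ evaluates (Deg-weaken e+a≤D (Deg-* dP C-Deg)) (pt i₀) ⟨
            ⟨ f , (λ x → P x * C x * idem (pt i₀) x) ⟩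
              ≡⟨ ⟨⟩-cong f (λ x → *-assoc (P x) (C x) _) ⟩
            ⟨ f , (λ x → P x * (C x * idem (pt i₀) x)) ⟩
              ≡⟨ near (Deg-weaken 2a≤M (Deg-* C-Deg (idem-Deg (pt i₀)))) ⟩
            sumL (λ (y , v) → v * (C y * idem (pt i₀) y)) ys
              ≡⟨ sumL-zero _ ys (λ j → trans (cong (proj₂ (List.lookup ys j) *_)
                   (trans (cong (_* idem (pt i₀) (proj₁ (List.lookup ys j))) (c⊥ j)) (zeroˡ _))) (zeroʳ _)) ⟩
            0F ∎)
            where
            open ≡-Reasoning
            C : Fun q n
            C x = sum λ i → c i * idem (pt i) x
            C-Deg : Deg a C
            C-Deg = Deg-∑ {m = length W} _ λ i → Deg-scale (c i) (idem-Deg (pt i))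
            C-≢0 : C (pt i₀) ≢ 0F
            C-≢0 eq = c≢0 (trans (sym (interpolate c pt (λ i → p-≢0 (List.lookup W i)) pt-injective i₀)) eq)

      -- The tests are the values of P at R independent points. By `few` the vector of these values
      -- is itself sparse, so the identity matrix serves as G.
      pointTests : TestFamily f e M R R
      pointTests = record
        { Φ = λ j P → P (p j)
        ; Φ-linear = λ j → ev-linear (p j)
        ; B = dual ∘ ι
        ; B-Deg = dual-Deg ∘ ι
        ; nondegenerate = λ c eq j → trans (sym (trans
            (sum-single {R} _ j λ i i≢j → trans (cong (c i *_) (dual-≢ (ι j) (ι i) (i≢j ∘ sym ∘ ι-injective))) (zeroʳ _))
            (trans (cong (c j *_) (dual-≡ (ι j))) (*-identityʳ _)))) (eq j)
        ; G = kronecker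
        ; code = λ {m} {P} dP (ys , ys≤m , near) → List.map (λ l → l , P (p l)) (nonzero P) ,
            ℕ.≤-trans (ℕ.≤-reflexive (List.length-map _ (nonzero P))) (ℕ.≤-trans (few dP ys near) ys≤m) ,
            values P
        }

  support : ∀ {n} → Fun q n → List (Vec F n)
  support {n} w = filter (λ z → ¬? (w z Fin.≟ 0F)) (vectors q n)

  support-unique : ∀ {n} (w : Fun q n) → Unique (setoid (Vec F n)) (support w)
  support-unique {n} w = Unique.filter⁺ (setoid (Vec F n)) (λ z → ¬? (w z Fin.≟ 0F)) (vectors-unique n)

  ∈support⇒≢0 : ∀ {n} (w : Fun q n) {z} → z ∈ support w → w z ≢ 0F
  ∈support⇒≢0 {n} w {z} z∈ = proj₂ (∈-filter⁻ {P = λ z → w z ≢ 0F} (λ z → ¬? (w z Fin.≟ 0F)) {v = z} {xs = vectors q n} z∈)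

-- The two cases, and close products as sparse functionals

module Dichotomy (q : ℕ) .{{_ : NonZero q}} (q-prime : Prime q) where

  open PrimeField q q-prime
  open Sums q q-prime
  open Polynomials q q-prime
  open Pairing q q-prime
  open Indicators q q-prime
  open LinearAlgebra q q-prime
  open Codewords q q-prime
  open Divisors q q-prime
  open DivisorTests q q-prime
  open Reduction q q-prime
  open Interpolation q q-prime

  module _ {n : ℕ} (f : Fun q n) {e a T N b M : ℕ} (1+a≡2e : suc a ≡ e ℕ.+ e) (1+a+T≡N : suc a ℕ.+ T ≡ N)
    (w+a+b≡N : (q ∸ 1 ℕ.+ a) ℕ.+ b ≡ N) (w+a≤T : q ∸ 1 ℕ.+ a ℕ.≤ T) (T+e≤M : T ℕ.+ e ℕ.≤ M)
    (e+a≤1+T : e ℕ.+ a ℕ.≤ suc T) (2a≤M : a ℕ.+ a ℕ.≤ M)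
    {R : ℕ} (large : ∀ w → (∀ {h} → Deg N h → ⟨ f , h ⟩ ≡ ⟨ w , h ⟩) → R ℕ.* R ℕ.≤ length (support w)) where

    open Functional f

    private
      pointCase : (∀ u → Vec.sum u ≡ suc a → ¬ Irreducible a T (mon u)) → TestFamily f e M R R
      pointCase none = PointTests.pointTests {D = suc T} f weight idem idem-Deg
          (ℕ.≤-trans (ℕ.n≤1+n a) (ℕ.≤-reflexive 1+a≡2e)) e+a≤1+T 2a≤M
          idem-evaluates idem-≢ idem-≡ (support weight) (support-unique weight) (∈support⇒≢0 weight)
          (dualBasis ev-linear (support weight)) (large weight (representation N ℕ.≤-refl))
        where
        open FlatExtension 1+a+T≡N (λ u s → reducible (none u s))
        open Points b w+a+b≡N w+a≤T

      divisorCase : ∀ p → p ℕ.* (q ∸ 1) ℕ.≤ e → ∃[ u ] LexMinimal (suc a) (λ t → Irreducible a T (mon t)) u →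
                    TestFamily f e M (q ℕ.^ (e ℕ.+ e)) (double p)
      divisorCase p p≤e (u , s , (h , dh , low , ne) , min) = divisorTests f T+e≤M dh u (trans s 1+a≡2e) ne
        -- If h did not kill a lex-smaller t of the same degree, the same h would witness the
        -- irreducibility of t.
        (λ t t≡u t<u → decidable-stable (_ Fin.≟ 0F) λ ne′ → min t (trans t≡u s) t<u (h , dh , low , ne′))
        (λ {g} {k} k< dg → low g (Deg-weaken (ℕ.s≤s⁻¹ (subst (k ℕ.<_) (sym 1+a≡2e) k<)) dg)) p p≤e

    testFamily : ∀ p → p ℕ.* (q ∸ 1) ℕ.≤ e →
                 TestFamily f e M (q ℕ.^ (e ℕ.+ e)) (double p) ⊎ TestFamily f e M R R
    testFamily p p≤e = Sum.swap (Sum.map pointCase (divisorCase p p≤e)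
      (lexMinimal? (suc a) (λ t → irreducible? a T (mon t))))

  -- A letter packs a row of G with a coefficient. Shorter lists are padded to exactly m letters by
  -- the coefficient 0 at the arbitrary row σ₀, so that (s q)^m words cover all of them.
  encode : ∀ {s R} (G : Fin s → Fin R → F) → Fin s → ∀ m (ys : List (Fin s × F)) → length ys ℕ.≤ m →
           Σ[ φ ∈ (Fin m → Fin (s ℕ.* q)) ] ∀ j → sumL (λ (σ , v) → v * G σ j) ys ≡
             sum (λ k → proj₂ (remQuot {s} q (φ k)) * G (proj₁ (remQuot {s} q (φ k))) j)
  encode G σ₀ zero    []       _ = (λ ()) , λ j → refl
  encode {s} G σ₀ (suc m) [] _ = (λ _ → combine σ₀ 0F) , λ j → sym (sum-zero {suc m} _ λ _ →
    trans (cong (λ p → proj₂ p * G (proj₁ p) j) (Fin.remQuot-combine {s} σ₀ 0F)) (zeroˡ _))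
  encode {s} G σ₀ (suc m) ((σ , v) ∷ ys) (ℕ.s≤s ys≤m) = extend (encode G σ₀ m ys ys≤m)
    where
    extend : Σ[ φ ∈ (Fin m → Fin (s ℕ.* q)) ] (∀ j → sumL (λ (σ , v) → v * G σ j) ys ≡
               sum (λ k → proj₂ (remQuot {s} q (φ k)) * G (proj₁ (remQuot {s} q (φ k))) j)) →
             Σ[ φ ∈ (Fin (suc m) → Fin (s ℕ.* q)) ] (∀ j → sumL (λ (σ , v) → v * G σ j) ((σ , v) ∷ ys) ≡
               sum (λ k → proj₂ (remQuot {s} q (φ k)) * G (proj₁ (remQuot {s} q (φ k))) j))
    extend (φ , eq) = (λ where zero → combine σ v
                               (suc k) → φ k) , λ j →
      cong₂ _+_ (cong (λ p → proj₂ p * G (proj₁ p) j) (sym (Fin.remQuot-combine {s} σ v))) (eq j)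

  -- With g the near codeword, the error f · P - g is supported on fewer than m points, and g
  -- contributes nothing: its product with a test has degree at most d + e + M < n (q - 1), so its
  -- values sum to zero.
  distance<⇒Near : ∀ {n d e M m} (f P : Fun q n) → d ℕ.+ e ℕ.+ M ℕ.< n ℕ.* (q ∸ 1) →
                   distance (f · P) (d ℕ.+ e) ℕ.< m → Near M f m P
  distance<⇒Near {n} {d} {e} {M} {m} f P small close = near (distance<⇒near (f · P) close)
    where
    near : ∃[ g ] Deg (d ℕ.+ e) g × hamming (f · P) g ℕ.< m → Near M f m P
    near (g , dg , close) = List.map entry D ,
        ℕ.≤-trans (ℕ.≤-reflexive (List.length-map entry D)) (ℕ.<⇒≤ close) , λ {h} dh → begin
          ⟨ f , (λ x → P x * h x) ⟩
            ≡⟨ ⟨⟩≡sumV f _ ⟩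
          sumV (λ x → f x * (P x * h x))
            ≡⟨ sumV-cong (λ x → add-subtract (f x) (P x) (g x) (h x)) ⟩
          sumV (λ x → ((f · P) x + - g x) * h x + g x * h x)
            ≡⟨ sumV-+ _ _ ⟩
          sumV (λ x → ((f · P) x + - g x) * h x) + sumV (λ x → g x * h x)
            ≡⟨ trans (cong (sumV (λ x → ((f · P) x + - g x) * h x) +_) (sumV-Deg (Deg-* dg dh) small)) (+-identityʳ _) ⟩
          sumV (λ x → ((f · P) x + - g x) * h x)
            ≡⟨ sumV-vectors _ ⟩
          sumL (λ x → ((f · P) x + - g x) * h x) (vectors q n)
            ≡⟨ sumL-filter differ? (λ x → ((f · P) x + - g x) * h x) (agree h) (vectors q n) ⟨
          sumL (λ x → ((f · P) x + - g x) * h x) D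
            ≡⟨ sumL-map (λ (y , v) → v * h y) entry D ⟨
          sumL (λ (y , v) → v * h y) (List.map entry D) ∎
      where
      open ≡-Reasoning
      differ? : Decidable (λ x → (f · P) x ≢ g x)
      differ? x = ¬? ((f · P) x Fin.≟ g x)
      D : List (Vec F n)
      D = filter differ? (vectors q n)
      entry : Vec F n → Vec F n × F
      entry x = x , (f · P) x + - g x
      agree : ∀ h x → ¬ ((f · P) x ≢ g x) → ((f · P) x + - g x) * h x ≡ 0F
      agree h x same = trans (cong (λ y → (y + - g x) * h x) (decidable-stable ((f · P) x Fin.≟ g x) same))
        (trans (cong (_* h x) (x-x≡0 (g x))) (zeroˡ _))
      add-subtract : ∀ u p v h → u * (p * h) ≡ (u *F p + - v) * h + v * h
      add-subtract u p v h = sym (begin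
        (u *F p + - v) * h + v * h ≡⟨ distribʳ h _ v ⟨
        (u *F p + - v + v) * h     ≡⟨ cong (_* h) (trans (+-assoc _ _ _) (trans (cong (u *F p +_) (-‿inverseˡ v)) (+-identityʳ _))) ⟩
        (u *F p) * h               ≡⟨ cong (_* h) (*F≡* u p) ⟩
        u * p * h                  ≡⟨ *-assoc u p h ⟩
        u * (p * h)                ∎)

  closeCount : ∀ {n d e M m s R} {f : Fun q n} → TestFamily f e M s R → Fin s → d ℕ.+ e ℕ.+ M ℕ.< n ℕ.* (q ∸ 1) →
    length (filter (λ P → distance (f · P) (d ℕ.+ e) ℕ.<? m) (reedMuller q n e)) ℕ.* q ℕ.^ R ℕ.≤
    length (reedMuller q n e) ℕ.* (s ℕ.* q) ℕ.^ m
  closeCount {n} {d} {e} {M} {m} {s} {R} {f} family σ₀ small = fiber-count {e = e} {R} {(s ℕ.* q) ℕ.^ m}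
      (reedMuller q n e) (reedMuller-unique e) (λ {f} → ∈reedMuller⇒Deg {f = f} {e}) (λ {f} → Deg⇒∈reedMuller {f = f} {e})
      {λ P → distance (f · P) (d ℕ.+ e) ℕ.< m} (λ P → distance (f · P) (d ℕ.+ e) ℕ.<? m) Φ Φ-linear B B-Deg nondegenerate
      dec (λ {P} dP close → covered dP (distance<⇒Near {d = d} {e} f P small close))
    where
    open TestFamily family
    value : (Fin m → Fin (s ℕ.* q)) → Fin R → F
    value φ j = sum λ k → proj₂ (remQuot {s} q (φ k)) * G (proj₁ (remQuot {s} q (φ k))) j
    dec : Fin ((s ℕ.* q) ℕ.^ m) → Fin R → F
    dec t = value (finToFun t)
    covered : ∀ {P} → Deg e P → Near M f m P → ∃[ t ] ∀ j → Φ j P ≡ dec t j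
    covered dP near = let (ys , ys≤m , eq) = code dP near
                          (φ , enc) = encode G σ₀ m ys ys≤m
      in funToFin φ , λ j → trans (eq j) (trans (enc j) (sum-cong-≗ {m} λ k →
           cong (λ i → proj₂ (remQuot {s} q i) * G (proj₁ (remQuot {s} q i)) j) (sym (Fin.finToFun-funToFin φ k))))

  -- The difference f - w annihilates degree ≤ N, so by duality it is a codeword of degree d; it
  -- differs from f exactly on the support of w.
  far⇒large : ∀ {n d N Δ} (f : Fun q n) → n ℕ.* (q ∸ 1) ∸ suc N ≡ d → Far Δ f d →
              ∀ w → (∀ {h} → Deg N h → ⟨ f , h ⟩ ≡ ⟨ w , h ⟩) → Δ ℕ.< length (support w)
  far⇒large {n} {d} {N} {Δ} f codim≡d far w represents = ℕ.<-≤-trans far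
    (ℕ.≤-trans (distance≤hamming f g-Deg) (ℕ.≤-reflexive hamming≡))
    where
    open ≡-Reasoning
    g : Fun q n
    g x = f x + - 1F * w x
    g-ann : ∀ {h} → Deg N h → ⟨ g , h ⟩ ≡ 0F
    g-ann {h} dh = begin
      ⟨ g , h ⟩                                      ≡⟨ ⟨⟩≡sumV g h ⟩
      sumV (λ x → (f x + - 1F * w x) * h x)          ≡⟨ sumV-cong (λ x → trans (distribʳ (h x) _ _) (cong (f x * h x +_) (*-assoc _ _ _))) ⟩
      sumV (λ x → f x * h x + - 1F * (w x * h x))    ≡⟨ trans (sumV-+ _ _) (cong₂ _+_ (sym (⟨⟩≡sumV f h)) (sumV-*ˡ (- 1F) _)) ⟩
      ⟨ f , h ⟩ + - 1F * sumV (λ x → w x * h x)      ≡⟨ cong₂ _+_ (represents dh) (trans (-1*x≈-x _) (cong -_ (sym (⟨⟩≡sumV w h)))) ⟩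
      ⟨ w , h ⟩ + - ⟨ w , h ⟩                        ≡⟨ x-x≡0 _ ⟩
      0F                                             ∎
    g-Deg : Deg d g
    g-Deg = subst (λ k → Deg k g) codim≡d (annihilator⇒Deg g g-ann)
    f≡g : ∀ x → w x ≡ 0F → f x ≡ g x
    f≡g x w≡0 = sym (trans (cong (f x +_) (trans (cong (- 1F *_) w≡0) (zeroʳ _))) (+-identityʳ _))
    w≡0 : ∀ x → f x ≡ g x → w x ≡ 0F
    w≡0 x eq = trans (sym (-‿involutive (w x))) (trans (cong -_ -w≡0) -0≡0)
      where
      -w≡0 : - w x ≡ 0F
      -w≡0 = +-cancelˡ (f x) _ _ (trans (cong (f x +_) (sym (-1*x≈-x _))) (trans (sym eq) (sym (+-identityʳ _))))
      -0≡0 : - 0F ≡ 0F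
      -0≡0 = trans (sym (+-identityˡ _)) (x-x≡0 0F)
    hamming≡ : hamming f g ≡ length (support w)
    hamming≡ = cong length (List.filter-≐ (λ x → ¬? (f x Fin.≟ g x)) (λ x → ¬? (w x Fin.≟ 0F))
      ((λ {x} ne → ne ∘ f≡g x) , (λ {x} ne → ne ∘ w≡0 x)) (vectors q n))

-- Natural-number inequalities from and to Dedekind cuts

module Reals where

  open import Data.Integer.Base as ℤ using (+_; -[1+_])
  import Data.Integer.Properties as ℤ
  open import Data.Rational.Base as ℚ using (ℚ; mkℚ; 0ℚ; 1ℚ; toℚᵘ; _/_; ↧ₙ_; *<*; *≤*)
  import Data.Rational.Properties as ℚ
  open import Data.Rational.Literals using (fromℤ)
  open import Data.Rational.Unnormalised.Base as ℚᵘ using (mkℚᵘ; *≡*; *<*; *≤*)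
  import Data.Rational.Unnormalised.Properties as ℚᵘ
  open import Algebra.Properties.CommutativeSemiring.Exp (CommutativeRing.commutativeSemiring ℚ.+-*-commutativeRing)
    using (^-distrib-*)

  open ℝ using (_∋_)

  ℕ→ℚ-mono-< : ∀ {m n} → m ℕ.< n → ℕ→ℚ m ℚ.< ℕ→ℚ n
  ℕ→ℚ-mono-< {m} {n} m<n = *<* (subst₂ ℤ._<_ (sym (ℤ.*-identityʳ (+ m))) (sym (ℤ.*-identityʳ (+ n))) (ℤ.+<+ m<n))

  ℕ→ℚ-* : ∀ m n → ℕ→ℚ (m ℕ.* n) ≡ ℕ→ℚ m ℚ.* ℕ→ℚ n
  ℕ→ℚ-* m n = ℚ.toℚᵘ-injective (ℚᵘ.≃-trans (*≡* (cong (ℤ._* + 1) (ℤ.pos-* m n))) (ℚᵘ.≃-sym (ℚ.toℚᵘ-homo-* (ℕ→ℚ m) (ℕ→ℚ n))))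

  ℕ→ℚ-^ : ∀ b m → ℕ→ℚ (b ℕ.^ m) ≡ ℕ→ℚ b ^ℚ m
  ℕ→ℚ-^ b zero    = refl
  ℕ→ℚ-^ b (suc m) = trans (ℕ→ℚ-* b (b ℕ.^ m)) (cong (ℕ→ℚ b ℚ.*_) (ℕ→ℚ-^ b m))

  toℚᵘ-/ : ∀ m n .{{_ : NonZero n}} → toℚᵘ ((+ m) / n) ℚᵘ.≃ (+ m) ℚᵘ./ n
  toℚᵘ-/ m (suc n) = ℚ.toℚᵘ-fromℚᵘ (mkℚᵘ (+ m) n)

  toℚᵘ-/-* : ∀ m n .{{_ : NonZero n}} k → toℚᵘ ((+ m) / n ℚ.* ℕ→ℚ k) ℚᵘ.≃ (+ (m ℕ.* k)) ℚᵘ./ n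
  toℚᵘ-/-* m (suc n) k = ℚᵘ.≃-trans (ℚ.toℚᵘ-homo-* ((+ m) / suc n) (ℕ→ℚ k))
    (ℚᵘ.≃-trans (ℚᵘ.*-congʳ {toℚᵘ (ℕ→ℚ k)} (toℚᵘ-/ m (suc n)))
      (*≡* (cong₂ (λ a b → a ℤ.* (+ suc b)) (sym (ℤ.pos-* m k)) (sym (ℕ.*-identityʳ n)))))

  fraction-< : ∀ m n .{{_ : NonZero n}} k → m ℕ.< n ℕ.* k → (+ m) / n ℚ.< ℕ→ℚ k
  fraction-< m (suc n) k h = ℚ.toℚᵘ-cancel-< (ℚᵘ.<-respˡ-≃ (ℚᵘ.≃-sym (toℚᵘ-/ m (suc n))) (*<*
    (subst₂ ℤ._<_ (sym (ℤ.*-identityʳ (+ m))) (trans (ℤ.pos-* (suc n) k) (ℤ.*-comm (+ suc n) (+ k))) (ℤ.+<+ h))))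

  fraction-*-≤ : ∀ m n .{{_ : NonZero n}} k l → m ℕ.* k ℕ.≤ n ℕ.* l → (+ m) / n ℚ.* ℕ→ℚ k ℚ.≤ ℕ→ℚ l
  fraction-*-≤ m (suc n) k l h = ℚ.toℚᵘ-cancel-≤ (ℚᵘ.≤-respˡ-≃ (ℚᵘ.≃-sym (toℚᵘ-/-* m (suc n) k)) (*≤*
    (subst₂ ℤ._≤_ (sym (ℤ.*-identityʳ (+ (m ℕ.* k)))) (trans (ℤ.pos-* (suc n) l) (ℤ.*-comm (+ suc n) (+ l))) (ℤ.+≤+ h))))

  positive⇒<-* : ∀ t → 0ℚ ℚ.< t → ∀ m r → m ℕ.* ↧ₙ t ℕ.< r → ℕ→ℚ m ℚ.< t ℚ.* ℕ→ℚ r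
  positive⇒<-* (mkℚ (+ zero)  d c) 0<t m r h = contradiction (ℚ.drop-*<* 0<t) λ { (ℤ.+<+ ()) }
  positive⇒<-* (mkℚ (-[1+ p ]) d c) 0<t m r h = contradiction (ℚ.drop-*<* 0<t) λ ()
  positive⇒<-* t@(mkℚ (+ suc p) d c) 0<t m r h = ℚ.toℚᵘ-cancel-<
    (ℚᵘ.<-respʳ-≃ (ℚᵘ.≃-sym (ℚ.toℚᵘ-homo-* t (ℕ→ℚ r))) (*<* (subst₂ ℤ._<_
      (trans (ℤ.pos-* m (suc d)) (cong (λ k → + m ℤ.* + suc k) (sym (ℕ.*-identityʳ d))))
      (trans (ℤ.pos-* (suc p) r) (sym (ℤ.*-identityʳ _)))
      (ℤ.+<+ (ℕ.<-≤-trans h (ℕ.m≤n*m r (suc p)))))))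

  -- A natural number b with 1/b ≤ x.
  positive⇒multiple : ∀ x → ℕ→ℝ 0 <ᴿ x → ∃[ b ] (1 ℕ.≤ b × ∀ m r → m ℕ.* b ℕ.< r → (x ·ᴿ r) ∋ ℕ→ℚ m)
  positive⇒multiple x (s , s∈x , s∉0) with ℝ.open′ x s∈x
  ... | t , s<t , t∈x = ↧ₙ t , ℕ.s≤s ℕ.z≤n , λ m r h → t ℚ.* ℕ→ℚ r , (t , t∈x , refl) , positive⇒<-* t 0<t m r h
    where
    0<t : 0ℚ ℚ.< t
    0<t = ℚ.≤-<-trans (ℚ.≮⇒≥ λ s<0 → s∉0 (0ℚ , refl , s<0)) s<t

  ∈ℚ→ℝ⇒< : ∀ {a s} → ℚ→ℝ a ∋ s → s ℚ.< a
  ∈ℚ→ℝ⇒< (_ , refl , s<a) = s<a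

  multiple-≤ : ∀ {x b} → (∀ m r → m ℕ.* b ℕ.< r → (x ·ᴿ r) ∋ ℕ→ℚ m) → ∀ {r e} → x ·ᴿ r ≤ᴿ ℕ→ℝ e → r ℕ.≤ e ℕ.* b
  multiple-≤ mult {r} {e} h = ℕ.≮⇒≥ λ eb<r → ℚ.<-irrefl refl (∈ℚ→ℝ⇒< (h (ℕ→ℚ e) (mult e r eb<r)))

  ℕ→ℝ≤fraction : ∀ {e r n} .{{_ : NonZero n}} → ℕ→ℝ e ≤ᴿ ℚ→ℝ ((+ r) / n) → n ℕ.* e ℕ.≤ r
  ℕ→ℝ≤fraction {e} {r} {n} h = ℕ.≮⇒≥ λ r<ne →
    ℚ.<-irrefl refl (∈ℚ→ℝ⇒< (h ((+ r) / n) (ℕ→ℚ e , refl , fraction-< r n e r<ne)))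

  0≤ℕ→ℚ : ∀ n → 0ℚ ℚ.≤ ℕ→ℚ n
  0≤ℕ→ℚ n = *≤* (subst (+ 0 ℤ.≤_) (sym (ℤ.*-identityʳ (+ n))) (ℤ.+≤+ ℕ.z≤n))

  power≤ : ∀ b .{{_ : NonZero b}} {y Δ m} → y ∋ ℕ→ℚ m → b ^ᴿ y ≤ᴿ ℕ→ℝ Δ → b ℕ.^ m ℕ.≤ Δ
  power≤ b {y} {Δ} {m} m∈y h = ℕ.≮⇒≥ λ Δ<bᵐ → ℚ.<-irrefl refl (∈ℚ→ℝ⇒< (h (ℕ→ℚ Δ)
    (ℕ→ℚ (b ℕ.^ m) , (ℕ→ℚ m , m∈y , 0≤ℕ→ℚ _ ,
      ℚ.≤-reflexive (trans (ℚ.*-identityʳ _) (ℕ→ℚ-^ b m))) , ℕ→ℚ-mono-< Δ<bᵐ)))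

  -- The bound witnessing that the cut b ^ᴿ x is proper is b^∣u∣, where u ∉ x is the
  -- corresponding witness for x; replacing the latter by k gives the bound b^k.
  power∌ : ∀ b .{{_ : NonZero b}} x k → ¬ x ∋ ℕ→ℚ k → ¬ (b ^ᴿ x) ∋ ℕ→ℚ (b ℕ.^ k)
  power∌ b x k k∉x = subst (λ s → ¬ (b ^ᴿ x) ∋ s) (sym (ℕ→ℚ-^ b k)) (proj₂ (ℝ.proper (b ^ᴿ x′)))
    where
    x′ : ℝ
    x′ = record { ℝ x hiding (proper) ; proper = ℕ→ℚ k , k∉x }

  ∌⇒≤ᴿ : ∀ x n → ¬ x ∋ ℕ→ℚ n → x ≤ᴿ ℕ→ℝ n
  ∌⇒≤ᴿ x n n∉x s s∈x = ℕ→ℚ n , refl , ℚ.≰⇒> λ n≤s → n∉x (below n≤s)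
    where
    below : ∀ {t} → t ℚ.≤ s → x ∋ t
    below {t} t≤s with t ℚ.<? s
    ... | yes t<s = ℝ.lower x t<s s∈x
    ... | no  t≮s = subst (x ∋_) (ℚ.≤-antisym (ℚ.≮⇒≥ t≮s) t≤s) s∈x

  scaled∌ : ∀ b .{{_ : NonZero b}} r k → r ℕ.≤ b ℕ.* k → ¬ (ℚ→ℝ ((+ 1) / b) ·ᴿ r) ∋ ℕ→ℚ k
  scaled∌ b r k r≤bk (u , (t , (_ , refl , t<c) , refl) , k<u) = ℚ.<-irrefl refl (ℚ.<-≤-trans k<u
    (ℚ.≤-trans (ℚ.*-monoʳ-≤-nonNeg (ℕ→ℚ r) {{ℚ.nonNegative (0≤ℕ→ℚ r)}} (ℚ.<⇒≤ t<c))
      (fraction-*-≤ 1 b r k (subst (ℕ._≤ b ℕ.* k) (sym (ℕ.*-identityˡ r)) r≤bk))))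

  0<fraction : ∀ b .{{_ : NonZero b}} → ℕ→ℝ 0 <ᴿ ℚ→ℝ ((+ 1) / b)
  0<fraction b = 0ℚ , ((+ 1) / b , refl , 0<1/b) , λ (_ , e , 0<0) → ℚ.<-irrefl (sym e) 0<0
    where
    0<1/b : 0ℚ ℚ.< (+ 1) / b
    0<1/b = ℚ.toℚᵘ-cancel-< (ℚᵘ.<-respʳ-≃ (ℚᵘ.≃-sym (toℚᵘ-/ 1 b)) (positive b))
      where
      positive : ∀ b .{{_ : NonZero b}} → mkℚᵘ (+ 0) 0 ℚᵘ.< (+ 1) ℚᵘ./ b
      positive (suc b) = *<* (ℤ.+<+ (ℕ.s≤s ℕ.z≤n))

  open import Algebra.Properties.Group ℚ.+-0-group using (⁻¹-involutive)

  -- `¬ y ∋ ℕ→ℚ Y` bounds y by Y, but the cut of -y contains only rationals strictly below its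
  -- bound. The exponent -(Y + 1) is certain to lie in it, hence the extra factor b in the
  -- hypothesis.
  fraction≤power : ∀ b .{{_ : NonZero b}} y Y E N .{{_ : NonZero N}} → ¬ y ∋ ℕ→ℚ Y → E ℕ.* b ℕ.^ suc Y ℕ.≤ N →
                   ℚ→ℝ ((+ E) / N) ≤ᴿ b ^ᴿ (-ᴿ y)
  fraction≤power b y Y E N Y∉y h s (_ , refl , s<E/N) = s′ ,
      (fromℤ -[1+ Y ] , (ℚ.- ℕ→ℚ Y , subst (λ t → ¬ y ∋ t) (sym (⁻¹-involutive (ℕ→ℚ Y))) Y∉y , -1-Y<-Y Y) ,
        0≤s′ , ℚ.≤-reflexive (ℚ.*-identityʳ s′)) ,
      ℚ.<-≤-trans s<E/N E/N≤s′
    where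
    s′ : ℚ
    s′ = (ℚ.1/ ℕ→ℚ b) ^ℚ suc Y
    -1-Y<-Y : ∀ Y → fromℤ -[1+ Y ] ℚ.< ℚ.- ℕ→ℚ Y
    -1-Y<-Y zero    = *<* ℤ.-<+
    -1-Y<-Y (suc Y) = *<* (ℤ.-<- (subst₂ ℕ._<_ (sym (ℕ.*-identityʳ Y)) (sym (ℕ.*-identityʳ (suc Y))) ℕ.≤-refl))
    bX : ℚ
    bX = ℕ→ℚ (b ℕ.^ suc Y)
    1^ : ∀ n → 1ℚ ^ℚ n ≡ 1ℚ
    1^ zero    = refl
    1^ (suc n) = trans (ℚ.*-identityˡ _) (1^ n)
    s′*bX≡1 : s′ ℚ.* bX ≡ 1ℚ
    s′*bX≡1 = trans (cong (s′ ℚ.*_) (ℕ→ℚ-^ b (suc Y))) (trans (sym (^-distrib-* (ℚ.1/ ℕ→ℚ b) (ℕ→ℚ b) (suc Y)))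
      (trans (cong (_^ℚ suc Y) (ℚ.*-inverseˡ (ℕ→ℚ b))) (1^ (suc Y))))
    instance
      bX-positive : ℚ.Positive bX
      bX-positive = ℚ.positive (ℕ→ℚ-mono-< (ℕ.m^n>0 b (suc Y)))
    E/N≤s′ : (+ E) / N ℚ.≤ s′
    E/N≤s′ = ℚ.*-cancelʳ-≤-pos bX (subst ((+ E) / N ℚ.* bX ℚ.≤_) (sym s′*bX≡1)
      (fraction-*-≤ E N (b ℕ.^ suc Y) 1 (subst (E ℕ.* b ℕ.^ suc Y ℕ.≤_) (sym (ℕ.*-identityʳ N)) h)))
    0≤s′ : 0ℚ ℚ.≤ s′
    0≤s′ = ℚ.*-cancelʳ-≤-pos bX (subst₂ ℚ._≤_ (sym (ℚ.*-zeroˡ bX)) (sym s′*bX≡1) (0≤ℕ→ℚ 1))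

-- The degree budget and the count of close products

module Counting (q : ℕ) .{{_ : NonZero q}} (q-prime : Prime q) where

  open Pairing q q-prime using (suc[q∸1]≡q; 1≤q∸1; ⟨_,_⟩)
  open Polynomials q q-prime using (Deg)
  open LinearAlgebra q q-prime using (1<q)
  open Divisors q q-prime using (double)
  open DivisorTests q q-prime using (TestFamily)
  open Interpolation q q-prime using (support)
  open Dichotomy q q-prime
  open import Data.Nat.Base using (_+_; _*_; _^_; _≤_; _<_; z≤n; s≤s; s≤s⁻¹)
  open import Data.Nat.Properties
  open import Data.Nat.Solver using (module +-*-Solver)

  open +-*-Solver using (solve; _:+_; _:*_; _:=_; con)

  double≡2^ : ∀ p → double p ≡ 2 ^ p
  double≡2^ zero    = refl
  double≡2^ (suc p) = cong₂ _+_ (double≡2^ p) (trans (double≡2^ p) (sym (+-identityʳ _)))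

  n<2^n : ∀ n → n < 2 ^ n
  n<2^n zero    = s≤s z≤n
  n<2^n (suc n) = ≤-trans (s≤s (n<2^n n)) (≤-trans (+-monoˡ-≤ (2 ^ n) (m^n>0 2 n)) (≤-reflexive (cong (2 ^ n +_) (sym (+-identityʳ _)))))

  cancel-power : ∀ {E L R S} m → E * q ^ R ≤ L * (q ^ S * q) ^ m → suc S * m + suc m ≤ R → E * q ^ suc m ≤ L
  cancel-power {E} {L} {R} {S} m count bound = *-cancelʳ-≤ _ _ (q ^ (suc S * m)) {{m^n≢0 q (suc S * m)}} (begin
    E * q ^ suc m * q ^ (suc S * m)   ≡⟨ *-assoc E (q ^ suc m) _ ⟩
    E * (q ^ suc m * q ^ (suc S * m)) ≡⟨ cong (E *_) (^-distribˡ-+-* q (suc m) (suc S * m)) ⟨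
    E * q ^ (suc m + suc S * m)       ≤⟨ *-monoʳ-≤ E (^-monoʳ-≤ q (≤-trans (≤-reflexive (+-comm (suc m) _)) bound)) ⟩
    E * q ^ R                         ≤⟨ count ⟩
    L * (q ^ S * q) ^ m               ≡⟨ cong (λ z → L * z ^ m) (*-comm (q ^ S) q) ⟩
    L * (q ^ suc S) ^ m               ≡⟨ cong (L *_) (^-*-assoc q (suc S) m) ⟩
    L * q ^ (suc S * m)               ∎)
    where open ≤-Reasoning

  module _ {n d N Δ e′ : ℕ} (k : ℕ) (r+d≡ : suc N + d ≡ (q ∸ 1) * n) (8e≤r : 8 * suc e′ ≤ suc N)
    (r≤m : suc N ≤ q ^ k) (κ+2≤r : suc (k + k) + 2 ≤ suc N) (p≤e : q * suc (k + k) * (q ∸ 1) ≤ suc e′)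
    (Δ-large : q ^ suc (k + k) * q ^ suc (k + k) ≤ Δ) (f : Fun q n) (far : Far Δ f d) where

    private
      e r κ m p : ℕ
      e = suc e′
      r = suc N
      κ = suc (k + k)
      m = q ^ k
      p = q * κ

      -- Here a = 2e - 1. From the budget N = r - 1, a monomial of degree 2e leaves T, a factor P of
      -- degree e leaves M, and a representative of degree a times an indicator of degree q - 1
      -- leaves b.
      a T b M : ℕ
      a = e′ + suc e′
      T = N ∸ (e + e)
      b = N ∸ (q ∸ 1 + a)
      M = N ∸ e

      q≤e : q ≤ e
      q≤e = ≤-trans (≤-reflexive (sym (trans (*-identityʳ _) (*-identityʳ q))))
        (≤-trans (*-mono-≤ (*-monoʳ-≤ q {1} {κ} (s≤s z≤n)) 1≤q∸1) p≤e)

      5e≤r : 5 * e ≤ r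
      5e≤r = ≤-trans (*-monoˡ-≤ e {5} {8} (s≤s (s≤s (s≤s (s≤s (s≤s z≤n)))))) 8e≤r

      w+4e≤N : q ∸ 1 + 4 * e ≤ N
      w+4e≤N = s≤s⁻¹ (≤-trans (≤-reflexive (cong (_+ 4 * e) suc[q∸1]≡q)) (≤-trans (+-monoˡ-≤ (4 * e) q≤e) 5e≤r))

      4e≤N : 4 * e ≤ N
      4e≤N = ≤-trans (m≤n+m (4 * e) (q ∸ 1)) w+4e≤N

      2e≤N : e + e ≤ N
      2e≤N = ≤-trans (+-monoʳ-≤ e (m≤m+n e (e + (e + 0)))) 4e≤N

      e≤N : e ≤ N
      e≤N = ≤-trans (m≤m+n e e) 2e≤N

      e≤M : e ≤ M
      e≤M = m+n≤o⇒m≤o∸n e 2e≤N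

      w+a+2e≤N : q ∸ 1 + a + (e + e) ≤ N
      w+a+2e≤N = ≤-trans (+-monoˡ-≤ (e + e) (+-monoʳ-≤ (q ∸ 1) (n≤1+n a)))
        (≤-trans (≤-reflexive (solve 2 (λ w e → w :+ (e :+ e) :+ (e :+ e) := w :+ con 4 :* e) refl (q ∸ 1) e)) w+4e≤N)

      w+a≤N : q ∸ 1 + a ≤ N
      w+a≤N = ≤-trans (m≤m+n _ _) w+a+2e≤N

      T+e≤M : T + e ≤ M
      T+e≤M = ≤-reflexive (trans (cong (_+ e) (sym (∸-+-assoc N e e))) (m∸n+n≡m e≤M))

      e+a≤1+T : e + a ≤ suc T
      e+a≤1+T = ≤-trans (m+n≤o⇒m≤o∸n (e + a) (s≤s⁻¹ (≤-trans (≤-reflexive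
        (trans (cong (_+ (e + e)) (sym (+-suc e a))) (solve 1 (λ e → e :+ (e :+ e) :+ (e :+ e) := con 5 :* e) refl e))) 5e≤r))) (n≤1+n T)

      2a≤M : a + a ≤ M
      2a≤M = m+n≤o⇒m≤o∸n (a + a) (s≤s⁻¹ (≤-trans (≤-trans (n≤1+n _) (≤-reflexive
        (trans (cong (λ z → suc z + e) (sym (+-suc a a))) (solve 1 (λ e → (e :+ e) :+ (e :+ e) :+ e := con 5 :* e) refl e)))) 5e≤r))

      small : d + e + M < n * (q ∸ 1)
      small = ≤-reflexive (trans (cong suc (trans (+-assoc d e M) (cong (d +_) (m+[n∸m]≡n e≤N))))
        (trans (cong suc (+-comm d N)) (trans r+d≡ (*-comm (q ∸ 1) n))))

      codim : n * (q ∸ 1) ∸ suc N ≡ d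
      codim = trans (cong (_∸ r) (trans (*-comm n (q ∸ 1)) (sym r+d≡))) (m+n∸m≡n r d)

      -- The rank q^κ = q · m² beats the m ≥ r symbols of the code words.
      beats : ∀ c → c + 2 ≤ m → suc c * m + suc m ≤ q ^ κ
      beats c c+2≤m = begin
        suc c * m + suc m     ≡⟨ solve 2 (λ c m → (con 1 :+ c) :* m :+ (con 1 :+ m) := (c :+ con 2) :* m :+ con 1) refl c m ⟩
        (c + 2) * m + 1       ≤⟨ +-mono-≤ (*-monoˡ-≤ m c+2≤m) (≤-trans (m^n>0 q k) (m≤m*n m m {{m^n≢0 q k}})) ⟩
        m * m + m * m         ≡⟨ cong (m * m +_) (+-identityʳ _) ⟨
        2 * (m * m)           ≤⟨ *-monoˡ-≤ (m * m) 1<q ⟩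
        q * (m * m)           ≡⟨ cong (q *_) (^-distribˡ-+-* q k k) ⟨
        q ^ κ                 ∎
        where open ≤-Reasoning

      -- The origin of p = q κ: 2^(q κ) = (2^q)^κ and q < 2^q.
      q^κ≤double : q ^ κ ≤ double p
      q^κ≤double = ≤-trans (^-monoˡ-≤ κ (<⇒≤ (n<2^n q))) (≤-reflexive (trans (^-*-assoc 2 q κ) (sym (double≡2^ p))))

      2e+2≤m : e + e + 2 ≤ m
      2e+2≤m = ≤-trans (+-monoʳ-≤ (e + e) {2} {e + e} (+-mono-≤ {1} {e} {1} {e} (s≤s z≤n) (s≤s z≤n)))
        (≤-trans (≤-reflexive (solve 1 (λ e → e :+ e :+ (e :+ e) := con 4 :* e) refl e)) (≤-trans 4e≤N (≤-trans (n≤1+n N) r≤m)))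

      κ≤m : κ + 2 ≤ m
      κ≤m = ≤-trans κ+2≤r r≤m

      large : ∀ w → (∀ {h} → Deg N h → ⟨ f , h ⟩ ≡ ⟨ w , h ⟩) → q ^ κ * q ^ κ ≤ length (support w)
      large w represents = ≤-trans Δ-large (<⇒≤ (far⇒large f codim far w represents))

      inhabitant : ∀ S → Fin (q ^ S)
      inhabitant S = fromℕ< (m^n>0 q S)

      close total : ℕ
      close = length (filter (λ P → distance (f · P) (d + e) <? m) (reedMuller q n e))
      total = length (reedMuller q n e)

      byDivisors : TestFamily f e M (q ^ (e + e)) (double p) → close * q ^ suc m ≤ total
      byDivisors family = cancel-power {close} {total} {S = e + e} m
        (closeCount {d = d} {m = m} family (inhabitant (e + e)) small) (≤-trans (beats (e + e) 2e+2≤m) q^κ≤double)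

      byPoints : TestFamily f e M (q ^ κ) (q ^ κ) → close * q ^ suc m ≤ total
      byPoints family = cancel-power {close} {total} {S = κ} m
        (closeCount {d = d} {m = m} family (inhabitant κ) small) (beats κ κ≤m)

    -- The exponent is q^k + 1 rather than q^k because `fraction≤power` uses up one factor q.
    closeProducts :
      length (filter (λ P → distance (f · P) (d + suc e′) <? q ^ k) (reedMuller q n (suc e′))) * q ^ suc (q ^ k)
      ≤ length (reedMuller q n (suc e′))
    closeProducts = [ byDivisors , byPoints ]′
      (testFamily f {e} {a} {T} {N} {b} {M} refl (m+[n∸m]≡n 2e≤N) (m+[n∸m]≡n w+a≤N)
        (m+n≤o⇒m≤o∸n (q ∸ 1 + a) w+a+2e≤N) T+e≤M e+a≤1+T 2a≤M {q ^ κ} large p p≤e)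

-- The choice of the exponent and of the constants

open Reals
open Counting
open LinearAlgebra using (1<q)
open import Data.Integer.Base using (+_)
open import Data.Nat.Base using (_+_; _*_; _≤_; _<_; _^_; s≤s; z≤n; >-nonZero)
open import Data.Nat.DivMod using (m/n*n≤m; m%n<n; m≡m%n+[m/n]*n; /-monoˡ-≤; m*n/n≡m)
import Data.Nat.DivMod as ℕ using (_/_)
open import Data.Nat.Properties
open import Data.Nat.Solver using (module +-*-Solver)
open import Data.Rational.Base using (_/_; _-_)

open ℝ using (_∋_)

-- The exponent k = ⌊r/B⌋ of Δ′ = q^k, for B large in terms of q and of the lower
-- bounds 1/b₁ for ε and 1/b₂ for δ.
module Exponent (q : ℕ) .{{_ : NonZero q}} (q-prime : Prime q) {b₁ b₂ : ℕ} (1≤b₁ : 1 ≤ b₁) (1≤b₂ : 1 ≤ b₂) where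

  open +-*-Solver using (solve; _:+_; _:*_; _:=_; con)

  -- The first summand of B yields q κ (q - 1) ≤ e, by κ ≤ 3k and r ≤ e b₂; the second yields 2κ b₁
  -- < r, by 2κ < 7k, and hence Δ ≥ q^(2κ). The bound r₀ forces k ≥ 2B + 2, from where on 2^k
  -- exceeds B (k + 1) and so r.
  B r₀ : ℕ
  B  = 3 * (q * q) * b₂ + 7 * b₁
  r₀ = (2 * B + 2) * B

  7≤B : 7 ≤ B
  7≤B = ≤-trans (*-monoʳ-≤ 7 {1} {b₁} 1≤b₁) (m≤n+m (7 * b₁) (3 * (q * q) * b₂))

  instance
    B-nonZero : NonZero B
    B-nonZero = >-nonZero (≤-trans (s≤s z≤n) 7≤B)
    2B-nonZero : NonZero (2 * B)
    2B-nonZero = m*n≢0 2 B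

  linear≤exponential : ∀ k → 2 * B + 2 ≤ k → B * suc k ≤ 2 ^ k
  linear≤exponential k h = subst (λ k → B * suc k ≤ 2 ^ k) (m+[n∸m]≡n h) (go (k ∸ (2 * B + 2)))
    where
    open ≤-Reasoning
    go : ∀ j → B * suc (2 * B + 2 + j) ≤ 2 ^ (2 * B + 2 + j)
    go zero = begin
      B * suc (2 * B + 2 + 0)          ≤⟨ *-mono-≤ (<⇒≤ (n<2^n q q-prime B)) bound ⟩
      2 ^ B * (2 ^ B * 4)              ≡⟨ solve 1 (λ p → p :* (p :* con 4) := (p :* p) :* con 4) refl (2 ^ B) ⟩
      2 ^ B * 2 ^ B * 2 ^ 2            ≡⟨ cong (_* 2 ^ 2) (^-distribˡ-+-* 2 B B) ⟨
      2 ^ (B + B) * 2 ^ 2              ≡⟨ ^-distribˡ-+-* 2 (B + B) 2 ⟨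
      2 ^ (B + B + 2)                  ≡⟨ cong (2 ^_) (solve 1 (λ B → B :+ B :+ con 2 := con 2 :* B :+ con 2 :+ con 0) refl B) ⟩
      2 ^ (2 * B + 2 + 0)              ∎
      where
      bound : suc (2 * B + 2 + 0) ≤ 2 ^ B * 4
      bound = begin
        suc (2 * B + 2 + 0)                   ≤⟨ m≤m+n _ (2 * B + 1) ⟩
        suc (2 * B + 2 + 0) + (2 * B + 1)     ≡⟨ solve 1 (λ B → con 1 :+ (con 2 :* B :+ con 2 :+ con 0) :+ (con 2 :* B :+ con 1) := (con 1 :+ B) :* con 4) refl B ⟩
        suc B * 4                             ≤⟨ *-monoˡ-≤ 4 (n<2^n q q-prime B) ⟩
        2 ^ B * 4                             ∎
    go (suc j) = begin
      B * suc (2 * B + 2 + suc j)                 ≡⟨ solve 2 (λ B j → B :* (con 1 :+ (con 2 :* B :+ con 2 :+ (con 1 :+ j))) :=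
                                                       B :* (con 1 :+ (con 2 :* B :+ con 2 :+ j)) :+ B) refl B j ⟩
      B * suc (2 * B + 2 + j) + B                 ≤⟨ +-mono-≤ (go j) (≤-trans (m≤m*n B (suc (2 * B + 2 + j))) (go j)) ⟩
      2 ^ (2 * B + 2 + j) + 2 ^ (2 * B + 2 + j)   ≡⟨ cong (λ z → 2 ^ (2 * B + 2 + j) + z) (+-identityʳ _) ⟨
      2 ^ suc (2 * B + 2 + j)                     ≡⟨ cong (2 ^_) (+-suc (2 * B + 2) j) ⟨
      2 ^ (2 * B + 2 + suc j)                     ∎

  module _ {r : ℕ} (r₀≤r : r₀ ≤ r) where

    k : ℕ
    k = r ℕ./ B

    kB≤r : k * B ≤ r
    kB≤r = m/n*n≤m r B

    r<B[1+k] : r < B * suc k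
    r<B[1+k] = <-≤-trans (subst (_< B + k * B) (sym (m≡m%n+[m/n]*n r B)) (+-monoˡ-< (k * B) (m%n<n r B)))
      (≤-reflexive (trans (cong (λ z → B + z) (*-comm k B)) (sym (*-suc B k))))

    k-large : 2 * B + 2 ≤ k
    k-large = subst (_≤ k) (m*n/n≡m (2 * B + 2) B) (/-monoˡ-≤ B r₀≤r)

    1≤k : 1 ≤ k
    1≤k = ≤-trans (≤-trans (s≤s z≤n) (m≤n+m 2 (2 * B))) k-large

    r≤q^k : r ≤ q ^ k
    r≤q^k = ≤-trans (<⇒≤ r<B[1+k]) (≤-trans (linear≤exponential k k-large) (^-monoˡ-≤ k (1<q q q-prime)))

    r≤2Bk : r ≤ 2 * B * k
    r≤2Bk = ≤-trans (<⇒≤ r<B[1+k]) (≤-trans (*-monoʳ-≤ B (+-monoˡ-≤ k 1≤k))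
      (≤-reflexive (solve 2 (λ B k → B :* (k :+ k) := con 2 :* B :* k) refl B k)))

    κ : ℕ
    κ = suc (k + k)

    κ+2≤5k : κ + 2 ≤ 5 * k
    κ+2≤5k = ≤-trans (≤-reflexive (solve 1 (λ k → con 1 :+ (k :+ k) :+ con 2 := con 3 :+ con 2 :* k) refl k))
      (≤-trans (+-monoˡ-≤ (2 * k) (*-monoʳ-≤ 3 {1} {k} 1≤k)) (≤-reflexive (sym (*-distribʳ-+ k 3 2))))

    κ+2≤r : κ + 2 ≤ r
    κ+2≤r = ≤-trans κ+2≤5k (≤-trans (*-monoˡ-≤ k {5} {7} (m≤m+n 5 2))
      (≤-trans (*-monoˡ-≤ k 7≤B) (≤-trans (≤-reflexive (*-comm B k)) kB≤r)))

    2κb₁<r : (κ + κ) * b₁ < r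
    2κb₁<r = <-≤-trans (*-monoˡ-< b₁ {{>-nonZero 1≤b₁}} 2κ<7k)
      (≤-trans (≤-reflexive (solve 2 (λ k b → con 7 :* k :* b := k :* (con 7 :* b)) refl k b₁))
        (≤-trans (*-monoʳ-≤ k (m≤n+m (7 * b₁) (3 * (q * q) * b₂))) kB≤r))
      where
      3≤k : 3 ≤ k
      3≤k = ≤-trans (s≤s (s≤s (s≤s z≤n))) (≤-trans 7≤B (≤-trans (m≤m+n B _) (≤-trans (m≤m+n (2 * B) 2) k-large)))
      2κ<7k : κ + κ < 7 * k
      2κ<7k = ≤-trans (≤-reflexive (solve 1 (λ k → con 1 :+ (con 1 :+ (k :+ k) :+ (con 1 :+ (k :+ k))) := con 3 :+ con 4 :* k) refl k))
        (≤-trans (+-monoˡ-≤ (4 * k) 3≤k) (≤-trans (≤-reflexive (solve 1 (λ k → k :+ con 4 :* k := con 5 :* k) refl k))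
          (*-monoˡ-≤ k {5} {7} (m≤m+n 5 2))))

    qκ[q-1]≤e : ∀ {e} → r ≤ e * b₂ → q * κ * (q ∸ 1) ≤ e
    qκ[q-1]≤e {e} r≤eb₂ = *-cancelʳ-≤ _ e b₂ {{>-nonZero 1≤b₂}} (begin
      q * κ * (q ∸ 1) * b₂        ≤⟨ *-monoˡ-≤ b₂ (*-mono-≤ (*-monoʳ-≤ q κ≤3k) (m∸n≤m q 1)) ⟩
      q * (3 * k) * q * b₂        ≡⟨ solve 3 (λ q k b → q :* (con 3 :* k) :* q :* b := k :* (con 3 :* (q :* q) :* b)) refl q k b₂ ⟩
      k * (3 * (q * q) * b₂)      ≤⟨ *-monoʳ-≤ k (m≤m+n _ _) ⟩
      k * B                       ≤⟨ kB≤r ⟩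
      r                           ≤⟨ r≤eb₂ ⟩
      e * b₂                      ∎)
      where
      open ≤-Reasoning
      κ≤3k : κ ≤ 3 * k
      κ≤3k = ≤-trans (+-monoˡ-≤ (k + k) 1≤k) (≤-reflexive (solve 1 (λ k → k :+ (k :+ k) := con 3 :* k) refl k))

theorem1p7 : (q : ℕ) .{{_ : NonZero q}} (q-prime : Prime q) (ε δ : ℝ) →
    ℕ→ℝ 0 <ᴿ ε → ε <ᴿ ℕ→ℝ 1 → ℕ→ℝ 0 <ᴿ δ → δ <ᴿ ℕ→ℝ 1 →
    ∃[ c₁ ] ∃[ c₂ ] ∃[ r₀ ] (ℕ→ℝ 0 <ᴿ c₁ × ℕ→ℝ 0 <ᴿ c₂ ×
    ((n d r Δ e : ℕ) → 1 ≤ n → 1 ≤ d → 1 ≤ r → 1 ≤ Δ → 1 ≤ e →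
    r₀ ≤ r →
    r + d ≡ (q ∸ 1) * n →
    q ^ᴿ (ε ·ᴿ r) ≤ᴿ ℕ→ℝ Δ →
    ℕ→ℝ Δ ≤ᴿ q ^ᴿ ℚ→ℝ (((+ r) / (4 * (q ∸ 1))) {{4*[q∸1]-nonZero q-prime}} - ℕ→ℚ 2) →
    δ ·ᴿ r ≤ᴿ ℕ→ℝ e →
    ℕ→ℝ e ≤ᴿ ℚ→ℝ ((+ r) / 8) →
    ∃[ Δ′ ] (q ^ᴿ (c₁ ·ᴿ r) ≤ᴿ ℕ→ℝ Δ′ ×
    ((f : Fun q n) → Far Δ f d →
    ℚ→ℝ (prCloseProduct f d e Δ′) ≤ᴿ q ^ᴿ (-ᴿ (q ^ᴿ (c₂ ·ᴿ r)))))))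
theorem1p7 q q-prime ε δ 0<ε _ 0<δ _ =
  -- Both constants are 1/(2B): r ≤ 2 B k gives q^(c r) ≤ q^k, so the same k serves for Δ′ = q^k and
  -- for the bound on the probability.
  c , c , r₀ , 0<fraction (2 * B) , 0<fraction (2 * B) , conclusion
  where
  b₁ b₂ : ℕ
  b₁ = proj₁ (positive⇒multiple ε 0<ε)
  b₂ = proj₁ (positive⇒multiple δ 0<δ)
  open Exponent q q-prime {b₁} {b₂} (proj₁ (proj₂ (positive⇒multiple ε 0<ε))) (proj₁ (proj₂ (positive⇒multiple δ 0<δ)))
  c : ℝ
  c = ℚ→ℝ ((+ 1) / (2 * B))
  conclusion : (n d r Δ e : ℕ) → 1 ≤ n → 1 ≤ d → 1 ≤ r → 1 ≤ Δ → 1 ≤ e →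
    r₀ ≤ r →
    r + d ≡ (q ∸ 1) * n →
    q ^ᴿ (ε ·ᴿ r) ≤ᴿ ℕ→ℝ Δ →
    ℕ→ℝ Δ ≤ᴿ q ^ᴿ ℚ→ℝ (((+ r) / (4 * (q ∸ 1))) {{4*[q∸1]-nonZero q-prime}} - ℕ→ℚ 2) →
    δ ·ᴿ r ≤ᴿ ℕ→ℝ e →
    ℕ→ℝ e ≤ᴿ ℚ→ℝ ((+ r) / 8) →
    ∃[ Δ′ ] (q ^ᴿ (c ·ᴿ r) ≤ᴿ ℕ→ℝ Δ′ ×
    ((f : Fun q n) → Far Δ f d →
    ℚ→ℝ (prCloseProduct f d e Δ′) ≤ᴿ q ^ᴿ (-ᴿ (q ^ᴿ (c ·ᴿ r)))))
  conclusion n d (suc N) Δ (suc e′) _ _ _ _ _ r₀≤r r+d≡ qεr≤Δ _ δr≤e e≤r/8 =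
    q ^ exponent , ∌⇒≤ᴿ (q ^ᴿ (c ·ᴿ suc N)) (q ^ exponent) q^cr∌ , λ f far →
      fraction≤power q (q ^ᴿ (c ·ᴿ suc N)) (q ^ exponent)
        (length (filter (λ P → distance (f · P) (d + suc e′) <? q ^ exponent) (reedMuller q n (suc e′))))
        (length (reedMuller q n (suc e′))) {{reedMuller-nonEmpty q n (suc e′)}} q^cr∌
        (closeProducts q q-prime {n} {d} {N} {Δ} {e′} exponent r+d≡ (ℕ→ℝ≤fraction e≤r/8) (r≤q^k r₀≤r) (κ+2≤r r₀≤r)
          (qκ[q-1]≤e r₀≤r (multiple-≤ {δ} {b₂} (proj₂ (proj₂ (positive⇒multiple δ 0<δ))) δr≤e)) Δ-large f far)
    where
    exponent : ℕ
    exponent = k r₀≤r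
    q^cr∌ : ¬ (q ^ᴿ (c ·ᴿ suc N)) ∋ ℕ→ℚ (q ^ exponent)
    q^cr∌ = power∌ q (c ·ᴿ suc N) exponent (scaled∌ (2 * B) (suc N) exponent (r≤2Bk r₀≤r))
    Δ-large : q ^ κ r₀≤r * q ^ κ r₀≤r ≤ Δ
    Δ-large = subst (_≤ Δ) (^-distribˡ-+-* q (κ r₀≤r) (κ r₀≤r))
      (power≤ q {ε ·ᴿ suc N} {Δ} {κ r₀≤r + κ r₀≤r} (proj₂ (proj₂ (positive⇒multiple ε 0<ε)) (κ r₀≤r + κ r₀≤r) (suc N) (2κb₁<r r₀≤r)) qεr≤Δ)
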